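{- For any positive integer $q$, there exists a constant $c_q>0$, depending only on $q$, such that for any positive integer $N$, any real numbers $\varphi_1,\ldots,\varphi_N$, any non-negative real numbers $a_1,\ldots,a_N$, and any real $T>0$, $$c_q\Big(\sum_{n=1}^N a_n^2\Big)^q \le \frac{1}{2T}\int_{|t|\le T}\Big|\sum_{n=1}^N a_n e^{it\varphi_n}\Big|^{2q}\,dt.$$
   Context: Here $t$ is a real variable, $i$ is the imaginary unit, and the integral is the Lebesgue integral over $[-T,T]$. -}

module Defs where

open import Algebra.Bundles using (RawSemiring)
open import Data.Bool.Base using (if_then_else_)
open import Data.Empty using (⊥-elim)
open import Data.Fin.Base using (Fin)
open import Data.Integer.Base as ℤ using (+_)
import Data.Integer.DivMod as ℤ
import Data.Integer.Properties as ℤ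
open import Data.Nat.Base as ℕ using (ℕ; zero; suc; _!)
open import Data.Nat.Coprimality using (Coprime)
import Data.Nat.DivMod as ℕ
open import Data.Nat.Properties as ℕ using (_!≢0)
open import Data.Product.Base using (Σ-syntax; ∃-syntax; _×_; _,_; proj₁; proj₂)
open import Data.Rational.Base as ℚ using (ℚ)
open import Data.Rational.Literals using (fromℤ)
import Data.Rational.Properties as ℚ
open import Data.Rational.Solver using (module +-*-Solver)
open import Data.Sum.Base using (inj₁; inj₂)
open import Level using (0ℓ)
open import Relation.Binary.PropositionalEquality
  using (_≡_; refl; sym; trans; cong; cong₂; subst; subst₂; module ≡-Reasoning)
open import Relation.Nullary using (Dec; yes; no; does)

fromℕ : ℕ → ℚ
fromℕ n = fromℤ (+ n)

module RationalLemmas where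

  open import Data.Rational.Base
  open import Data.Rational.Properties
    using (≤-refl; ≤-trans; ≤-reflexive; <⇒≤; +-mono-≤; +-monoˡ-≤; +-monoʳ-≤)

  *-monoˡ : ∀ {p q r} → 0ℚ ≤ r → p ≤ q → r * p ≤ r * q
  *-monoˡ {r = r} 0≤r = ℚ.*-monoˡ-≤-nonNeg r {{nonNegative 0≤r}}

  *-monoʳ : ∀ {p q r} → 0ℚ ≤ r → p ≤ q → p * r ≤ q * r
  *-monoʳ {r = r} 0≤r = ℚ.*-monoʳ-≤-nonNeg r {{nonNegative 0≤r}}

  *-mono : ∀ {p q r s} → 0ℚ ≤ r → 0ℚ ≤ q → p ≤ q → r ≤ s → p * r ≤ q * s
  *-mono 0≤r 0≤q p≤q r≤s = ≤-trans (*-monoʳ 0≤r p≤q) (*-monoˡ 0≤q r≤s)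

  0≤+ : ∀ {p q} → 0ℚ ≤ p → 0ℚ ≤ q → 0ℚ ≤ p + q
  0≤+ 0≤p 0≤q = ≤-trans (≤-reflexive (sym (ℚ.+-identityˡ 0ℚ))) (+-mono-≤ 0≤p 0≤q)

  0≤* : ∀ {p q} → 0ℚ ≤ p → 0ℚ ≤ q → 0ℚ ≤ p * q
  0≤* {p} 0≤p 0≤q = ≤-trans (≤-reflexive (sym (ℚ.*-zeroʳ p))) (*-monoˡ 0≤p 0≤q)

  0<+ : ∀ {p q} → 0ℚ < p → 0ℚ ≤ q → 0ℚ < p + q
  0<+ 0<p 0≤q = ℚ.≤-<-trans (≤-reflexive (sym (ℚ.+-identityˡ 0ℚ))) (ℚ.+-mono-<-≤ 0<p 0≤q)

  0<* : ∀ {p q} → 0ℚ < p → 0ℚ < q → 0ℚ < p * q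
  0<* {p} {q} 0<p 0<q =
    ℚ.positive⁻¹ (p * q) {{ℚ.pos*pos⇒pos p {{positive 0<p}} q {{positive 0<q}}}}

  0<1 : 0ℚ < 1ℚ
  0<1 = ℚ.positive⁻¹ 1ℚ

  0≤1 : 0ℚ ≤ 1ℚ
  0≤1 = <⇒≤ 0<1

  half : ∀ {ε} → 0ℚ < ε → 0ℚ < ½ * ε
  half = 0<* (ℚ.positive⁻¹ ½)

  half+half : ∀ ε → ½ * ε + ½ * ε ≡ ε
  half+half = solve 1 (λ e → con ½ :* e :+ con ½ :* e := e) refl
    where open +-*-Solver

  inv : (p : ℚ) → 0ℚ < p → ℚ
  inv p 0<p = (1/ p) {{>-nonZero 0<p}}

  inv-r : ∀ p (0<p : 0ℚ < p) → p * inv p 0<p ≡ 1ℚ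
  inv-r p 0<p = ℚ.*-inverseʳ p {{>-nonZero 0<p}}

  inv-pos : ∀ p (0<p : 0ℚ < p) → 0ℚ < inv p 0<p
  inv-pos p 0<p = ℚ.positive⁻¹ (inv p 0<p) {{ℚ.1/pos⇒pos p {{positive 0<p}}}}

  inv-anti : ∀ p q (0<p : 0ℚ < p) (0<q : 0ℚ < q) → p ≤ q → inv q 0<q ≤ inv p 0<p
  inv-anti p q 0<p 0<q p≤q = begin
    q⁻¹              ≡⟨ ℚ.*-identityʳ q⁻¹ ⟨
    q⁻¹ * 1ℚ         ≡⟨ cong (q⁻¹ *_) (inv-r p 0<p) ⟨
    q⁻¹ * (p * p⁻¹)  ≤⟨ *-monoˡ (<⇒≤ (inv-pos q 0<q)) (*-monoʳ (<⇒≤ (inv-pos p 0<p)) p≤q) ⟩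
    q⁻¹ * (q * p⁻¹)  ≡⟨ solve 3 (λ a b c → a :* (b :* c) := (b :* a) :* c) refl q⁻¹ q p⁻¹ ⟩
    (q * q⁻¹) * p⁻¹  ≡⟨ cong (_* p⁻¹) (inv-r q 0<q) ⟩
    1ℚ * p⁻¹         ≡⟨ ℚ.*-identityˡ p⁻¹ ⟩
    p⁻¹              ∎
    where
    open ℚ.≤-Reasoning
    open +-*-Solver
    p⁻¹ = inv p 0<p
    q⁻¹ = inv q 0<q

  p≤∣p∣ : ∀ p → p ≤ ∣ p ∣
  p≤∣p∣ p with ℚ.≤-total 0ℚ p
  ... | inj₁ 0≤p = ≤-reflexive (sym (ℚ.0≤p⇒∣p∣≡p 0≤p))
  ... | inj₂ p≤0 = ≤-trans p≤0 (ℚ.0≤∣p∣ p)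

  ∣∣≤ : ∀ {p c} → p ≤ c → - p ≤ c → ∣ p ∣ ≤ c
  ∣∣≤ {p} p≤c -p≤c with ℚ.∣p∣≡p∨∣p∣≡-p p
  ... | inj₁ eq rewrite eq = p≤c
  ... | inj₂ eq rewrite eq = -p≤c

  dist-sym : ∀ p q → ∣ p - q ∣ ≡ ∣ q - p ∣
  dist-sym p q = trans (sym (ℚ.∣-p∣≡∣p∣ (p - q))) (cong ∣_∣ (lem p q))
    where
    open +-*-Solver
    lem : ∀ p q → - (p - q) ≡ q - p
    lem = solve 2 (λ a b → :- (a :- b) := b :- a) refl

  dist-trans : ∀ p q r → ∣ p - r ∣ ≤ ∣ p - q ∣ + ∣ q - r ∣
  dist-trans p q r =
    ≤-trans (≤-reflexive (cong ∣_∣ (lem p q r))) (ℚ.∣p+q∣≤∣p∣+∣q∣ (p - q) (q - r))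
    where
    open +-*-Solver
    lem : ∀ p q r → p - r ≡ (p - q) + (q - r)
    lem = solve 3 (λ a b c → a :- c := (a :- b) :+ (b :- c)) refl

  dist≤ : ∀ {p q c} → p ≤ q + c → q ≤ p + c → ∣ p - q ∣ ≤ c
  dist≤ {p} {q} {c} p≤q+c q≤p+c = ∣∣≤
    (≤-trans (+-monoˡ-≤ (- q) p≤q+c)
      (≤-reflexive (solve 2 (λ b e → b :+ e :- b := e) refl q c)))
    (≤-trans (≤-reflexive (solve 2 (λ a b → :- (a :- b) := b :- a) refl p q))
      (≤-trans (+-monoˡ-≤ (- p) q≤p+c)
        (≤-reflexive (solve 2 (λ a e → a :+ e :- a := e) refl p c))))
    where open +-*-Solver

  ≤dist : ∀ {p q c} → ∣ p - q ∣ ≤ c → p ≤ q + c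
  ≤dist {p} {q} {c} d = begin
    p            ≡⟨ solve 2 (λ a b → a := b :+ (a :- b)) refl p q ⟩
    q + (p - q)  ≤⟨ +-monoʳ-≤ q (≤-trans (p≤∣p∣ (p - q)) d) ⟩
    q + c        ∎
    where
    open ℚ.≤-Reasoning
    open +-*-Solver

  ≤dist′ : ∀ {p q c} → ∣ p - q ∣ ≤ c → q ≤ p + c
  ≤dist′ {p} {q} d = ≤dist (≤-trans (≤-reflexive (dist-sym q p)) d)

  ⊔-dist : ∀ p q r → ∣ (p ⊔ r) - (q ⊔ r) ∣ ≤ ∣ p - q ∣
  ⊔-dist p q r = dist≤ (side p q ≤-refl) (side q p (≤-reflexive (dist-sym q p)))
    where
    side : ∀ a b {c} → ∣ a - b ∣ ≤ c → a ⊔ r ≤ (b ⊔ r) + c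
    side a b {c} d = ℚ.⊔-lub
      (≤-trans (≤dist {a} {b} d) (+-monoˡ-≤ c (ℚ.p≤p⊔q b r)))
      (≤-trans (ℚ.p≤q⊔p b r)
        (≤-trans (≤-reflexive (sym (ℚ.+-identityʳ (b ⊔ r))))
          (+-monoʳ-≤ (b ⊔ r) (≤-trans (ℚ.0≤∣p∣ (a - b)) d))))

  sq-cancel : ∀ {p q} → 0ℚ ≤ q → p * p ≤ q * q → p ≤ q
  sq-cancel {p} {q} 0≤q p²≤q² with p ℚ.≤? q
  ... | yes p≤q = p≤q
  ... | no  p≰q = ⊥-elim (ℚ.<-irrefl refl (ℚ.<-≤-trans q²<p² p²≤q²))
    where
    q<p : q < p
    q<p = ℚ.≰⇒> p≰q
    0<p : 0ℚ < p
    0<p = ℚ.≤-<-trans 0≤q q<p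
    q²<p² : q * q < p * p
    q²<p² = ℚ.≤-<-trans (*-monoˡ 0≤q (<⇒≤ q<p)) (ℚ.*-monoˡ-<-pos p {{positive 0<p}} q<p)

  fromℤ-mono : ∀ {i j} → i ℤ.≤ j → fromℤ i ≤ fromℤ j
  fromℤ-mono {i} {j} i≤j =
    *≤* (subst₂ ℤ._≤_ (sym (ℤ.*-identityʳ i)) (sym (ℤ.*-identityʳ j)) i≤j)

  fromℕ-mono : ∀ {m n} → m ℕ.≤ n → fromℕ m ≤ fromℕ n
  fromℕ-mono m≤n = fromℤ-mono (ℤ.+≤+ m≤n)

  0≤fromℕ : ∀ n → 0ℚ ≤ fromℕ n
  0≤fromℕ n = fromℕ-mono ℕ.z≤n

  0<fromℕ-suc : ∀ n → 0ℚ < fromℕ (suc n)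
  0<fromℕ-suc n = ℚ.positive⁻¹ (fromℕ (suc n))

  fromℤ-/1 : ∀ i → fromℤ i ≡ i / 1
  fromℤ-/1 i = sym (ℚ.↥p/↧p≡p (fromℤ i))

  fromℤ-* : ∀ i j → fromℤ i * fromℤ j ≡ fromℤ (i ℤ.* j)
  fromℤ-* i j = sym (fromℤ-/1 (i ℤ.* j))

  fromℤ-+ : ∀ i j → fromℤ i + fromℤ j ≡ fromℤ (i ℤ.+ j)
  fromℤ-+ i j = trans
    (cong (_/ 1) (cong₂ ℤ._+_ (ℤ.*-identityʳ i) (ℤ.*-identityʳ j)))
    (sym (fromℤ-/1 (i ℤ.+ j)))

  fromℕ-* : ∀ m n → fromℕ m * fromℕ n ≡ fromℕ (m ℕ.* n)
  fromℕ-* m n = trans (fromℤ-* (+ m) (+ n)) (cong fromℤ (sym (ℤ.pos-* m n)))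

  fromℕ-suc : ∀ n → fromℕ (suc n) ≡ 1ℚ + fromℕ n
  fromℕ-suc n = sym (fromℤ-+ (+ 1) (+ n))

  inv-suc : ℕ → ℚ
  inv-suc n = inv (fromℕ (suc n)) (0<fromℕ-suc n)

  inv-suc-pos : ∀ n → 0ℚ < inv-suc n
  inv-suc-pos n = inv-pos (fromℕ (suc n)) (0<fromℕ-suc n)

  inv-suc-anti : ∀ {m n} → m ℕ.≤ n → inv-suc n ≤ inv-suc m
  inv-suc-anti {m} {n} m≤n =
    inv-anti (fromℕ (suc m)) (fromℕ (suc n)) (0<fromℕ-suc m) (0<fromℕ-suc n) (fromℕ-mono (ℕ.s≤s m≤n))

  ∃fromℕ≥ : ∀ p → ∃[ n ] p ≤ fromℕ n
  ∃fromℕ≥ p@(mkℚ (+ n) d-1 _) = n , *≤* (begin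
    + n ℤ.* + 1         ≡⟨ ℤ.*-identityʳ (+ n) ⟩
    + n                 ≤⟨ ℤ.+≤+ (ℕ.m≤m*n n (suc d-1)) ⟩
    + (n ℕ.* suc d-1)   ≡⟨ ℤ.pos-* n (suc d-1) ⟩
    + n ℤ.* + suc d-1   ∎)
    where open ℤ.≤-Reasoning
  ∃fromℕ≥ (mkℚ ℤ.-[1+ n ] d-1 c) = 0 , ℚ.<⇒≤ (ℚ.negative⁻¹ (mkℚ ℤ.-[1+ n ] d-1 c))

  archimedean : ∀ {ε} → 0ℚ < ε → ∃[ n ] inv-suc n ≤ ε
  archimedean {ε} 0<ε =
    let (n , ε⁻¹≤n) = ∃fromℕ≥ (inv ε 0<ε)
        e = fromℕ (suc n)
        e⁻¹ = inv-suc n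
    in n , (begin
      e⁻¹                     ≡⟨ ℚ.*-identityʳ e⁻¹ ⟨
      e⁻¹ * 1ℚ                ≡⟨ cong (e⁻¹ *_) (inv-r ε 0<ε) ⟨
      e⁻¹ * (ε * inv ε 0<ε)   ≤⟨ *-monoˡ (<⇒≤ (inv-suc-pos n)) (*-monoˡ (<⇒≤ 0<ε)
                                   (≤-trans ε⁻¹≤n (fromℕ-mono (ℕ.n≤1+n n)))) ⟩
      e⁻¹ * (ε * e)           ≡⟨ solve 3 (λ a b c → a :* (b :* c) := (c :* a) :* b) refl e⁻¹ ε e ⟩
      (e * e⁻¹) * ε           ≡⟨ cong (_* ε) (inv-r e (0<fromℕ-suc n)) ⟩
      1ℚ * ε                  ≡⟨ ℚ.*-identityˡ ε ⟩
      ε                       ∎)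
    where
    open ℚ.≤-Reasoning
    open +-*-Solver

IsCauchy : (ℕ → ℚ) → Set
IsCauchy x = ∀ ε → ℚ.0ℚ ℚ.< ε →
  ∃[ n ] (∀ i j → n ℕ.≤ i → n ℕ.≤ j → ℚ.∣ x i ℚ.- x j ∣ ℚ.≤ ε)

module CauchyLemmas where

  open import Data.Rational.Base
  open import Data.Rational.Properties
    using (≤-refl; ≤-trans; ≤-reflexive; <⇒≤; +-mono-≤; +-monoˡ-≤; +-monoʳ-≤)
  open RationalLemmas

  max-prefix : ∀ (x : ℕ → ℚ) n → ∃[ B ] (∀ i → i ℕ.≤ n → ∣ x i ∣ ≤ B)
  max-prefix x zero    = ∣ x 0 ∣ , λ { .0 ℕ.z≤n → ≤-refl }
  max-prefix x (suc n) = B ⊔ ∣ x (suc n) ∣ , bound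
    where
    B  = proj₁ (max-prefix x n)
    ih = proj₂ (max-prefix x n)
    bound : ∀ i → i ℕ.≤ suc n → ∣ x i ∣ ≤ B ⊔ ∣ x (suc n) ∣
    bound i i≤1+n with ℕ.m≤n⇒m<n∨m≡n i≤1+n
    ... | inj₁ (ℕ.s≤s i≤n) = ≤-trans (ih i i≤n) (ℚ.p≤p⊔q B ∣ x (suc n) ∣)
    ... | inj₂ refl        = ℚ.p≤q⊔p B ∣ x (suc n) ∣

  bounded : ∀ x → IsCauchy x → ∃[ B ] (∀ i → ∣ x i ∣ ≤ fromℕ B)
  bounded x cx = M , bound
    where
    n  = proj₁ (cx 1ℚ 0<1)
    B  = proj₁ (max-prefix x n)
    B′ = B + 1ℚ
    M  = proj₁ (∃fromℕ≥ B′)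
    bound : ∀ i → ∣ x i ∣ ≤ fromℕ M
    bound i = ≤-trans (lem (ℕ.≤-total i n)) (proj₂ (∃fromℕ≥ B′))
      where
      open +-*-Solver
      lem : _ → ∣ x i ∣ ≤ B′
      lem (inj₁ i≤n) = ≤-trans (proj₂ (max-prefix x n) i i≤n)
        (≤-trans (≤-reflexive (sym (ℚ.+-identityʳ B))) (+-monoʳ-≤ B 0≤1))
      lem (inj₂ n≤i) = begin
        ∣ x i ∣                    ≡⟨ cong ∣_∣ (solve 2 (λ a b → a := b :+ (a :- b)) refl (x i) (x n)) ⟩
        ∣ x n + (x i - x n) ∣      ≤⟨ ℚ.∣p+q∣≤∣p∣+∣q∣ (x n) (x i - x n) ⟩
        ∣ x n ∣ + ∣ x i - x n ∣    ≤⟨ +-mono-≤ (proj₂ (max-prefix x n) n ℕ.≤-refl)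
                                       (proj₂ (cx 1ℚ 0<1) i n n≤i ℕ.≤-refl) ⟩
        B′                         ∎
        where open ℚ.≤-Reasoning

  const-cauchy : ∀ p → IsCauchy (λ _ → p)
  const-cauchy p ε 0<ε = 0 , λ _ _ _ _ →
    ≤-trans (≤-reflexive (cong ∣_∣ (ℚ.+-inverseʳ p))) (<⇒≤ 0<ε)

  lipschitz : ∀ x (f : ℕ → ℚ) → (∀ i j → ∣ f i - f j ∣ ≤ ∣ x i - x j ∣) → IsCauchy x → IsCauchy f
  lipschitz x f lip cx ε 0<ε =
    let (n , h) = cx ε 0<ε in n , λ i j n≤i n≤j → ≤-trans (lip i j) (h i j n≤i n≤j)

  neg-cauchy : ∀ x → IsCauchy x → IsCauchy (λ i → - x i)
  neg-cauchy x = lipschitz x (λ i → - x i) λ i j → ≤-reflexive (begin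
    ∣ - x i - - x j ∣    ≡⟨ cong ∣_∣ (solve 2 (λ a b → :- a :- :- b := :- (a :- b)) refl (x i) (x j)) ⟩
    ∣ - (x i - x j) ∣    ≡⟨ ℚ.∣-p∣≡∣p∣ (x i - x j) ⟩
    ∣ x i - x j ∣        ∎)
    where
    open ≡-Reasoning
    open +-*-Solver

  abs-cauchy : ∀ x → IsCauchy x → IsCauchy (λ i → ∣ x i ∣)
  abs-cauchy x = lipschitz x (λ i → ∣ x i ∣) λ i j →
    dist≤ (side (x i) (x j) ≤-refl) (side (x j) (x i) (≤-reflexive (dist-sym (x j) (x i))))
    where
    open +-*-Solver
    side : ∀ a b {c} → ∣ a - b ∣ ≤ c → ∣ a ∣ ≤ ∣ b ∣ + c
    side a b {c} d = ≤-trans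
      (≤-reflexive (cong ∣_∣ (solve 2 (λ a b → a := b :+ (a :- b)) refl a b)))
      (≤-trans (ℚ.∣p+q∣≤∣p∣+∣q∣ b (a - b)) (+-monoʳ-≤ ∣ b ∣ d))

  +-cauchy : ∀ x y → IsCauchy x → IsCauchy y → IsCauchy (λ i → x i + y i)
  +-cauchy x y cx cy ε 0<ε =
    let (m , hx) = cx (½ * ε) (half 0<ε)
        (n , hy) = cy (½ * ε) (half 0<ε)
    in m ℕ.⊔ n , λ i j mn≤i mn≤j → begin
      ∣ (x i + y i) - (x j + y j) ∣
        ≡⟨ cong ∣_∣ (solve 4 (λ a b c d → (a :+ b) :- (c :+ d) := (a :- c) :+ (b :- d)) refl
             (x i) (y i) (x j) (y j)) ⟩
      ∣ (x i - x j) + (y i - y j) ∣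
        ≤⟨ ℚ.∣p+q∣≤∣p∣+∣q∣ (x i - x j) (y i - y j) ⟩
      ∣ x i - x j ∣ + ∣ y i - y j ∣
        ≤⟨ +-mono-≤ (hx i j (ℕ.m⊔n≤o⇒m≤o m n mn≤i) (ℕ.m⊔n≤o⇒m≤o m n mn≤j))
                    (hy i j (ℕ.m⊔n≤o⇒n≤o m n mn≤i) (ℕ.m⊔n≤o⇒n≤o m n mn≤j)) ⟩
      ½ * ε + ½ * ε
        ≡⟨ half+half ε ⟩
      ε ∎
    where
    open ℚ.≤-Reasoning
    open +-*-Solver

  *-cauchy : ∀ x y → IsCauchy x → IsCauchy y → IsCauchy (λ i → x i * y i)
  *-cauchy x y cx cy ε 0<ε =
    let (m , hx) = cx δ 0<δ
        (n , hy) = cy δ 0<δ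
    in m ℕ.⊔ n , λ i j mn≤i mn≤j → begin
      ∣ x i * y i - x j * y j ∣
        ≡⟨ cong ∣_∣ (solve 4 (λ a b c d → a :* b :- c :* d := a :* (b :- d) :+ (a :- c) :* d) refl
             (x i) (y i) (x j) (y j)) ⟩
      ∣ x i * (y i - y j) + (x i - x j) * y j ∣
        ≤⟨ ℚ.∣p+q∣≤∣p∣+∣q∣ (x i * (y i - y j)) ((x i - x j) * y j) ⟩
      ∣ x i * (y i - y j) ∣ + ∣ (x i - x j) * y j ∣
        ≡⟨ cong₂ _+_ (ℚ.∣p*q∣≡∣p∣*∣q∣ (x i) (y i - y j)) (ℚ.∣p*q∣≡∣p∣*∣q∣ (x i - x j) (y j)) ⟩
      ∣ x i ∣ * ∣ y i - y j ∣ + ∣ x i - x j ∣ * ∣ y j ∣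
        ≤⟨ +-mono-≤
             (*-mono (ℚ.0≤∣p∣ (y i - y j)) (<⇒≤ 0<B) (x≤B i)
               (hy i j (ℕ.m⊔n≤o⇒n≤o m n mn≤i) (ℕ.m⊔n≤o⇒n≤o m n mn≤j)))
             (*-mono (ℚ.0≤∣p∣ (y j)) (<⇒≤ 0<δ)
               (hx i j (ℕ.m⊔n≤o⇒m≤o m n mn≤i) (ℕ.m⊔n≤o⇒m≤o m n mn≤j)) (y≤B j)) ⟩
      B * δ + δ * B
        ≡⟨ solve 3 (λ b e b⁻¹ → b :* (con ½ :* e :* b⁻¹) :+ (con ½ :* e :* b⁻¹) :* b := (b :* b⁻¹) :* e)
             refl B ε (inv B 0<B) ⟩
      (B * inv B 0<B) * ε
        ≡⟨ cong (_* ε) (inv-r B 0<B) ⟩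
      1ℚ * ε
        ≡⟨ ℚ.*-identityˡ ε ⟩
      ε ∎
    where
    open ℚ.≤-Reasoning
    open +-*-Solver
    Bx = proj₁ (bounded x cx)
    By = proj₁ (bounded y cy)
    B  = fromℕ (suc (Bx ℕ.+ By))
    0<B : 0ℚ < B
    0<B = 0<fromℕ-suc (Bx ℕ.+ By)
    x≤B : ∀ i → ∣ x i ∣ ≤ B
    x≤B i = ≤-trans (proj₂ (bounded x cx) i) (fromℕ-mono (ℕ.m≤n⇒m≤1+n (ℕ.m≤m+n Bx By)))
    y≤B : ∀ i → ∣ y i ∣ ≤ B
    y≤B i = ≤-trans (proj₂ (bounded y cy) i) (fromℕ-mono (ℕ.m≤n⇒m≤1+n (ℕ.m≤n+m By Bx)))
    δ = ½ * ε * inv B 0<B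
    0<δ : 0ℚ < δ
    0<δ = 0<* (half 0<ε) (inv-pos B 0<B)

  0<⊔ : ∀ p {δ} → 0ℚ < δ → 0ℚ < p ⊔ δ
  0<⊔ p {δ} 0<δ = ℚ.<-≤-trans 0<δ (ℚ.p≤q⊔p p δ)

  inv-dist : ∀ {p q δ} (0<p : 0ℚ < p) (0<q : 0ℚ < q) (0<δ : 0ℚ < δ) → δ ≤ p → δ ≤ q →
             ∣ inv p 0<p - inv q 0<q ∣ ≤ ∣ p - q ∣ * (inv δ 0<δ * inv δ 0<δ)
  inv-dist {p} {q} {δ} 0<p 0<q 0<δ δ≤p δ≤q = begin
    ∣ p⁻¹ - q⁻¹ ∣
      ≡⟨ cong ∣_∣ eq ⟩
    ∣ (q - p) * (p⁻¹ * q⁻¹) ∣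
      ≡⟨ ℚ.∣p*q∣≡∣p∣*∣q∣ (q - p) (p⁻¹ * q⁻¹) ⟩
    ∣ q - p ∣ * ∣ p⁻¹ * q⁻¹ ∣
      ≡⟨ cong₂ _*_ (dist-sym q p) (ℚ.0≤p⇒∣p∣≡p (0≤* 0≤p⁻¹ 0≤q⁻¹)) ⟩
    ∣ p - q ∣ * (p⁻¹ * q⁻¹)
      ≤⟨ *-monoˡ (ℚ.0≤∣p∣ (p - q))
           (*-mono 0≤q⁻¹ (<⇒≤ (inv-pos δ 0<δ)) (inv-anti δ p 0<δ 0<p δ≤p) (inv-anti δ q 0<δ 0<q δ≤q)) ⟩
    ∣ p - q ∣ * (inv δ 0<δ * inv δ 0<δ) ∎
    where
    open ℚ.≤-Reasoning
    open +-*-Solver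
    p⁻¹ = inv p 0<p
    q⁻¹ = inv q 0<q
    0≤p⁻¹ = <⇒≤ (inv-pos p 0<p)
    0≤q⁻¹ = <⇒≤ (inv-pos q 0<q)
    eq : p⁻¹ - q⁻¹ ≡ (q - p) * (p⁻¹ * q⁻¹)
    eq = begin-equality
      p⁻¹ - q⁻¹
        ≡⟨ cong₂ _-_ (ℚ.*-identityˡ p⁻¹) (ℚ.*-identityˡ q⁻¹) ⟨
      1ℚ * p⁻¹ - 1ℚ * q⁻¹
        ≡⟨ cong₂ (λ a b → a * p⁻¹ - b * q⁻¹) (inv-r q 0<q) (inv-r p 0<p) ⟨
      (q * q⁻¹) * p⁻¹ - (p * p⁻¹) * q⁻¹
        ≡⟨ solve 4 (λ a b a′ b′ → (b :* b′) :* a′ :- (a :* a′) :* b′ := (b :- a) :* (a′ :* b′)) refl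
             p q p⁻¹ q⁻¹ ⟩
      (q - p) * (p⁻¹ * q⁻¹) ∎

  inv-cauchy : ∀ x {δ} (0<δ : 0ℚ < δ) → IsCauchy x → IsCauchy (λ i → inv (x i ⊔ δ) (0<⊔ (x i) 0<δ))
  inv-cauchy x {δ} 0<δ cx ε 0<ε =
    let (n , h) = cx (ε * (δ * δ)) (0<* 0<ε (0<* 0<δ 0<δ))
    in n , λ i j n≤i n≤j → begin
      ∣ inv (x i ⊔ δ) (0<⊔ (x i) 0<δ) - inv (x j ⊔ δ) (0<⊔ (x j) 0<δ) ∣
        ≤⟨ inv-dist (0<⊔ (x i) 0<δ) (0<⊔ (x j) 0<δ) 0<δ (ℚ.p≤q⊔p (x i) δ) (ℚ.p≤q⊔p (x j) δ) ⟩
      ∣ (x i ⊔ δ) - (x j ⊔ δ) ∣ * (δ⁻¹ * δ⁻¹)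
        ≤⟨ *-monoʳ (0≤* 0≤δ⁻¹ 0≤δ⁻¹) (≤-trans (⊔-dist (x i) (x j) δ) (h i j n≤i n≤j)) ⟩
      ε * (δ * δ) * (δ⁻¹ * δ⁻¹)
        ≡⟨ solve 3 (λ e d d′ → e :* (d :* d) :* (d′ :* d′) := e :* ((d :* d′) :* (d :* d′))) refl ε δ δ⁻¹ ⟩
      ε * ((δ * δ⁻¹) * (δ * δ⁻¹))
        ≡⟨ cong (λ a → ε * (a * a)) (inv-r δ 0<δ) ⟩
      ε * (1ℚ * 1ℚ)
        ≡⟨ ℚ.*-identityʳ ε ⟩
      ε ∎
    where
    open ℚ.≤-Reasoning
    open +-*-Solver
    δ⁻¹ = inv δ 0<δ
    0≤δ⁻¹ = <⇒≤ (inv-pos δ 0<δ)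

isqrt : ℕ → ℕ
isqrt zero    = zero
isqrt (suc n) with suc (isqrt n) ℕ.* suc (isqrt n) ℕ.≤? suc n
... | yes _ = suc (isqrt n)
... | no  _ = isqrt n

-- With M = i + 1, this is ⌊√(M²p)⌋ / M, for p replaced by its positive part.
sqrtApprox : ℕ → ℚ → ℚ
sqrtApprox i p =
  fromℕ (isqrt ℤ.∣ ℚ.floor ((p ℚ.⊔ ℚ.0ℚ) ℚ.* fromℕ (suc i ℕ.* suc i)) ∣) ℚ.* RationalLemmas.inv-suc i

module SqrtLemmas where

  open import Data.Rational.Base
  open import Data.Rational.Properties
    using (≤-refl; ≤-trans; ≤-reflexive; <⇒≤; +-mono-≤; +-monoˡ-≤; +-monoʳ-≤)
  open RationalLemmas
  open CauchyLemmas

  isqrt-lower : ∀ n → isqrt n ℕ.* isqrt n ℕ.≤ n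
  isqrt-lower zero = ℕ.z≤n
  isqrt-lower (suc n) with suc (isqrt n) ℕ.* suc (isqrt n) ℕ.≤? suc n
  ... | yes p = p
  ... | no  _ = ℕ.m≤n⇒m≤1+n (isqrt-lower n)

  isqrt-upper : ∀ n → n ℕ.< suc (isqrt n) ℕ.* suc (isqrt n)
  isqrt-upper zero = ℕ.s≤s ℕ.z≤n
  isqrt-upper (suc n) with suc (isqrt n) ℕ.* suc (isqrt n) ℕ.≤? suc n
  ... | yes _ = ℕ.<-≤-trans (ℕ.s≤s (isqrt-upper n))
                  (ℕ.*-mono-< (ℕ.n<1+n (suc (isqrt n))) (ℕ.n<1+n (suc (isqrt n))))
  ... | no  p = ℕ.≰⇒> p

  ⌊_⌋ₙ : ℚ → ℕ
  ⌊ p ⌋ₙ = ℤ.∣ floor p ∣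

  floor-+ : ∀ n d-1 .(c : Coprime n (suc d-1)) → ⌊ mkℚ (+ n) d-1 c ⌋ₙ ≡ n ℕ./ suc d-1
  floor-+ n d-1 c = cong ℤ.∣_∣ (ℤ.*-identityˡ (+ (n ℕ./ suc d-1)))

  floor-lower : ∀ {p} → 0ℚ ≤ p → fromℕ ⌊ p ⌋ₙ ≤ p
  floor-lower {p@(mkℚ (+ n) d-1 c)} _ = *≤* (begin
    + ⌊ p ⌋ₙ ℤ.* + suc d-1          ≡⟨ cong (λ m → + m ℤ.* + suc d-1) (floor-+ n d-1 c) ⟩
    + (n ℕ./ suc d-1) ℤ.* + suc d-1 ≡⟨ ℤ.pos-* (n ℕ./ suc d-1) (suc d-1) ⟨
    + (n ℕ./ suc d-1 ℕ.* suc d-1)   ≤⟨ ℤ.+≤+ (ℕ.m/n*n≤m n (suc d-1)) ⟩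
    + n                             ≡⟨ ℤ.*-identityʳ (+ n) ⟨
    + n ℤ.* + 1                     ∎)
    where open ℤ.≤-Reasoning
  floor-lower {mkℚ ℤ.-[1+ n ] d-1 c} 0≤p =
    ⊥-elim (ℚ.<-irrefl refl (ℚ.≤-<-trans 0≤p (ℚ.negative⁻¹ (mkℚ ℤ.-[1+ n ] d-1 c))))

  floor-upper : ∀ {p} → 0ℚ ≤ p → p ≤ fromℕ (suc ⌊ p ⌋ₙ)
  floor-upper {p@(mkℚ (+ n) d-1 c)} _ = *≤* (begin
    + n ℤ.* + 1                               ≡⟨ ℤ.*-identityʳ (+ n) ⟩
    + n                                       ≡⟨ cong +_ (ℕ.m≡m%n+[m/n]*n n d) ⟩
    + (n ℕ.% d ℕ.+ n ℕ./ d ℕ.* d)             ≤⟨ ℤ.+≤+ (ℕ.+-monoˡ-≤ (n ℕ./ d ℕ.* d) (ℕ.<⇒≤ (ℕ.m%n<n n d))) ⟩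
    + (suc (n ℕ./ d) ℕ.* d)                   ≡⟨ cong (λ m → + (suc m ℕ.* d)) (floor-+ n d-1 c) ⟨
    + (suc ⌊ p ⌋ₙ ℕ.* d)                      ≡⟨ ℤ.pos-* (suc ⌊ p ⌋ₙ) d ⟩
    + suc ⌊ p ⌋ₙ ℤ.* + d                      ∎)
    where
    open ℤ.≤-Reasoning
    d = suc d-1
  floor-upper {mkℚ ℤ.-[1+ n ] d-1 c} 0≤p =
    ⊥-elim (ℚ.<-irrefl refl (ℚ.≤-<-trans 0≤p (ℚ.negative⁻¹ (mkℚ ℤ.-[1+ n ] d-1 c))))

  0≤⊔ : ∀ p → 0ℚ ≤ p ⊔ 0ℚ
  0≤⊔ p = ℚ.p≤q⊔p p 0ℚ

  module _ (i : ℕ) (p : ℚ) where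

    open +-*-Solver

    private
      M = suc i
      e = inv-suc i
      0≤e = <⇒≤ (inv-suc-pos i)
      p⁺ = p ⊔ 0ℚ
      P = p⁺ * fromℕ (M ℕ.* M)
      0≤P : 0ℚ ≤ P
      0≤P = 0≤* (0≤⊔ p) (0≤fromℕ (M ℕ.* M))
      k = isqrt ⌊ P ⌋ₙ

      P·e² : P * (e * e) ≡ p⁺
      P·e² = begin
        p⁺ * fromℕ (M ℕ.* M) * (e * e)
          ≡⟨ cong (λ q → p⁺ * q * (e * e)) (fromℕ-* M M) ⟨
        p⁺ * (fromℕ M * fromℕ M) * (e * e)
          ≡⟨ solve 3 (λ p m e → p :* (m :* m) :* (e :* e) := p :* ((m :* e) :* (m :* e))) refl p⁺ (fromℕ M) e ⟩
        p⁺ * ((fromℕ M * e) * (fromℕ M * e))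
          ≡⟨ cong (λ q → p⁺ * (q * q)) (inv-r (fromℕ M) (0<fromℕ-suc i)) ⟩
        p⁺ * (1ℚ * 1ℚ)
          ≡⟨ ℚ.*-identityʳ p⁺ ⟩
        p⁺ ∎
        where open ≡-Reasoning

    sqrtApprox-nonNeg : 0ℚ ≤ sqrtApprox i p
    sqrtApprox-nonNeg = 0≤* (0≤fromℕ k) 0≤e

    sqrtApprox-lower : sqrtApprox i p * sqrtApprox i p ≤ p ⊔ 0ℚ
    sqrtApprox-lower = begin
      (fromℕ k * e) * (fromℕ k * e)
        ≡⟨ solve 2 (λ k e → (k :* e) :* (k :* e) := (k :* k) :* (e :* e)) refl (fromℕ k) e ⟩
      (fromℕ k * fromℕ k) * (e * e)
        ≡⟨ cong (_* (e * e)) (fromℕ-* k k) ⟩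
      fromℕ (k ℕ.* k) * (e * e)
        ≤⟨ *-monoʳ (0≤* 0≤e 0≤e) (≤-trans (fromℕ-mono (isqrt-lower ⌊ P ⌋ₙ)) (floor-lower 0≤P)) ⟩
      P * (e * e)
        ≡⟨ P·e² ⟩
      p⁺ ∎
      where open ℚ.≤-Reasoning

    sqrtApprox-upper : p ⊔ 0ℚ ≤ (sqrtApprox i p + inv-suc i) * (sqrtApprox i p + inv-suc i)
    sqrtApprox-upper = begin
      p⁺
        ≡⟨ P·e² ⟨
      P * (e * e)
        ≤⟨ *-monoʳ (0≤* 0≤e 0≤e) (≤-trans (floor-upper 0≤P) (fromℕ-mono (isqrt-upper ⌊ P ⌋ₙ))) ⟩
      fromℕ (suc k ℕ.* suc k) * (e * e)
        ≡⟨ cong (_* (e * e)) (fromℕ-* (suc k) (suc k)) ⟨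
      (fromℕ (suc k) * fromℕ (suc k)) * (e * e)
        ≡⟨ cong (λ q → (q * q) * (e * e)) (fromℕ-suc k) ⟩
      ((1ℚ + fromℕ k) * (1ℚ + fromℕ k)) * (e * e)
        ≡⟨ solve 2 (λ k e → ((con 1ℚ :+ k) :* (con 1ℚ :+ k)) :* (e :* e) :=
                            (k :* e :+ e) :* (k :* e :+ e)) refl (fromℕ k) e ⟩
      (fromℕ k * e + e) * (fromℕ k * e + e) ∎
      where open ℚ.≤-Reasoning

  sqrtApprox-step : ∀ i j {p q ε} → 0ℚ < ε → inv-suc j ≤ ε → ∣ p - q ∣ ≤ ε * ε →
                    sqrtApprox i p ≤ sqrtApprox j q + (ε + ε)
  sqrtApprox-step i j {p} {q} {ε} 0<ε e≤ε d = sq-cancel {sqrtApprox i p} {sqrtApprox j q + (ε + ε)} (0≤+ 0≤s (0≤+ 0≤ε 0≤ε)) (begin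
    sqrtApprox i p * sqrtApprox i p
      ≤⟨ sqrtApprox-lower i p ⟩
    p ⊔ 0ℚ
      ≤⟨ ≤dist {p ⊔ 0ℚ} {q ⊔ 0ℚ} (≤-trans (⊔-dist p q 0ℚ) d) ⟩
    (q ⊔ 0ℚ) + ε * ε
      ≤⟨ +-monoˡ-≤ (ε * ε) (sqrtApprox-upper j q) ⟩
    (s + inv-suc j) * (s + inv-suc j) + ε * ε
      ≤⟨ +-monoˡ-≤ (ε * ε) (*-mono 0≤s+e (≤-trans 0≤s+e s+e≤s+ε) s+e≤s+ε s+e≤s+ε) ⟩
    (s + ε) * (s + ε) + ε * ε
      ≡⟨ ℚ.+-identityʳ ((s + ε) * (s + ε) + ε * ε) ⟨
    (s + ε) * (s + ε) + ε * ε + 0ℚ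
      ≤⟨ +-monoʳ-≤ ((s + ε) * (s + ε) + ε * ε) (0≤* (0≤+ 0≤s 0≤ε) (0≤+ 0≤ε 0≤ε)) ⟩
    (s + ε) * (s + ε) + ε * ε + (s + ε) * (ε + ε)
      ≡⟨ solve 2 (λ s e → (s :+ e) :* (s :+ e) :+ e :* e :+ (s :+ e) :* (e :+ e) :=
                          (s :+ (e :+ e)) :* (s :+ (e :+ e))) refl s ε ⟩
    (s + (ε + ε)) * (s + (ε + ε)) ∎)
    where
    open ℚ.≤-Reasoning
    open +-*-Solver
    s = sqrtApprox j q
    0≤ε = <⇒≤ 0<ε
    0≤s = sqrtApprox-nonNeg j q
    0≤s+e : 0ℚ ≤ s + inv-suc j
    0≤s+e = 0≤+ 0≤s (<⇒≤ (inv-suc-pos j))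
    s+e≤s+ε : s + inv-suc j ≤ s + ε
    s+e≤s+ε = +-monoʳ-≤ s e≤ε

  sqrt-cauchy : ∀ x → IsCauchy x → IsCauchy (λ i → sqrtApprox i (x i))
  sqrt-cauchy x cx ε 0<ε =
    let (m , hx) = cx (η * η) (0<* 0<η 0<η)
        (n , e≤) = archimedean 0<η
        step : ∀ i j → m ℕ.⊔ n ℕ.≤ i → m ℕ.⊔ n ℕ.≤ j →
               sqrtApprox i (x i) ≤ sqrtApprox j (x j) + (η + η)
        step i j mn≤i mn≤j = sqrtApprox-step i j {x i} {x j} 0<η
          (≤-trans (inv-suc-anti (ℕ.m⊔n≤o⇒n≤o m n mn≤j)) e≤)
          (hx i j (ℕ.m⊔n≤o⇒m≤o m n mn≤i) (ℕ.m⊔n≤o⇒m≤o m n mn≤j))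
    in m ℕ.⊔ n , λ i j mn≤i mn≤j →
      ≤-trans (dist≤ {sqrtApprox i (x i)} {sqrtApprox j (x j)} (step i j mn≤i mn≤j) (step j i mn≤j mn≤i)) (≤-reflexive (half+half ε))
    where
    η = ½ * ε
    0<η : 0ℚ < η
    0<η = half 0<ε

-- Real numbers are Cauchy sequences of rationals, identified along _≈_ rather than _≡_.
record ℝ : Set where
  no-eta-equality
  field
    seq      : ℕ → ℚ
    isCauchy : IsCauchy seq

open ℝ

infix  4 _≈_ _≤_ _<_
infixl 6 _+_ _-_
infixl 7 _*_
infix  8 -_ √_

record _≈_ (x y : ℝ) : Set where
  constructor mk≈
  field
    eventually≈ : ∀ ε → ℚ.0ℚ ℚ.< ε → ∃[ n ] (∀ i → n ℕ.≤ i → ℚ.∣ seq x i ℚ.- seq y i ∣ ℚ.≤ ε)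

record _≤_ (x y : ℝ) : Set where
  constructor mk≤
  field
    eventually≤ : ∀ ε → ℚ.0ℚ ℚ.< ε → ∃[ n ] (∀ i → n ℕ.≤ i → seq x i ℚ.≤ seq y i ℚ.+ ε)

open _≤_

record _<_ (x y : ℝ) : Set where
  constructor mk<
  field
    gap         : ℚ
    0<gap       : ℚ.0ℚ ℚ.< gap
    eventually< : ∃[ n ] (∀ i → n ℕ.≤ i → seq x i ℚ.+ gap ℚ.≤ seq y i)

fromℚ : ℚ → ℝ
fromℚ p .seq _    = p
fromℚ p .isCauchy = CauchyLemmas.const-cauchy p

0ℝ 1ℝ 2ℝ : ℝ
0ℝ = fromℚ ℚ.0ℚ
1ℝ = fromℚ ℚ.1ℚ
2ℝ = fromℚ (fromℕ 2)

_+_ : ℝ → ℝ → ℝ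
(x + y) .seq i    = seq x i ℚ.+ seq y i
(x + y) .isCauchy = CauchyLemmas.+-cauchy (seq x) (seq y) (isCauchy x) (isCauchy y)

_*_ : ℝ → ℝ → ℝ
(x * y) .seq i    = seq x i ℚ.* seq y i
(x * y) .isCauchy = CauchyLemmas.*-cauchy (seq x) (seq y) (isCauchy x) (isCauchy y)

-_ : ℝ → ℝ
(- x) .seq i    = ℚ.- seq x i
(- x) .isCauchy = CauchyLemmas.neg-cauchy (seq x) (isCauchy x)

_-_ : ℝ → ℝ → ℝ
x - y = x + (- y)

∣_∣ : ℝ → ℝ
∣ x ∣ .seq i    = ℚ.∣ seq x i ∣
∣ x ∣ .isCauchy = CauchyLemmas.abs-cauchy (seq x) (isCauchy x)

-- Truncated to √0 = 0 at negative arguments.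
√_ : ℝ → ℝ
(√ x) .seq i    = sqrtApprox i (seq x i)
(√ x) .isCauchy = SqrtLemmas.sqrt-cauchy (seq x) (isCauchy x)

-- Positivity supplies a rational δ > 0 with δ ≤ xᵢ for all large i, so replacing xᵢ by
-- max(xᵢ, δ) leaves the limit unchanged and makes every term invertible.
recip : (x : ℝ) → 0ℝ < x → ℝ
recip x (mk< δ 0<δ _) .seq i    = RationalLemmas.inv (seq x i ℚ.⊔ δ) (CauchyLemmas.0<⊔ (seq x i) 0<δ)
recip x (mk< δ 0<δ _) .isCauchy = CauchyLemmas.inv-cauchy (seq x) 0<δ (isCauchy x)

2*-pos : ∀ {x} → 0ℝ < x → 0ℝ < 2ℝ * x
2*-pos {x} (mk< δ 0<δ (n , δ≤x)) = mk< δ 0<δ (n , λ i n≤i → begin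
  ℚ.0ℚ ℚ.+ δ                   ≡⟨ ℚ.+-identityˡ δ ⟩
  δ                            ≡⟨ ℚ.+-identityʳ δ ⟨
  δ ℚ.+ ℚ.0ℚ                   ≤⟨ ℚ.+-mono-≤ (δ≤xᵢ i n≤i) (ℚ.≤-trans (ℚ.<⇒≤ 0<δ) (δ≤xᵢ i n≤i)) ⟩
  seq x i ℚ.+ seq x i          ≡⟨ solve 1 (λ a → a :+ a := con (fromℕ 2) :* a) refl (seq x i) ⟩
  fromℕ 2 ℚ.* seq x i          ∎)
  where
  open ℚ.≤-Reasoning
  open +-*-Solver
  δ≤xᵢ : ∀ i → n ℕ.≤ i → δ ℚ.≤ seq x i
  δ≤xᵢ i n≤i = ℚ.≤-trans (ℚ.≤-reflexive (sym (ℚ.+-identityˡ δ))) (δ≤x i n≤i)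

ℝ-rawSemiring : RawSemiring 0ℓ 0ℓ
ℝ-rawSemiring = record { Carrier = ℝ ; _≈_ = _≈_ ; _+_ = _+_ ; _*_ = _*_ ; 0# = 0ℝ ; 1# = 1ℝ }

open import Algebra.Definitions.RawSemiring ℝ-rawSemiring public using (sum; _^_)

IsCauchySequence : (ℕ → ℝ) → Set
IsCauchySequence X = ∀ ε → ℚ.0ℚ ℚ.< ε →
  ∃[ n ] (∀ i j → n ℕ.≤ i → n ℕ.≤ j → ∣ X i - X j ∣ ≤ fromℚ ε)

module Limit (X : ℕ → ℝ) (cX : IsCauchySequence X) where

  open RationalLemmas

  index : ℕ → ℕ
  index n = proj₁ (cX (inv-suc n) (inv-suc-pos n))

  depth : ℕ → ℕ
  depth n = proj₁ (isCauchy (X (index n)) (inv-suc n) (inv-suc-pos n))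

  diagonal : ℕ → ℚ
  diagonal n = seq (X (index n)) (depth n)

  diagonal-close : ∀ n {δ} → ℚ.0ℚ ℚ.< δ → inv-suc n ℚ.≤ δ → ∀ p → index n ℕ.≤ p →
    ∃[ m ] (∀ k → m ℕ.≤ k → ℚ.∣ diagonal n ℚ.- seq (X p) k ∣ ℚ.≤ δ ℚ.+ (δ ℚ.+ δ))
  diagonal-close n {δ} 0<δ e≤δ p N≤p =
    let N = index n
        (m , h) = eventually≤ (proj₂ (cX (inv-suc n) (inv-suc-pos n)) N p ℕ.≤-refl N≤p) δ 0<δ
        d = depth n
    in m ℕ.⊔ d , λ k md≤k → ℚ.≤-trans (dist-trans (diagonal n) (seq (X N) k) (seq (X p) k))
         (ℚ.+-mono-≤
           (ℚ.≤-trans (proj₂ (isCauchy (X N) (inv-suc n) (inv-suc-pos n)) d k ℕ.≤-refl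
                        (ℕ.m⊔n≤o⇒n≤o m d md≤k)) e≤δ)
           (ℚ.≤-trans (h k (ℕ.m⊔n≤o⇒m≤o m d md≤k)) (ℚ.+-monoˡ-≤ δ e≤δ)))

  diagonal-cauchy : IsCauchy diagonal
  diagonal-cauchy ε 0<ε = K , λ i j K≤i K≤j →
    let p = index i ℕ.⊔ index j
        (m , hi) = diagonal-close i 0<δ (ℚ.≤-trans (inv-suc-anti K≤i) K≤δ) p (ℕ.m≤m⊔n (index i) (index j))
        (n , hj) = diagonal-close j 0<δ (ℚ.≤-trans (inv-suc-anti K≤j) K≤δ) p (ℕ.m≤n⊔m (index i) (index j))
        k = m ℕ.⊔ n
        Xₚ = seq (X p) k
    in begin
      ℚ.∣ diagonal i ℚ.- diagonal j ∣
        ≤⟨ dist-trans (diagonal i) Xₚ (diagonal j) ⟩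
      ℚ.∣ diagonal i ℚ.- Xₚ ∣ ℚ.+ ℚ.∣ Xₚ ℚ.- diagonal j ∣
        ≡⟨ cong (ℚ.∣ diagonal i ℚ.- Xₚ ∣ ℚ.+_) (dist-sym Xₚ (diagonal j)) ⟩
      ℚ.∣ diagonal i ℚ.- Xₚ ∣ ℚ.+ ℚ.∣ diagonal j ℚ.- Xₚ ∣
        ≤⟨ ℚ.+-mono-≤ (hi k (ℕ.m≤m⊔n m n)) (hj k (ℕ.m≤n⊔m m n)) ⟩
      (δ ℚ.+ (δ ℚ.+ δ)) ℚ.+ (δ ℚ.+ (δ ℚ.+ δ))
        ≡⟨ solve 1 (λ e → let d = con (+ 1 ℚ./ 6) :* e in
             (d :+ (d :+ d)) :+ (d :+ (d :+ d)) := e) refl ε ⟩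
      ε ∎
    where
    open ℚ.≤-Reasoning
    open +-*-Solver
    δ = + 1 ℚ./ 6 ℚ.* ε
    0<δ : ℚ.0ℚ ℚ.< δ
    0<δ = 0<* (ℚ.positive⁻¹ (+ 1 ℚ./ 6)) 0<ε
    K = proj₁ (archimedean 0<δ)
    K≤δ = proj₂ (archimedean 0<δ)

lim : (X : ℕ → ℝ) → IsCauchySequence X → ℝ
lim X cX .seq      = Limit.diagonal X cX
lim X cX .isCauchy = Limit.diagonal-cauchy X cX

partialSum : (ℕ → ℝ) → ℕ → ℝ
partialSum u zero    = 0ℝ
partialSum u (suc n) = partialSum u n + u n

HasSum : (ℕ → ℝ) → ℝ → Set
HasSum u s = ∀ ε → ℚ.0ℚ ℚ.< ε → ∃[ n ] (∀ i → n ℕ.≤ i → ∣ partialSum u i - s ∣ ≤ fromℚ ε)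

Summable : (ℕ → ℝ) → Set
Summable u = ∃[ s ] HasSum u s

record ℂ : Set where
  constructor _+i_
  field
    re : ℝ
    im : ℝ

open ℂ

infixl 6 _+ᶜ_
infixl 7 _*ᶜ_ _·_

_≈ᶜ_ : ℂ → ℂ → Set
z ≈ᶜ w = re z ≈ re w × im z ≈ im w

0ᶜ 1ᶜ 𝕚 : ℂ
0ᶜ = 0ℝ +i 0ℝ
1ᶜ = 1ℝ +i 0ℝ
𝕚  = 0ℝ +i 1ℝ

_+ᶜ_ _*ᶜ_ : ℂ → ℂ → ℂ
(a +i b) +ᶜ (c +i d) = (a + c) +i (b + d)
(a +i b) *ᶜ (c +i d) = (a * c - b * d) +i (a * d + b * c)

_·_ : ℝ → ℂ → ℂ
r · (a +i b) = (r * a) +i (r * b)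

∣_∣ᶜ : ℂ → ℝ
∣ a +i b ∣ᶜ = √ (a * a + b * b)

ℂ-rawSemiring : RawSemiring 0ℓ 0ℓ
ℂ-rawSemiring = record { Carrier = ℂ ; _≈_ = _≈ᶜ_ ; _+_ = _+ᶜ_ ; _*_ = _*ᶜ_ ; 0# = 0ᶜ ; 1# = 1ᶜ }

open import Algebra.Definitions.RawSemiring ℂ-rawSemiring public using () renaming (sum to sumᶜ; _^_ to _^ᶜ_)

expTerm : ℂ → ℕ → ℂ
expTerm z k = fromℚ (+ 1 ℚ./ k !) · z ^ᶜ k
  where instance _ = k !≢0

module ExpLemmas where

  open RationalLemmas
  open CauchyLemmas using (bounded)
  open +-*-Solver

  module _ (u : ℕ → ℝ) (c : ℕ → ℚ) (K : ℕ)
           (u≤c : ∀ k j → ℚ.∣ seq (u k) j ∣ ℚ.≤ c k)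
           (halving : ∀ k → K ℕ.≤ k → c (suc k) ℚ.+ c (suc k) ℚ.≤ c k) where

    open ℚ.≤-Reasoning

    private
      S : ℕ → ℕ → ℚ
      S n j = seq (partialSum u n) j

      0≤c : ∀ k → ℚ.0ℚ ℚ.≤ c k
      0≤c k = ℚ.≤-trans (ℚ.0≤∣p∣ (seq (u k) 0)) (u≤c k 0)

      tail : ∀ m j → K ℕ.≤ m → ∀ d →
        ℚ.∣ S (d ℕ.+ m) j ℚ.- S m j ∣ ℚ.+ (c (d ℕ.+ m) ℚ.+ c (d ℕ.+ m)) ℚ.≤ c m ℚ.+ c m
      tail m j K≤m zero = ℚ.≤-reflexive
        (trans (cong (λ q → ℚ.∣ q ∣ ℚ.+ (c m ℚ.+ c m)) (ℚ.+-inverseʳ (S m j))) (ℚ.+-identityˡ (c m ℚ.+ c m)))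
      tail m j K≤m (suc d) = begin
        ℚ.∣ (S n j ℚ.+ seq (u n) j) ℚ.- S m j ∣ ℚ.+ (c (suc n) ℚ.+ c (suc n))
          ≡⟨ cong (λ q → ℚ.∣ q ∣ ℚ.+ (c (suc n) ℚ.+ c (suc n)))
               (solve 3 (λ a b e → (a :+ b) :- e := (a :- e) :+ b) refl (S n j) (seq (u n) j) (S m j)) ⟩
        ℚ.∣ (S n j ℚ.- S m j) ℚ.+ seq (u n) j ∣ ℚ.+ (c (suc n) ℚ.+ c (suc n))
          ≤⟨ ℚ.+-mono-≤
               (ℚ.≤-trans (ℚ.∣p+q∣≤∣p∣+∣q∣ (S n j ℚ.- S m j) (seq (u n) j))
                 (ℚ.+-monoʳ-≤ ℚ.∣ S n j ℚ.- S m j ∣ (u≤c n j)))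
               (halving n (ℕ.≤-trans K≤m (ℕ.m≤n+m m d))) ⟩
        (ℚ.∣ S n j ℚ.- S m j ∣ ℚ.+ c n) ℚ.+ c n
          ≡⟨ ℚ.+-assoc ℚ.∣ S n j ℚ.- S m j ∣ (c n) (c n) ⟩
        ℚ.∣ S n j ℚ.- S m j ∣ ℚ.+ (c n ℚ.+ c n)
          ≤⟨ tail m j K≤m d ⟩
        c m ℚ.+ c m ∎
        where n = d ℕ.+ m

      tail′ : ∀ m n j → K ℕ.≤ m → m ℕ.≤ n → ℚ.∣ S n j ℚ.- S m j ∣ ℚ.≤ c m ℚ.+ c m
      tail′ m n j K≤m m≤n = subst (λ n → ℚ.∣ S n j ℚ.- S m j ∣ ℚ.≤ c m ℚ.+ c m) (ℕ.m∸n+n≡m m≤n) (begin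
        ℚ.∣ S n′ j ℚ.- S m j ∣
          ≡⟨ ℚ.+-identityʳ ℚ.∣ S n′ j ℚ.- S m j ∣ ⟨
        ℚ.∣ S n′ j ℚ.- S m j ∣ ℚ.+ ℚ.0ℚ
          ≤⟨ ℚ.+-monoʳ-≤ ℚ.∣ S n′ j ℚ.- S m j ∣ (0≤+ (0≤c n′) (0≤c n′)) ⟩
        ℚ.∣ S n′ j ℚ.- S m j ∣ ℚ.+ (c n′ ℚ.+ c n′)
          ≤⟨ tail m j K≤m (n ℕ.∸ m) ⟩
        c m ℚ.+ c m ∎)
        where n′ = n ℕ.∸ m ℕ.+ m

      decay : ∀ j → fromℕ (suc j) ℚ.* c (j ℕ.+ K) ℚ.≤ c K
      decay zero = ℚ.≤-reflexive (ℚ.*-identityˡ (c K))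
      decay (suc j) = begin
        fromℕ (suc (suc j)) ℚ.* c′
          ≡⟨ cong (ℚ._* c′) (trans (fromℕ-suc (suc j)) (cong (ℚ.1ℚ ℚ.+_) (fromℕ-suc j))) ⟩
        (ℚ.1ℚ ℚ.+ (ℚ.1ℚ ℚ.+ J)) ℚ.* c′
          ≡⟨ ℚ.+-identityʳ ((ℚ.1ℚ ℚ.+ (ℚ.1ℚ ℚ.+ J)) ℚ.* c′) ⟨
        (ℚ.1ℚ ℚ.+ (ℚ.1ℚ ℚ.+ J)) ℚ.* c′ ℚ.+ ℚ.0ℚ
          ≤⟨ ℚ.+-monoʳ-≤ ((ℚ.1ℚ ℚ.+ (ℚ.1ℚ ℚ.+ J)) ℚ.* c′) (0≤* (0≤fromℕ j) (0≤c (suc j ℕ.+ K))) ⟩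
        (ℚ.1ℚ ℚ.+ (ℚ.1ℚ ℚ.+ J)) ℚ.* c′ ℚ.+ J ℚ.* c′
          ≡⟨ solve 2 (λ a b → (con ℚ.1ℚ :+ (con ℚ.1ℚ :+ a)) :* b :+ a :* b := (con ℚ.1ℚ :+ a) :* (b :+ b)) refl J c′ ⟩
        (ℚ.1ℚ ℚ.+ J) ℚ.* (c′ ℚ.+ c′)
          ≡⟨ cong (ℚ._* (c′ ℚ.+ c′)) (fromℕ-suc j) ⟨
        fromℕ (suc j) ℚ.* (c′ ℚ.+ c′)
          ≤⟨ *-monoˡ (0≤fromℕ (suc j)) (halving (j ℕ.+ K) (ℕ.m≤n+m K j)) ⟩
        fromℕ (suc j) ℚ.* c (j ℕ.+ K)
          ≤⟨ decay j ⟩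
        c K ∎
        where
        J = fromℕ j
        c′ = c (suc j ℕ.+ K)

      small : ∀ ε → ℚ.0ℚ ℚ.< ε → ∃[ m ] K ℕ.≤ m × (c m ℚ.+ c m) ℚ.+ (c m ℚ.+ c m) ℚ.≤ ε
      small ε 0<ε = m , ℕ.m≤n+m K j , (begin
        (c m ℚ.+ c m) ℚ.+ (c m ℚ.+ c m)
          ≡⟨ solve 1 (λ a → (a :+ a) :+ (a :+ a) := con (fromℕ 4) :* a) refl (c m) ⟩
        fromℕ 4 ℚ.* c m
          ≡⟨ cong (fromℕ 4 ℚ.*_) (trans (cong (ℚ._* c m) (inv-r (fromℕ (suc j)) (0<fromℕ-suc j))) (ℚ.*-identityˡ (c m))) ⟨
        fromℕ 4 ℚ.* (fromℕ (suc j) ℚ.* inv-suc j ℚ.* c m)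
          ≡⟨ solve 4 (λ f a b e → f :* (a :* b :* e) := (a :* e) :* (f :* b)) refl (fromℕ 4) (fromℕ (suc j)) (inv-suc j) (c m) ⟩
        (fromℕ (suc j) ℚ.* c m) ℚ.* (fromℕ 4 ℚ.* inv-suc j)
          ≤⟨ *-mono (0≤* (0≤fromℕ 4) (ℚ.<⇒≤ (inv-suc-pos j))) (0≤fromℕ (suc B))
               (ℚ.≤-trans (decay j) (ℚ.≤-trans (proj₂ (∃fromℕ≥ (c K))) (fromℕ-mono (ℕ.n≤1+n B))))
               (*-monoˡ (0≤fromℕ 4) (proj₂ (archimedean 0<δ))) ⟩
        fromℕ (suc B) ℚ.* (fromℕ 4 ℚ.* δ)
          ≡⟨ solve 3 (λ b e b′ → b :* (con (fromℕ 4) :* (con (+ 1 ℚ./ 4) :* e :* b′)) := (b :* b′) :* e)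
               refl (fromℕ (suc B)) ε (inv-suc B) ⟩
        (fromℕ (suc B) ℚ.* inv-suc B) ℚ.* ε
          ≡⟨ trans (cong (ℚ._* ε) (inv-r (fromℕ (suc B)) (0<fromℕ-suc B))) (ℚ.*-identityˡ ε) ⟩
        ε ∎)
        where
        B = proj₁ (∃fromℕ≥ (c K))
        δ = + 1 ℚ./ 4 ℚ.* ε ℚ.* inv-suc B
        0<δ : ℚ.0ℚ ℚ.< δ
        0<δ = 0<* (0<* (ℚ.positive⁻¹ (+ 1 ℚ./ 4)) 0<ε) (inv-suc-pos B)
        j = proj₁ (archimedean 0<δ)
        m = j ℕ.+ K

    series-cauchy : IsCauchySequence (partialSum u)
    series-cauchy ε 0<ε = m , λ n n′ m≤n m≤n′ → mk≤ λ η 0<η → 0 , λ j _ → begin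
      ℚ.∣ S n j ℚ.- S n′ j ∣
        ≤⟨ dist-trans (S n j) (S m j) (S n′ j) ⟩
      ℚ.∣ S n j ℚ.- S m j ∣ ℚ.+ ℚ.∣ S m j ℚ.- S n′ j ∣
        ≡⟨ cong (ℚ.∣ S n j ℚ.- S m j ∣ ℚ.+_) (dist-sym (S m j) (S n′ j)) ⟩
      ℚ.∣ S n j ℚ.- S m j ∣ ℚ.+ ℚ.∣ S n′ j ℚ.- S m j ∣
        ≤⟨ ℚ.+-mono-≤ (tail′ m n j K≤m m≤n) (tail′ m n′ j K≤m m≤n′) ⟩
      (c m ℚ.+ c m) ℚ.+ (c m ℚ.+ c m)
        ≤⟨ 4c≤ε ⟩
      ε
        ≡⟨ ℚ.+-identityʳ ε ⟨
      ε ℚ.+ ℚ.0ℚ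
        ≤⟨ ℚ.+-monoʳ-≤ ε (ℚ.<⇒≤ 0<η) ⟩
      ε ℚ.+ η ∎
      where
      m = proj₁ (small ε 0<ε)
      K≤m = proj₁ (proj₂ (small ε 0<ε))
      4c≤ε = proj₂ (proj₂ (small ε 0<ε))

  1/-r : ∀ n .{{_ : ℕ.NonZero n}} → fromℕ n ℚ.* (+ 1 ℚ./ n) ≡ ℚ.1ℚ
  1/-r (suc d) = trans (cong (fromℕ (suc d) ℚ.*_) (ℚ.↥p/↧p≡p (inv-suc d))) (inv-r (fromℕ (suc d)) (0<fromℕ-suc d))

  1/! : ℕ → ℚ
  1/! k = + 1 ℚ./ k !
    where instance _ = k !≢0

  1/!-r : ∀ k → fromℕ (k !) ℚ.* 1/! k ≡ ℚ.1ℚ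
  1/!-r k = 1/-r (k !)
    where instance _ = k !≢0

  1/!-suc : ∀ k → 1/! k ≡ fromℕ (suc k) ℚ.* 1/! (suc k)
  1/!-suc k = begin
    1/! k
      ≡⟨ ℚ.*-identityʳ (1/! k) ⟨
    1/! k ℚ.* ℚ.1ℚ
      ≡⟨ cong (1/! k ℚ.*_) (1/!-r (suc k)) ⟨
    1/! k ℚ.* (fromℕ (suc k ℕ.* k !) ℚ.* 1/! (suc k))
      ≡⟨ cong (λ q → 1/! k ℚ.* (q ℚ.* 1/! (suc k))) (fromℕ-* (suc k) (k !)) ⟨
    1/! k ℚ.* (fromℕ (suc k) ℚ.* fromℕ (k !) ℚ.* 1/! (suc k))
      ≡⟨ solve 4 (λ a b f e → a :* (b :* f :* e) := (f :* a) :* (b :* e)) refl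
           (1/! k) (fromℕ (suc k)) (fromℕ (k !)) (1/! (suc k)) ⟩
    (fromℕ (k !) ℚ.* 1/! k) ℚ.* (fromℕ (suc k) ℚ.* 1/! (suc k))
      ≡⟨ cong (ℚ._* (fromℕ (suc k) ℚ.* 1/! (suc k))) (1/!-r k) ⟩
    ℚ.1ℚ ℚ.* (fromℕ (suc k) ℚ.* 1/! (suc k))
      ≡⟨ ℚ.*-identityˡ (fromℕ (suc k) ℚ.* 1/! (suc k)) ⟩
    fromℕ (suc k) ℚ.* 1/! (suc k) ∎
    where open ≡-Reasoning

  0≤1/! : ∀ k → ℚ.0ℚ ℚ.≤ 1/! k
  0≤1/! k = ℚ.nonNegative⁻¹ (1/! k) {{ℚ.normalize-nonNeg 1 (k !)}}
    where instance _ = k !≢0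

  module _ (z : ℂ) where

    open ℚ.≤-Reasoning

    private
      a b : ℕ → ℚ
      a = seq (re z)
      b = seq (im z)

      norm : ℂ → ℕ → ℚ
      norm w j = ℚ.∣ seq (re w) j ∣ ℚ.+ ℚ.∣ seq (im w) j ∣

      0≤norm : ∀ w j → ℚ.0ℚ ℚ.≤ norm w j
      0≤norm w j = 0≤+ (ℚ.0≤∣p∣ (seq (re w) j)) (ℚ.0≤∣p∣ (seq (im w) j))

      B : ℕ
      B = proj₁ (bounded a (isCauchy (re z))) ℕ.+ proj₁ (bounded b (isCauchy (im z)))

      0≤B : ℚ.0ℚ ℚ.≤ fromℕ B
      0≤B = 0≤fromℕ B

      norm≤B : ∀ j → norm z j ℚ.≤ fromℕ B
      norm≤B j = ℚ.≤-trans
        (ℚ.+-mono-≤ (proj₂ (bounded a (isCauchy (re z))) j) (proj₂ (bounded b (isCauchy (im z))) j))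
        (ℚ.≤-reflexive (fromℤ-+ (+ proj₁ (bounded a (isCauchy (re z)))) (+ proj₁ (bounded b (isCauchy (im z))))))

      ∣pq∣ : ∀ p q r s → ℚ.∣ p ℚ.* q ℚ.+ r ℚ.* s ∣ ℚ.≤ ℚ.∣ p ∣ ℚ.* ℚ.∣ q ∣ ℚ.+ ℚ.∣ r ∣ ℚ.* ℚ.∣ s ∣
      ∣pq∣ p q r s = ℚ.≤-trans (ℚ.∣p+q∣≤∣p∣+∣q∣ (p ℚ.* q) (r ℚ.* s))
        (ℚ.≤-reflexive (cong₂ ℚ._+_ (ℚ.∣p*q∣≡∣p∣*∣q∣ p q) (ℚ.∣p*q∣≡∣p∣*∣q∣ r s)))

      norm-* : ∀ w j → norm (z *ᶜ w) j ℚ.≤ norm z j ℚ.* norm w j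
      norm-* w j = begin
        ℚ.∣ p ℚ.* r ℚ.+ ℚ.- (q ℚ.* s) ∣ ℚ.+ ℚ.∣ p ℚ.* s ℚ.+ q ℚ.* r ∣
          ≡⟨ cong (λ t → ℚ.∣ p ℚ.* r ℚ.+ t ∣ ℚ.+ ℚ.∣ p ℚ.* s ℚ.+ q ℚ.* r ∣) (ℚ.neg-distribˡ-* q s) ⟩
        ℚ.∣ p ℚ.* r ℚ.+ (ℚ.- q) ℚ.* s ∣ ℚ.+ ℚ.∣ p ℚ.* s ℚ.+ q ℚ.* r ∣
          ≤⟨ ℚ.+-mono-≤ (∣pq∣ p r (ℚ.- q) s) (∣pq∣ p s q r) ⟩
        (∣p∣ ℚ.* ∣r∣ ℚ.+ ℚ.∣ ℚ.- q ∣ ℚ.* ∣s∣) ℚ.+ (∣p∣ ℚ.* ∣s∣ ℚ.+ ∣q∣ ℚ.* ∣r∣)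
          ≡⟨ cong (λ t → (∣p∣ ℚ.* ∣r∣ ℚ.+ t ℚ.* ∣s∣) ℚ.+ (∣p∣ ℚ.* ∣s∣ ℚ.+ ∣q∣ ℚ.* ∣r∣)) (ℚ.∣-p∣≡∣p∣ q) ⟩
        (∣p∣ ℚ.* ∣r∣ ℚ.+ ∣q∣ ℚ.* ∣s∣) ℚ.+ (∣p∣ ℚ.* ∣s∣ ℚ.+ ∣q∣ ℚ.* ∣r∣)
          ≡⟨ solve 4 (λ p q r s → (p :* r :+ q :* s) :+ (p :* s :+ q :* r) := (p :+ q) :* (r :+ s)) refl
               ∣p∣ ∣q∣ ∣r∣ ∣s∣ ⟩
        (∣p∣ ℚ.+ ∣q∣) ℚ.* (∣r∣ ℚ.+ ∣s∣) ∎
        where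
        p = a j
        q = b j
        r = seq (re w) j
        s = seq (im w) j
        ∣p∣ = ℚ.∣ p ∣
        ∣q∣ = ℚ.∣ q ∣
        ∣r∣ = ℚ.∣ r ∣
        ∣s∣ = ℚ.∣ s ∣

      B^ : ℕ → ℚ
      B^ zero    = ℚ.1ℚ
      B^ (suc k) = fromℕ B ℚ.* B^ k

      0≤B^ : ∀ k → ℚ.0ℚ ℚ.≤ B^ k
      0≤B^ zero    = 0≤1
      0≤B^ (suc k) = 0≤* 0≤B (0≤B^ k)

      norm-^ : ∀ k j → norm (z ^ᶜ k) j ℚ.≤ B^ k
      norm-^ zero    j = ℚ.≤-reflexive refl
      norm-^ (suc k) j = ℚ.≤-trans (norm-* (z ^ᶜ k) j)
        (*-mono (0≤norm (z ^ᶜ k) j) 0≤B (norm≤B j) (norm-^ k j))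

      c : ℕ → ℚ
      c k = 1/! k ℚ.* B^ k

      halving : ∀ k → B ℕ.+ B ℕ.≤ k → c (suc k) ℚ.+ c (suc k) ℚ.≤ c k
      halving k 2B≤k = begin
        f ℚ.* (fromℕ B ℚ.* B^ k) ℚ.+ f ℚ.* (fromℕ B ℚ.* B^ k)
          ≡⟨ solve 3 (λ f b p → f :* (b :* p) :+ f :* (b :* p) := ((b :+ b) :* f) :* p) refl f (fromℕ B) (B^ k) ⟩
        ((fromℕ B ℚ.+ fromℕ B) ℚ.* f) ℚ.* B^ k
          ≤⟨ *-monoʳ (0≤B^ k) (*-monoʳ (0≤1/! (suc k))
               (ℚ.≤-trans (ℚ.≤-reflexive (fromℤ-+ (+ B) (+ B))) (fromℕ-mono (ℕ.m≤n⇒m≤1+n 2B≤k)))) ⟩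
        (fromℕ (suc k) ℚ.* f) ℚ.* B^ k
          ≡⟨ cong (ℚ._* B^ k) (1/!-suc k) ⟨
        c k ∎
        where f = 1/! (suc k)

      ≤+ˡ : ∀ {p q} → ℚ.0ℚ ℚ.≤ q → p ℚ.≤ p ℚ.+ q
      ≤+ˡ {p} 0≤q = ℚ.≤-trans (ℚ.≤-reflexive (sym (ℚ.+-identityʳ p))) (ℚ.+-monoʳ-≤ p 0≤q)

      ≤+ʳ : ∀ {p q} → ℚ.0ℚ ℚ.≤ q → p ℚ.≤ q ℚ.+ p
      ≤+ʳ {p} 0≤q = ℚ.≤-trans (ℚ.≤-reflexive (sym (ℚ.+-identityˡ p))) (ℚ.+-monoˡ-≤ p 0≤q)

      scale : ∀ k {p} → ℚ.∣ p ∣ ℚ.≤ B^ k → ℚ.∣ 1/! k ℚ.* p ∣ ℚ.≤ c k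
      scale k {p} p≤ = begin
        ℚ.∣ 1/! k ℚ.* p ∣          ≡⟨ ℚ.∣p*q∣≡∣p∣*∣q∣ (1/! k) p ⟩
        ℚ.∣ 1/! k ∣ ℚ.* ℚ.∣ p ∣    ≡⟨ cong (ℚ._* ℚ.∣ p ∣) (ℚ.0≤p⇒∣p∣≡p (0≤1/! k)) ⟩
        1/! k ℚ.* ℚ.∣ p ∣          ≤⟨ *-monoˡ (0≤1/! k) p≤ ⟩
        c k                        ∎

    re-cauchy : IsCauchySequence (partialSum (λ k → re (expTerm z k)))
    re-cauchy = series-cauchy (λ k → re (expTerm z k)) c (B ℕ.+ B)
      (λ k j → scale k (ℚ.≤-trans (≤+ˡ (ℚ.0≤∣p∣ (seq (im (z ^ᶜ k)) j))) (norm-^ k j)))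
      halving

    im-cauchy : IsCauchySequence (partialSum (λ k → im (expTerm z k)))
    im-cauchy = series-cauchy (λ k → im (expTerm z k)) c (B ℕ.+ B)
      (λ k j → scale k (ℚ.≤-trans (≤+ʳ (ℚ.0≤∣p∣ (seq (re (z ^ᶜ k)) j))) (norm-^ k j)))
      halving

exp : ℂ → ℂ
exp z = lim (partialSum (λ k → re (expTerm z k))) (ExpLemmas.re-cauchy z)
     +i lim (partialSum (λ k → im (expTerm z k))) (ExpLemmas.im-cauchy z)

-- The function with value coeff on [left , right) and 0 elsewhere.
record Brick (a b : ℝ) : Set where
  field
    coeff left right : ℝ
    a≤left     : a ≤ left
    left≤right : left ≤ right
    right≤b    : right ≤ b

  length : ℝ
  length = right - left

_∈_ : ∀ {a b} → ℝ → Brick a b → Set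
x ∈ β = Brick.left β ≤ x × x < Brick.right β

χ : ∀ {A : Set} → Dec A → ℝ
χ A? = if does A? then 1ℝ else 0ℝ

record BrickSeries (a b : ℝ) : Set where
  field
    size  : ℕ → ℕ
    brick : ∀ n → Fin (size n) → Brick a b

module _ {a b : ℝ} (S : BrickSeries a b) where

  open BrickSeries S
  open Brick

  Decides : ℝ → Set
  Decides x = ∀ n j → Dec (x ∈ brick n j)

  integralTerms absIntegralTerms : ℕ → ℝ
  integralTerms    n = sum (λ j → coeff (brick n j) * length (brick n j))
  absIntegralTerms n = sum (λ j → ∣ coeff (brick n j) ∣ * length (brick n j))

  terms absTerms : ∀ x → Decides x → ℕ → ℝ
  terms    x x∈? n = sum (λ j → coeff (brick n j) * χ (x∈? n j))
  absTerms x x∈? n = sum (λ j → ∣ coeff (brick n j) ∣ * χ (x∈? n j))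

-- Mikusiński's definition of the Lebesgue integral: f is integrable over [a , b] with
-- integral I when there are bricks βₖ with coefficients λₖ such that Σ |λₖ| length βₖ < ∞,
-- I = Σ λₖ length βₖ, and f x = Σ λₖ χ_βₖ(x) at every x for which Σ |λₖ| χ_βₖ(x) < ∞.
-- A BrickSeries lists the bricks in consecutive finite blocks, the n-th with size n members;
-- by absolute convergence the grouping is immaterial.  The endpoints a and b, a null set, are
-- left out.  Membership of a real in a brick is not constructively decidable, so the sum at x
-- is formed from given decisions, which classically always exist.  Classically I is unique.
IsLebesgueIntegral : (f : ℝ → ℝ) (a b I : ℝ) → Set
IsLebesgueIntegral f a b I = Σ[ S ∈ BrickSeries a b ]
  Summable (absIntegralTerms S) ×
  HasSum (integralTerms S) I ×
  (∀ x → a < x → x < b → (x∈? : Decides S x) →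
     Summable (absTerms S x x∈?) → HasSum (terms S x x∈?) (f x))

{-# OPTIONS --safe #-}

-- Write f t = ∑ a n e^{i t φ n}, let L be a power of two and t j = j T / L.  By positive definiteness
--   ∑_{j,l < L} |f (t j - t l)|² = ∑_{m,n} a m a n |∑_j e^{i t j (φ m - φ n)}|² ≥ L² ∑ a n²,
-- the terms with m ≠ n being non-negative.  For each l the points t j - t l are among the nodes
-- (i - L) T / L, i < 2 L, so the mean of |f|² over these 2 L nodes is at least s = (∑ a n²) / 2.  As
-- x ^ q lies above its tangent at s, the mean of |f|^{2q} is at least s ^ q, whence c = 2 ^ -q.
--
-- The integral is the limit of these left Riemann sums.  Since |f|^{2q} is Lipschitz on [-T , T], the
-- corresponding step functions differ between successive levels by an absolutely summable series of bricks.

module Submission where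

open import Defs
open import Algebra.Bundles using (CommutativeRing)
import Algebra.Properties.CommutativeSemiring.Exp
import Algebra.Properties.Semiring.Sum
import Algebra.Solver.Ring
open import Algebra.Solver.Ring.AlmostCommutativeRing
  using (fromCommutativeRing; _-Raw-AlmostCommutative⟶_; Induced-equivalence)
import Algebra.Solver.Ring.Simple
open import Data.Empty using (⊥-elim-irr)
open import Data.Fin.Base using (Fin; zero; suc; toℕ; fromℕ<)
import Data.Fin.Properties as Fin
open import Data.Integer.Base using (+_)
open import Data.Maybe.Base using (map)
open import Data.Nat.Base as ℕ using (ℕ; zero; suc; NonZero) renaming (_*_ to _*ℕ_)
import Data.Nat.Properties as ℕ
open import Data.Product.Base using (Σ-syntax; ∃-syntax; _×_; _,_; proj₁; proj₂)
import Data.Product.Properties as ×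
open import Data.Rational.Base as ℚ using (ℚ)
import Data.Rational.Properties as ℚ
import Data.Rational.Solver as ℚ
open import Data.Sum.Base using (inj₁; inj₂)
open import Data.Vec.Functional using (Vector)
open import Function.Base using (_∘_)
open import Level using (0ℓ)
open import Relation.Binary.Bundles using (Poset)
open import Relation.Binary.Consequences using (dec⇒weaklyDec)
open import Relation.Binary.Definitions using (WeaklyDecidable; tri<; tri≈; tri>)
open import Relation.Binary.PropositionalEquality
  using (_≡_; _≢_; refl; sym; trans; cong; cong₂; subst; subst₂; module ≡-Reasoning; isEquivalence)
import Relation.Binary.Reasoning.PartialOrder
open import Relation.Nullary using (¬_; Dec; yes; no; contradiction)

open ℝ
open ℂ
open _≤_
open RationalLemmas

-- Order and equality

-- Two obstacles shape the proof. The function `exp` is a limit of partial sums which are themselves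
-- sequences of rationals, and none of its properties is given. The addition theorem, conjugation
-- and a Lipschitz bound are therefore established for partial sums at rational complex points,
-- exactly or up to geometric errors with one constant for all approximation indices, and only then
-- passed to the limit.
--
-- The order on ℝ is undecidable. At a point x only the given decisions about bricks can be
-- consulted, and a negative decision yields merely a negated inequality; non-strict bounds are
-- recovered from the failure of strict ones (`≮⇒≥`). L is a power of two to make the subdivisions
-- nested: a refinement then alters a step function on right halves of intervals only, by a small
-- jump.
--
-- The tangent stands in for Hölder's inequality, which avoids roots of order q. Since only even
-- powers of |f| occur, the square root in the modulus cancels and the integrand is a polynomial in
-- cosines and sines.

Eventually : (ℕ → Set) → Set
Eventually P = ∃[ n ] (∀ i → n ℕ.≤ i → P i)

map₁ : ∀ {P Q : ℕ → Set} → (∀ i → P i → Q i) → Eventually P → Eventually Q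
map₁ f (n , p) = n , λ i n≤i → f i (p i n≤i)

map₂ : ∀ {P Q R : ℕ → Set} → (∀ i → P i → Q i → R i) → Eventually P → Eventually Q → Eventually R
map₂ f (m , p) (n , q) = m ℕ.⊔ n , λ i mn≤i →
  f i (p i (ℕ.m⊔n≤o⇒m≤o m n mn≤i)) (q i (ℕ.m⊔n≤o⇒n≤o m n mn≤i))

p≤p+q : ∀ p {q} → ℚ.0ℚ ℚ.≤ q → p ℚ.≤ p ℚ.+ q
p≤p+q p 0≤q = ℚ.≤-trans (ℚ.≤-reflexive (sym (ℚ.+-identityʳ p))) (ℚ.+-monoʳ-≤ p 0≤q)

eventually⇒≤ : ∀ {x y} → Eventually (λ i → seq x i ℚ.≤ seq y i) → x ≤ y
eventually⇒≤ h = mk≤ λ ε 0<ε → map₁ (λ i x≤y → ℚ.≤-trans x≤y (p≤p+q _ (ℚ.<⇒≤ 0<ε))) h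

pointwise⇒≤ : ∀ {x y} → (∀ i → seq x i ℚ.≤ seq y i) → x ≤ y
pointwise⇒≤ h = eventually⇒≤ (0 , λ i _ → h i)

≈⇒≤ : ∀ {x y} → x ≈ y → x ≤ y
≈⇒≤ (mk≈ h) = mk≤ λ ε 0<ε → map₁ (λ _ → ≤dist) (h ε 0<ε)

≤-antisym : ∀ {x y} → x ≤ y → y ≤ x → x ≈ y
≤-antisym {x} {y} (mk≤ h) (mk≤ k) = mk≈ λ ε 0<ε → map₂ (λ i → dist≤ {seq x i} {seq y i}) (h ε 0<ε) (k ε 0<ε)

≈-sym : ∀ {x y} → x ≈ y → y ≈ x
≈-sym {x} {y} (mk≈ h) = mk≈ λ ε 0<ε →
  map₁ (λ i → ℚ.≤-trans (ℚ.≤-reflexive (dist-sym (seq y i) (seq x i)))) (h ε 0<ε)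

≤-trans : ∀ {x y z} → x ≤ y → y ≤ z → x ≤ z
≤-trans {x} {y} {z} (mk≤ h) (mk≤ k) = mk≤ λ ε 0<ε → map₂
  (λ i x≤y y≤z → begin
    seq x i                                ≤⟨ x≤y ⟩
    seq y i ℚ.+ ℚ.½ ℚ.* ε                  ≤⟨ ℚ.+-monoˡ-≤ _ y≤z ⟩
    seq z i ℚ.+ ℚ.½ ℚ.* ε ℚ.+ ℚ.½ ℚ.* ε    ≡⟨ ℚ.+-assoc (seq z i) _ _ ⟩
    seq z i ℚ.+ (ℚ.½ ℚ.* ε ℚ.+ ℚ.½ ℚ.* ε)  ≡⟨ cong (seq z i ℚ.+_) (half+half ε) ⟩
    seq z i ℚ.+ ε                          ∎)
  (h (ℚ.½ ℚ.* ε) (half 0<ε)) (k (ℚ.½ ℚ.* ε) (half 0<ε))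
  where open ℚ.≤-Reasoning

≤-refl : ∀ {x} → x ≤ x
≤-refl = pointwise⇒≤ λ _ → ℚ.≤-refl

≈-refl : ∀ {x} → x ≈ x
≈-refl = ≤-antisym ≤-refl ≤-refl

≈-trans : ∀ {x y z} → x ≈ y → y ≈ z → x ≈ z
≈-trans x≈y y≈z = ≤-antisym
  (≤-trans (≈⇒≤ x≈y) (≈⇒≤ y≈z)) (≤-trans (≈⇒≤ (≈-sym y≈z)) (≈⇒≤ (≈-sym x≈y)))

pointwise⇒≈ : ∀ {x y} → (∀ i → seq x i ≡ seq y i) → x ≈ y
pointwise⇒≈ h = ≤-antisym (pointwise⇒≤ λ i → ℚ.≤-reflexive (h i))
                          (pointwise⇒≤ λ i → ℚ.≤-reflexive (sym (h i)))

-- Lets an estimate come out with whatever constant it produces: the hypothesis is used at ε / (B +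
-- 1), where the summand 1 covers B = 0.
≤-scaled : ∀ {x y} B → (∀ ε → ℚ.0ℚ ℚ.< ε → Eventually (λ i → seq x i ℚ.≤ seq y i ℚ.+ fromℕ B ℚ.* ε)) → x ≤ y
≤-scaled {x} {y} B h = mk≤ λ ε 0<ε → map₁
  (λ i x≤y → begin
    seq x i                                                   ≤⟨ x≤y ⟩
    seq y i ℚ.+ fromℕ B ℚ.* (inv-suc B ℚ.* ε)                 ≤⟨ ℚ.+-monoʳ-≤ (seq y i) (*-monoʳ (ℚ.<⇒≤ (0<* (inv-suc-pos B) 0<ε)) (fromℕ-mono (ℕ.n≤1+n B))) ⟩
    seq y i ℚ.+ fromℕ (suc B) ℚ.* (inv-suc B ℚ.* ε)           ≡⟨ cong (seq y i ℚ.+_) (ℚ.*-assoc (fromℕ (suc B)) (inv-suc B) ε) ⟨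
    seq y i ℚ.+ fromℕ (suc B) ℚ.* inv-suc B ℚ.* ε             ≡⟨ cong (λ r → seq y i ℚ.+ r ℚ.* ε) (inv-r (fromℕ (suc B)) (0<fromℕ-suc B)) ⟩
    seq y i ℚ.+ ℚ.1ℚ ℚ.* ε                                    ≡⟨ cong (seq y i ℚ.+_) (ℚ.*-identityˡ ε) ⟩
    seq y i ℚ.+ ε                                             ∎)
  (h (inv-suc B ℚ.* ε) (0<* (inv-suc-pos B) 0<ε))
  where open ℚ.≤-Reasoning

abstract
  -- Abstract because only the existence of a bound matters; the number it computes is not meant to
  -- unfold in later types.
  ∃bound : ∀ x → ∃[ B ] (∀ i → ℚ.∣ seq x i ∣ ℚ.≤ fromℕ B)
  ∃bound x = CauchyLemmas.bounded (seq x) (isCauchy x)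

+-mono-≤ : ∀ {x y u v} → x ≤ y → u ≤ v → x + u ≤ y + v
+-mono-≤ {x} {y} {u} {v} (mk≤ h) (mk≤ k) = ≤-scaled 2 λ ε 0<ε → map₂
  (λ i x≤y u≤v → begin
    seq x i ℚ.+ seq u i                   ≤⟨ ℚ.+-mono-≤ x≤y u≤v ⟩
    seq y i ℚ.+ ε ℚ.+ (seq v i ℚ.+ ε)
      ≡⟨ solve 3 (λ y v e → y :+ e :+ (v :+ e) := y :+ v :+ con (fromℕ 2) :* e) refl (seq y i) (seq v i) ε ⟩
    seq y i ℚ.+ seq v i ℚ.+ fromℕ 2 ℚ.* ε ∎)
  (h ε 0<ε) (k ε 0<ε)
  where
  open ℚ.≤-Reasoning
  open ℚ.+-*-Solver

neg-anti-≤ : ∀ {x y} → x ≤ y → - y ≤ - x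
neg-anti-≤ {x} {y} (mk≤ h) = mk≤ λ ε 0<ε → map₁
  (λ i x≤y → begin
    ℚ.- seq y i                             ≡⟨ solve 2 (λ y e → :- y := :- (y :+ e) :+ e) refl (seq y i) ε ⟩
    ℚ.- (seq y i ℚ.+ ε) ℚ.+ ε               ≤⟨ ℚ.+-monoˡ-≤ ε (ℚ.neg-antimono-≤ x≤y) ⟩
    ℚ.- seq x i ℚ.+ ε                       ∎)
  (h ε 0<ε)
  where
  open ℚ.≤-Reasoning
  open ℚ.+-*-Solver

-- The difference x u - y v = (x - y) u + y (u - v) is small because the approximants of u and y are
-- bounded. Applied in both directions, this makes multiplication respect `_≈_`.
*-mono₁ : ∀ {x y u v} → x ≈ y → u ≈ v → x * u ≤ y * v
*-mono₁ {x} {y} {u} {v} (mk≈ h) (mk≈ k) = ≤-scaled (Bᵤ ℕ.+ Bᵧ) λ ε 0<ε → map₂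
  (λ i x≈y u≈v → begin
    seq x i ℚ.* seq u i
      ≡⟨ solve 4 (λ x y u v → x :* u := y :* v :+ ((x :- y) :* u :+ y :* (u :- v))) refl (seq x i) (seq y i) (seq u i) (seq v i) ⟩
    seq y i ℚ.* seq v i ℚ.+ ((seq x i ℚ.- seq y i) ℚ.* seq u i ℚ.+ seq y i ℚ.* (seq u i ℚ.- seq v i))
      ≤⟨ ℚ.+-monoʳ-≤ (seq y i ℚ.* seq v i) (ℚ.+-mono-≤ (bound {seq x i ℚ.- seq y i} {seq u i} x≈y (proj₂ (∃bound u) i) (ℚ.<⇒≤ 0<ε))
           (bound {seq y i} (proj₂ (∃bound y) i) u≈v (0≤fromℕ Bᵧ))) ⟩
    seq y i ℚ.* seq v i ℚ.+ (ε ℚ.* fromℕ Bᵤ ℚ.+ fromℕ Bᵧ ℚ.* ε)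
      ≡⟨ cong (seq y i ℚ.* seq v i ℚ.+_) (solve 3 (λ e u y → e :* u :+ y :* e := (u :+ y) :* e) refl ε (fromℕ Bᵤ) (fromℕ Bᵧ)) ⟩
    seq y i ℚ.* seq v i ℚ.+ (fromℕ Bᵤ ℚ.+ fromℕ Bᵧ) ℚ.* ε
      ≡⟨ cong (λ b → seq y i ℚ.* seq v i ℚ.+ b ℚ.* ε) (fromℤ-+ (+ Bᵤ) (+ Bᵧ)) ⟩
    seq y i ℚ.* seq v i ℚ.+ fromℕ (Bᵤ ℕ.+ Bᵧ) ℚ.* ε ∎)
  (h ε 0<ε) (k ε 0<ε)
  where
  open ℚ.≤-Reasoning
  open ℚ.+-*-Solver
  Bᵤ = proj₁ (∃bound u)
  Bᵧ = proj₁ (∃bound y)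
  bound : ∀ {p q a b} → ℚ.∣ p ∣ ℚ.≤ a → ℚ.∣ q ∣ ℚ.≤ b → ℚ.0ℚ ℚ.≤ a → p ℚ.* q ℚ.≤ a ℚ.* b
  bound {p} {q} p≤a q≤b 0≤a = ℚ.≤-trans (p≤∣p∣ (p ℚ.* q)) (ℚ.≤-trans (ℚ.≤-reflexive (ℚ.∣p*q∣≡∣p∣*∣q∣ p q))
    (*-mono (ℚ.0≤∣p∣ q) 0≤a p≤a q≤b))

+-cong : ∀ {x y u v} → x ≈ y → u ≈ v → x + u ≈ y + v
+-cong p q = ≤-antisym (+-mono-≤ (≈⇒≤ p) (≈⇒≤ q)) (+-mono-≤ (≈⇒≤ (≈-sym p)) (≈⇒≤ (≈-sym q)))

neg-cong : ∀ {x y} → x ≈ y → - x ≈ - y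
neg-cong p = ≤-antisym (neg-anti-≤ (≈⇒≤ (≈-sym p))) (neg-anti-≤ (≈⇒≤ p))

*-cong : ∀ {x y u v} → x ≈ y → u ≈ v → x * u ≈ y * v
*-cong p q = ≤-antisym (*-mono₁ p q) (*-mono₁ (≈-sym p) (≈-sym q))

-- The ordered ring of real numbers

ℝ-commutativeRing : CommutativeRing 0ℓ 0ℓ
ℝ-commutativeRing = record
  { Carrier = ℝ ; _≈_ = _≈_ ; _+_ = _+_ ; _*_ = _*_ ; -_ = -_ ; 0# = 0ℝ ; 1# = 1ℝ
  ; isCommutativeRing = record
    { isRing = record
      { +-isAbelianGroup = record
        { isGroup = record
          { isMonoid = record
            { isSemigroup = record
              { isMagma = record
                { isEquivalence = record { refl = ≈-refl ; sym = ≈-sym ; trans = ≈-trans }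
                ; ∙-cong = +-cong }
              ; assoc = λ x y z → pointwise⇒≈ λ i → ℚ.+-assoc (seq x i) (seq y i) (seq z i) }
            ; identity = (λ x → pointwise⇒≈ λ i → ℚ.+-identityˡ (seq x i))
                       , (λ x → pointwise⇒≈ λ i → ℚ.+-identityʳ (seq x i)) }
          ; inverse = (λ x → pointwise⇒≈ λ i → ℚ.+-inverseˡ (seq x i))
                    , (λ x → pointwise⇒≈ λ i → ℚ.+-inverseʳ (seq x i))
          ; ⁻¹-cong = neg-cong }
        ; comm = λ x y → pointwise⇒≈ λ i → ℚ.+-comm (seq x i) (seq y i) }
      ; *-cong = *-cong
      ; *-assoc = λ x y z → pointwise⇒≈ λ i → ℚ.*-assoc (seq x i) (seq y i) (seq z i)
      ; *-identity = (λ x → pointwise⇒≈ λ i → ℚ.*-identityˡ (seq x i))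
                   , (λ x → pointwise⇒≈ λ i → ℚ.*-identityʳ (seq x i))
      ; distrib = (λ x y z → pointwise⇒≈ λ i → ℚ.*-distribˡ-+ (seq x i) (seq y i) (seq z i))
                , (λ x y z → pointwise⇒≈ λ i → ℚ.*-distribʳ-+ (seq x i) (seq y i) (seq z i)) }
    ; *-comm = λ x y → pointwise⇒≈ λ i → ℚ.*-comm (seq x i) (seq y i) } }

open CommutativeRing ℝ-commutativeRing
  using (+-congˡ; +-congʳ; *-congˡ; *-congʳ; +-identityˡ; +-identityʳ; *-identityˡ; *-identityʳ;
         +-assoc; *-assoc; *-comm; -‿inverseʳ; distribˡ; distribʳ)

-- A ring solver compares coefficients, which cannot be decided for reals. With rational
-- coefficients it can, and numerals such as ½ may occur in identities.
ℚ⟶ℝ : ℚ.+-*-rawRing -Raw-AlmostCommutative⟶ fromCommutativeRing ℝ-commutativeRing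
ℚ⟶ℝ = record
  { ⟦_⟧    = fromℚ
  ; +-homo = λ _ _ → pointwise⇒≈ λ _ → refl
  ; *-homo = λ _ _ → pointwise⇒≈ λ _ → refl
  ; -‿homo = λ _ → pointwise⇒≈ λ _ → refl
  ; 0-homo = ≈-refl
  ; 1-homo = ≈-refl
  }

coefficientsEqual? : WeaklyDecidable (Induced-equivalence ℚ⟶ℝ)
coefficientsEqual? p q = map (λ { refl → ≈-refl }) (dec⇒weaklyDec ℚ._≟_ p q)

module ℝ-Solver = Algebra.Solver.Ring ℚ.+-*-rawRing (fromCommutativeRing ℝ-commutativeRing) ℚ⟶ℝ
  coefficientsEqual?

≤-poset : Poset 0ℓ 0ℓ 0ℓ
≤-poset = record
  { Carrier = ℝ ; _≈_ = _≈_ ; _≤_ = _≤_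
  ; isPartialOrder = record
    { isPreorder = record
      { isEquivalence = record { refl = ≈-refl ; sym = ≈-sym ; trans = ≈-trans }
      ; reflexive = ≈⇒≤
      ; trans = ≤-trans }
    ; antisym = ≤-antisym } }

module ≤-Reasoning = Relation.Binary.Reasoning.PartialOrder ≤-poset

+-monoˡ-≤ : ∀ {x y} z → x ≤ y → x + z ≤ y + z
+-monoˡ-≤ z x≤y = +-mono-≤ x≤y ≤-refl

+-monoʳ-≤ : ∀ {x y} z → x ≤ y → z + x ≤ z + y
+-monoʳ-≤ z = +-mono-≤ ≤-refl

x≤y⇒0≤y-x : ∀ {x y} → x ≤ y → 0ℝ ≤ y - x
x≤y⇒0≤y-x {x} x≤y = ≤-trans (≈⇒≤ (≈-sym (-‿inverseʳ x))) (+-monoˡ-≤ (- x) x≤y)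

0≤y-x⇒x≤y : ∀ {x y} → 0ℝ ≤ y - x → x ≤ y
0≤y-x⇒x≤y {x} {y} 0≤y-x = begin
  x            ≈⟨ +-identityˡ x ⟨
  0ℝ + x       ≤⟨ +-monoˡ-≤ x 0≤y-x ⟩
  y - x + x    ≈⟨ solve 2 (λ x y → y :- x :+ x := y) ≈-refl x y ⟩
  y            ∎
  where
  open ≤-Reasoning
  open ℝ-Solver

+-nonNeg : ∀ {x y} → 0ℝ ≤ x → 0ℝ ≤ y → 0ℝ ≤ x + y
+-nonNeg 0≤x 0≤y = ≤-trans (≈⇒≤ (≈-sym (+-identityˡ 0ℝ))) (+-mono-≤ 0≤x 0≤y)

0≤p² : ∀ p → ℚ.0ℚ ℚ.≤ p ℚ.* p
0≤p² p with ℚ.≤-total ℚ.0ℚ p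
... | inj₁ 0≤p = 0≤* 0≤p 0≤p
... | inj₂ p≤0 = ℚ.≤-trans (0≤* (ℚ.neg-antimono-≤ p≤0) (ℚ.neg-antimono-≤ p≤0))
                   (ℚ.≤-reflexive (solve′ p))
  where
  open ℚ.+-*-Solver
  solve′ : ∀ p → ℚ.- p ℚ.* ℚ.- p ≡ p ℚ.* p
  solve′ = solve 1 (λ p → (:- p) :* (:- p) := p :* p) refl

0≤x² : ∀ x → 0ℝ ≤ x * x
0≤x² x = pointwise⇒≤ λ i → 0≤p² (seq x i)

-- Approximants of non-negative reals may dip to -ε, so both factors may be slightly negative. If q
-- ≥ 0, then p q ≥ -ε q ≥ -b ε. If q ≤ 0, then p ≤ b gives p q ≥ b q ≥ -b ε.
*-almostNonNeg : ∀ {p q ε b} → ℚ.0ℚ ℚ.≤ ε → ℚ.0ℚ ℚ.≤ p ℚ.+ ε → ℚ.0ℚ ℚ.≤ q ℚ.+ ε → ℚ.∣ p ∣ ℚ.≤ b → ℚ.∣ q ∣ ℚ.≤ b →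
  ℚ.0ℚ ℚ.≤ p ℚ.* q ℚ.+ b ℚ.* ε
*-almostNonNeg {p} {q} {ε} {b} 0≤ε 0≤p+ε 0≤q+ε p≤b q≤b with ℚ.≤-total ℚ.0ℚ q
... | inj₁ 0≤q = begin
  ℚ.0ℚ                 ≤⟨ 0≤* 0≤p+ε 0≤q ⟩
  (p ℚ.+ ε) ℚ.* q      ≡⟨ ℚ.*-distribʳ-+ q p ε ⟩
  p ℚ.* q ℚ.+ ε ℚ.* q  ≤⟨ ℚ.+-monoʳ-≤ (p ℚ.* q) (*-monoˡ 0≤ε (ℚ.≤-trans (p≤∣p∣ q) q≤b)) ⟩
  p ℚ.* q ℚ.+ ε ℚ.* b  ≡⟨ cong (p ℚ.* q ℚ.+_) (ℚ.*-comm ε b) ⟩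
  p ℚ.* q ℚ.+ b ℚ.* ε  ∎
  where open ℚ.≤-Reasoning
... | inj₂ q≤0 = begin
  ℚ.0ℚ                                          ≤⟨ 0≤+ (0≤* 0≤b-p (ℚ.neg-antimono-≤ q≤0)) (0≤* 0≤b 0≤q+ε) ⟩
  (b ℚ.- p) ℚ.* ℚ.- q ℚ.+ b ℚ.* (q ℚ.+ ε)       ≡⟨ identity p q ε b ⟩
  p ℚ.* q ℚ.+ b ℚ.* ε                           ∎
  where
  open ℚ.≤-Reasoning
  open ℚ.+-*-Solver
  0≤b : ℚ.0ℚ ℚ.≤ b
  0≤b = ℚ.≤-trans (ℚ.0≤∣p∣ p) p≤b
  0≤b-p : ℚ.0ℚ ℚ.≤ b ℚ.- p
  0≤b-p = ℚ.≤-trans (ℚ.≤-reflexive (sym (ℚ.+-inverseʳ p))) (ℚ.+-monoˡ-≤ (ℚ.- p) (ℚ.≤-trans (p≤∣p∣ p) p≤b))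
  identity : ∀ p q ε b → (b ℚ.- p) ℚ.* ℚ.- q ℚ.+ b ℚ.* (q ℚ.+ ε) ≡ p ℚ.* q ℚ.+ b ℚ.* ε
  identity = solve 4 (λ p q e b → (b :- p) :* (:- q) :+ b :* (q :+ e) := p :* q :+ b :* e) refl

*-nonNeg : ∀ {x y} → 0ℝ ≤ x → 0ℝ ≤ y → 0ℝ ≤ x * y
*-nonNeg {x} {y} (mk≤ h) (mk≤ k) = ≤-scaled (Bₓ ℕ.+ Bᵧ) λ ε 0<ε → map₂
  (λ i 0≤x 0≤y → *-almostNonNeg {seq x i} {seq y i} (ℚ.<⇒≤ 0<ε) 0≤x 0≤y
    (ℚ.≤-trans (proj₂ (∃bound x) i) (fromℕ-mono (ℕ.m≤m+n Bₓ Bᵧ)))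
    (ℚ.≤-trans (proj₂ (∃bound y) i) (fromℕ-mono (ℕ.m≤n+m Bᵧ Bₓ))))
  (h ε 0<ε) (k ε 0<ε)
  where
  Bₓ = proj₁ (∃bound x)
  Bᵧ = proj₁ (∃bound y)

*-monoˡ-≤ : ∀ {x y z} → 0ℝ ≤ z → x ≤ y → z * x ≤ z * y
*-monoˡ-≤ {x} {y} {z} 0≤z x≤y = 0≤y-x⇒x≤y (≤-trans (*-nonNeg 0≤z (x≤y⇒0≤y-x x≤y))
  (≈⇒≤ (solve 3 (λ x y z → z :* (y :- x) := z :* y :- z :* x) ≈-refl x y z)))
  where open ℝ-Solver

*-monoʳ-≤ : ∀ {x y z} → 0ℝ ≤ z → x ≤ y → x * z ≤ y * z
*-monoʳ-≤ {x} {y} {z} 0≤z x≤y =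
  ≤-trans (≈⇒≤ (*-comm x z)) (≤-trans (*-monoˡ-≤ 0≤z x≤y) (≈⇒≤ (*-comm z y)))

*-mono-≤ : ∀ {x y u v} → 0ℝ ≤ u → 0ℝ ≤ y → x ≤ y → u ≤ v → x * u ≤ y * v
*-mono-≤ 0≤u 0≤y x≤y u≤v = ≤-trans (*-monoʳ-≤ 0≤u x≤y) (*-monoˡ-≤ 0≤y u≤v)

-- Absolute values

∣∣-lub : ∀ {x c} → x ≤ c → - x ≤ c → ∣ x ∣ ≤ c
∣∣-lub {x} (mk≤ h) (mk≤ k) = mk≤ λ ε 0<ε → map₂ (λ i → ∣∣≤ {seq x i}) (h ε 0<ε) (k ε 0<ε)

x≤∣x∣ : ∀ x → x ≤ ∣ x ∣
x≤∣x∣ x = pointwise⇒≤ λ i → p≤∣p∣ (seq x i)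

∣-x∣≈∣x∣ : ∀ x → ∣ - x ∣ ≈ ∣ x ∣
∣-x∣≈∣x∣ x = pointwise⇒≈ λ i → ℚ.∣-p∣≡∣p∣ (seq x i)

0≤∣x∣ : ∀ x → 0ℝ ≤ ∣ x ∣
0≤∣x∣ x = pointwise⇒≤ λ i → ℚ.0≤∣p∣ (seq x i)

∣x+y∣≤∣x∣+∣y∣ : ∀ x y → ∣ x + y ∣ ≤ ∣ x ∣ + ∣ y ∣
∣x+y∣≤∣x∣+∣y∣ x y = pointwise⇒≤ λ i → ℚ.∣p+q∣≤∣p∣+∣q∣ (seq x i) (seq y i)

∣x*y∣≈∣x∣*∣y∣ : ∀ x y → ∣ x * y ∣ ≈ ∣ x ∣ * ∣ y ∣
∣x*y∣≈∣x∣*∣y∣ x y = pointwise⇒≈ λ i → ℚ.∣p*q∣≡∣p∣*∣q∣ (seq x i) (seq y i)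

∣∣-mono : ∀ {x y} → x ≈ y → ∣ x ∣ ≤ ∣ y ∣
∣∣-mono {x} {y} x≈y = ∣∣-lub (≤-trans (≈⇒≤ x≈y) (x≤∣x∣ y))
  (≤-trans (≈⇒≤ (neg-cong x≈y)) (≤-trans (x≤∣x∣ (- y)) (≈⇒≤ (∣-x∣≈∣x∣ y))))

∣∣-cong : ∀ {x y} → x ≈ y → ∣ x ∣ ≈ ∣ y ∣
∣∣-cong x≈y = ≤-antisym (∣∣-mono x≈y) (∣∣-mono (≈-sym x≈y))

0≤x⇒∣x∣≈x : ∀ {x} → 0ℝ ≤ x → ∣ x ∣ ≈ x
0≤x⇒∣x∣≈x {x} 0≤x = ≤-antisym
  (∣∣-lub ≤-refl (≤-trans (neg-anti-≤ 0≤x) (≤-trans (≈⇒≤ (solve 0 (:- con ℚ.0ℚ := con ℚ.0ℚ) ≈-refl)) 0≤x)))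
  (x≤∣x∣ x)
  where open ℝ-Solver

∣x-y∣≈∣y-x∣ : ∀ x y → ∣ x - y ∣ ≈ ∣ y - x ∣
∣x-y∣≈∣y-x∣ x y = pointwise⇒≈ λ i → dist-sym (seq x i) (seq y i)

∣x-z∣≤∣x-y∣+∣y-z∣ : ∀ x y z → ∣ x - z ∣ ≤ ∣ x - y ∣ + ∣ y - z ∣
∣x-z∣≤∣x-y∣+∣y-z∣ x y z = pointwise⇒≤ λ i → dist-trans (seq x i) (seq y i) (seq z i)

∣x-y∣≤z⇒x≤y+z : ∀ {x y z} → ∣ x - y ∣ ≤ z → x ≤ y + z
∣x-y∣≤z⇒x≤y+z {x} {y} {z} h = begin
  x            ≈⟨ solve 2 (λ x y → x := y :+ (x :- y)) ≈-refl x y ⟩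
  y + (x - y)  ≤⟨ +-monoʳ-≤ y (≤-trans (x≤∣x∣ (x - y)) h) ⟩
  y + z        ∎
  where
  open ≤-Reasoning
  open ℝ-Solver

∣x-y∣≤z⇒y≤x+z : ∀ {x y z} → ∣ x - y ∣ ≤ z → y ≤ x + z
∣x-y∣≤z⇒y≤x+z {x} {y} h = ∣x-y∣≤z⇒x≤y+z (≤-trans (≈⇒≤ (∣x-y∣≈∣y-x∣ y x)) h)

-- Rational approximation

fromℚ-mono : ∀ {p q} → p ℚ.≤ q → fromℚ p ≤ fromℚ q
fromℚ-mono p≤q = pointwise⇒≤ λ _ → p≤q

fromℚ-* : ∀ p q → fromℚ p * fromℚ q ≈ fromℚ (p ℚ.* q)
fromℚ-* p q = pointwise⇒≈ λ _ → refl

≤-byApprox : ∀ {x y} → (∀ ε → ℚ.0ℚ ℚ.< ε → x ≤ y + fromℚ ε) → x ≤ y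
≤-byApprox {x} {y} h = ≤-scaled 2 λ ε 0<ε → map₁
  (λ i x≤ → ℚ.≤-trans x≤ (ℚ.≤-reflexive
     (solve 2 (λ y e → y :+ e :+ e := y :+ con (fromℕ 2) :* e) refl (seq y i) ε)))
  (eventually≤ (h ε 0<ε) ε 0<ε)
  where
  open ℚ.+-*-Solver

abstract
  ∃rationalBound : ∀ x → ∃[ B ] ∣ x ∣ ≤ fromℚ (fromℕ B)
  ∃rationalBound x = proj₁ (∃bound x) , pointwise⇒≤ (proj₂ (∃bound x))

-- Strict inequality, reciprocals and square roots

<⇒≤ : ∀ {x y} → x < y → x ≤ y
<⇒≤ (mk< δ 0<δ h) = eventually⇒≤ (map₁ (λ i → ℚ.≤-trans (p≤p+q _ (ℚ.<⇒≤ 0<δ))) h)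

-- For each ε a comparison of rationals at one late index n settles the matter. If y n exceeds x n
-- by more than ε / 2, the excess persists and refutes the hypothesis; otherwise y stays below x +
-- ε. Each move between late indices costs ε / 8, which leaves a gap of ε / 8 in the first case.
≮⇒≥ : ∀ {x y} → ¬ (x < y) → y ≤ x
≮⇒≥ {x} {y} x≮y = mk≤ go
  where
  open ℚ.≤-Reasoning
  open ℚ.+-*-Solver
  go : ∀ ε → ℚ.0ℚ ℚ.< ε → Eventually (λ i → seq y i ℚ.≤ seq x i ℚ.+ ε)
  go ε 0<ε = decide (seq y n ℚ.≤? seq x n ℚ.+ ℚ.½ ℚ.* ε)
    where
    δ = + 1 ℚ./ 8 ℚ.* ε
    0<δ : ℚ.0ℚ ℚ.< δ
    0<δ = 0<* (ℚ.positive⁻¹ (+ 1 ℚ./ 8)) 0<ε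
    n = proj₁ (isCauchy x δ 0<δ) ℕ.⊔ proj₁ (isCauchy y δ 0<δ)
    nearx : ∀ i j → n ℕ.≤ i → n ℕ.≤ j → ℚ.∣ seq x i ℚ.- seq x j ∣ ℚ.≤ δ
    nearx i j n≤i n≤j = proj₂ (isCauchy x δ 0<δ) i j (ℕ.m⊔n≤o⇒m≤o _ _ n≤i) (ℕ.m⊔n≤o⇒m≤o _ _ n≤j)
    neary : ∀ i j → n ℕ.≤ i → n ℕ.≤ j → ℚ.∣ seq y i ℚ.- seq y j ∣ ℚ.≤ δ
    neary i j n≤i n≤j = proj₂ (isCauchy y δ 0<δ) i j (ℕ.m⊔n≤o⇒n≤o _ _ n≤i) (ℕ.m⊔n≤o⇒n≤o _ _ n≤j)
    decide : _ → _
    decide (yes y≤x) = n , λ i n≤i → begin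
      seq y i                                    ≤⟨ ≤dist {seq y i} {seq y n} (neary i n n≤i ℕ.≤-refl) ⟩
      seq y n ℚ.+ δ                              ≤⟨ ℚ.+-monoˡ-≤ δ y≤x ⟩
      seq x n ℚ.+ ℚ.½ ℚ.* ε ℚ.+ δ                ≤⟨ ℚ.+-monoˡ-≤ δ (ℚ.+-monoˡ-≤ _ (≤dist {seq x n} {seq x i} (nearx n i ℕ.≤-refl n≤i))) ⟩
      seq x i ℚ.+ δ ℚ.+ ℚ.½ ℚ.* ε ℚ.+ δ          ≤⟨ p≤p+q _ (ℚ.<⇒≤ (0<+ 0<δ (ℚ.<⇒≤ 0<δ))) ⟩
      seq x i ℚ.+ δ ℚ.+ ℚ.½ ℚ.* ε ℚ.+ δ ℚ.+ (δ ℚ.+ δ)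
        ≡⟨ solve 2 (λ x e → let d = con (+ 1 ℚ./ 8) :* e in x :+ d :+ con ℚ.½ :* e :+ d :+ (d :+ d) := x :+ e) refl (seq x i) ε ⟩
      seq x i ℚ.+ ε                              ∎
    decide (no y≰x) = contradiction (mk< δ 0<δ (n , λ i n≤i → begin
      seq x i ℚ.+ δ                    ≤⟨ ℚ.+-monoˡ-≤ δ (≤dist {seq x i} {seq x n} (nearx i n n≤i ℕ.≤-refl)) ⟩
      seq x n ℚ.+ δ ℚ.+ δ              ≤⟨ p≤p+q _ (ℚ.<⇒≤ 0<δ) ⟩
      seq x n ℚ.+ δ ℚ.+ δ ℚ.+ δ
        ≡⟨ solve 2 (λ x e → let d = con (+ 1 ℚ./ 8) :* e in x :+ d :+ d :+ d := x :+ con ℚ.½ :* e :- d) refl (seq x n) ε ⟩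
      seq x n ℚ.+ ℚ.½ ℚ.* ε ℚ.- δ      ≤⟨ ℚ.+-monoˡ-≤ (ℚ.- δ) (ℚ.<⇒≤ (ℚ.≰⇒> y≰x)) ⟩
      seq y n ℚ.- δ                    ≤⟨ ℚ.+-monoˡ-≤ (ℚ.- δ) (≤dist {seq y n} {seq y i} (neary n i ℕ.≤-refl n≤i)) ⟩
      seq y i ℚ.+ δ ℚ.- δ              ≡⟨ solve 2 (λ y d → y :+ d :- d := y) refl (seq y i) δ ⟩
      seq y i                          ∎)) x≮y

recip-nonNeg : ∀ x (0<x : 0ℝ < x) → 0ℝ ≤ recip x 0<x
recip-nonNeg x (mk< δ 0<δ _) = pointwise⇒≤ λ i →
  ℚ.<⇒≤ (inv-pos (seq x i ℚ.⊔ δ) (CauchyLemmas.0<⊔ (seq x i) 0<δ))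

recip-inverseʳ : ∀ x (0<x : 0ℝ < x) → x * recip x 0<x ≈ 1ℝ
recip-inverseʳ x (mk< δ 0<δ h) = ≤-antisym
  (eventually⇒≤ (map₁ (λ i δ≤x → ℚ.≤-reflexive (inverse i δ≤x)) h))
  (eventually⇒≤ (map₁ (λ i δ≤x → ℚ.≤-reflexive (sym (inverse i δ≤x))) h))
  where
  inverse : ∀ i → ℚ.0ℚ ℚ.+ δ ℚ.≤ seq x i →
    seq x i ℚ.* inv (seq x i ℚ.⊔ δ) (CauchyLemmas.0<⊔ (seq x i) 0<δ) ≡ ℚ.1ℚ
  inverse i δ≤x = trans
    (cong (ℚ._* inv (seq x i ℚ.⊔ δ) (CauchyLemmas.0<⊔ (seq x i) 0<δ))
      (sym (ℚ.p≥q⇒p⊔q≡p (ℚ.≤-trans (ℚ.≤-reflexive (sym (ℚ.+-identityˡ δ))) δ≤x))))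
    (inv-r (seq x i ℚ.⊔ δ) (CauchyLemmas.0<⊔ (seq x i) 0<δ))

√-square : ∀ {x} → 0ℝ ≤ x → √ x * √ x ≈ x
√-square {x} 0≤x = ≤-antisym lower upper
  where
  open ℚ.≤-Reasoning
  open ℚ.+-*-Solver
  s : ℕ → ℚ
  s i = sqrtApprox i (seq x i)
  B = proj₁ (∃bound (√ x))
  s≤B : ∀ i → s i ℚ.≤ fromℕ B
  s≤B i = ℚ.≤-trans (p≤∣p∣ (s i)) (proj₂ (∃bound (√ x)) i)
  lower : √ x * √ x ≤ x
  lower = mk≤ λ ε 0<ε → map₁
    (λ i 0≤x+ε → ℚ.≤-trans (SqrtLemmas.sqrtApprox-lower i (seq x i)) (ℚ.⊔-lub (p≤p+q (seq x i) (ℚ.<⇒≤ 0<ε)) 0≤x+ε))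
    (eventually≤ 0≤x ε 0<ε)
  upper : x ≤ √ x * √ x
  -- The constant comes from (s + e)² - s² = (e + 2 s) e with e + 2 s ≤ 1 + 2 B.
  upper = ≤-scaled (suc (B ℕ.+ B)) λ ε 0<ε → let (n , e≤ε) = archimedean 0<ε in n , λ i n≤i →
    let e = inv-suc i ; e≤ = ℚ.≤-trans (inv-suc-anti n≤i) e≤ε ; 0≤e = ℚ.<⇒≤ (inv-suc-pos i) in begin
      seq x i                               ≤⟨ ℚ.p≤p⊔q (seq x i) ℚ.0ℚ ⟩
      seq x i ℚ.⊔ ℚ.0ℚ                      ≤⟨ SqrtLemmas.sqrtApprox-upper i (seq x i) ⟩
      (s i ℚ.+ e) ℚ.* (s i ℚ.+ e)
        ≡⟨ solve 2 (λ s e → (s :+ e) :* (s :+ e) := s :* s :+ (e :+ (s :+ s)) :* e) refl (s i) e ⟩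
      s i ℚ.* s i ℚ.+ (e ℚ.+ (s i ℚ.+ s i)) ℚ.* e
        ≤⟨ ℚ.+-monoʳ-≤ (s i ℚ.* s i) (*-mono 0≤e
             (0≤+ 0≤1 (0≤+ (0≤fromℕ B) (0≤fromℕ B)))
             (ℚ.+-mono-≤ (inv-suc-anti {0} {i} ℕ.z≤n) (ℚ.+-mono-≤ (s≤B i) (s≤B i))) e≤) ⟩
      s i ℚ.* s i ℚ.+ (ℚ.1ℚ ℚ.+ (fromℕ B ℚ.+ fromℕ B)) ℚ.* ε
        ≡⟨ cong (λ b → s i ℚ.* s i ℚ.+ b ℚ.* ε)
             (trans (cong (ℚ.1ℚ ℚ.+_) (fromℤ-+ (+ B) (+ B))) (sym (fromℕ-suc (B ℕ.+ B)))) ⟩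
      s i ℚ.* s i ℚ.+ fromℕ (suc (B ℕ.+ B)) ℚ.* ε ∎

-- Limits

-- `HasSum u s` unfolds to `Converges (partialSum u) s`, so the facts below apply to series as they
-- stand.
Converges : (ℕ → ℝ) → ℝ → Set
Converges X x = ∀ ε → ℚ.0ℚ ℚ.< ε → Eventually (λ n → ∣ X n - x ∣ ≤ fromℚ ε)

-- For one fixed late n, the rational `diagonal n` lies within 3 δ of the late approximants of X p
-- and within δ of the late diagonal terms, which are the approximants of the limit. Hence δ = ε /
-- 4.
lim-converges : ∀ X (cX : IsCauchySequence X) → Converges X (lim X cX)
lim-converges X cX ε 0<ε = index n , λ p n≤p →
  eventually⇒≤ (map₂ (λ k near near′ → begin
      ℚ.∣ seq (X p) k ℚ.- diagonal k ∣
        ≤⟨ dist-trans (seq (X p) k) (diagonal n) (diagonal k) ⟩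
      ℚ.∣ seq (X p) k ℚ.- diagonal n ∣ ℚ.+ ℚ.∣ diagonal n ℚ.- diagonal k ∣
        ≤⟨ ℚ.+-mono-≤ (ℚ.≤-trans (ℚ.≤-reflexive (dist-sym (seq (X p) k) (diagonal n))) near) near′ ⟩
      δ ℚ.+ (δ ℚ.+ δ) ℚ.+ δ
        ≡⟨ solve 1 (λ e → let d = con (+ 1 ℚ./ 4) :* e in d :+ (d :+ d) :+ d := e) refl ε ⟩
      ε ∎)
    (diagonal-close n 0<δ (ℚ.≤-trans (inv-suc-anti (ℕ.m≤m⊔n K K′)) (proj₂ (archimedean 0<δ))) p n≤p)
    (K′ , λ k K′≤k → proj₂ (diagonal-cauchy δ 0<δ) n k (ℕ.m≤n⊔m K K′) K′≤k))
  where
  open Limit X cX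
  open ℚ.≤-Reasoning
  open ℚ.+-*-Solver
  δ = + 1 ℚ./ 4 ℚ.* ε
  0<δ : ℚ.0ℚ ℚ.< δ
  0<δ = 0<* (ℚ.positive⁻¹ (+ 1 ℚ./ 4)) 0<ε
  K = proj₁ (archimedean 0<δ)
  K′ = proj₁ (diagonal-cauchy δ 0<δ)
  n = K ℕ.⊔ K′

now : ∀ {P : ℕ → Set} (e : Eventually P) → P (proj₁ e)
now (n , p) = p n ℕ.≤-refl

converges-≥ : ∀ {X x y} → Converges X x → Eventually (λ n → y ≤ X n) → y ≤ x
converges-≥ {X} {x} {y} cX h = ≤-byApprox λ ε 0<ε →
  let (n , p) = map₂ (λ n near y≤Xn → ≤-trans y≤Xn (∣x-y∣≤z⇒x≤y+z near)) (cX ε 0<ε) h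
  in p n ℕ.≤-refl

converges-dist : ∀ {X Y x y c} → Converges X x → Converges Y y →
  Eventually (λ n → ∣ X n - Y n ∣ ≤ c) → ∣ x - y ∣ ≤ c
converges-dist {X} {Y} {x} {y} {c} cX cY h = ≤-byApprox λ ε 0<ε →
  now (map₂ (λ n near (near′ , X-Y≤c) → begin
    ∣ x - y ∣
      ≤⟨ ≤-trans (∣x-z∣≤∣x-y∣+∣y-z∣ x (X n) y) (+-monoʳ-≤ ∣ x - X n ∣ (∣x-z∣≤∣x-y∣+∣y-z∣ (X n) (Y n) y)) ⟩
    ∣ x - X n ∣ + (∣ X n - Y n ∣ + ∣ Y n - y ∣)
      ≤⟨ +-mono-≤ (≤-trans (≈⇒≤ (∣x-y∣≈∣y-x∣ x (X n))) near) (+-mono-≤ X-Y≤c near′) ⟩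
    fromℚ (ℚ.½ ℚ.* ε) + (c + fromℚ (ℚ.½ ℚ.* ε))
      ≈⟨ solve 2 (λ d c → d :+ (c :+ d) := c :+ (d :+ d)) ≈-refl (fromℚ (ℚ.½ ℚ.* ε)) c ⟩
    c + (fromℚ (ℚ.½ ℚ.* ε) + fromℚ (ℚ.½ ℚ.* ε))
      ≈⟨ +-congˡ (pointwise⇒≈ λ _ → half+half ε) ⟩
    c + fromℚ ε ∎)
  (cX _ (half 0<ε)) (map₂ (λ _ → _,_) (cY _ (half 0<ε)) h))
  where
  open ≤-Reasoning
  open ℝ-Solver

∣x-y∣≤ε⇒x≈y : ∀ {x y} → (∀ ε → ℚ.0ℚ ℚ.< ε → ∣ x - y ∣ ≤ fromℚ ε) → x ≈ y
∣x-y∣≤ε⇒x≈y h = ≤-antisym (≤-byApprox λ ε 0<ε → ∣x-y∣≤z⇒x≤y+z (h ε 0<ε))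
                           (≤-byApprox λ ε 0<ε → ∣x-y∣≤z⇒y≤x+z (h ε 0<ε))

converges-unique : ∀ {X Y x y} → Converges X x → Converges Y y →
  (∀ ε → ℚ.0ℚ ℚ.< ε → Eventually (λ n → ∣ X n - Y n ∣ ≤ fromℚ ε)) → x ≈ y
converges-unique cX cY h = ∣x-y∣≤ε⇒x≈y λ ε 0<ε → converges-dist cX cY (h ε 0<ε)

converges-neg : ∀ {X x} → Converges X x → Converges (λ n → - X n) (- x)
converges-neg {X} {x} cX ε 0<ε = map₁ (λ n near → ≤-trans
  (≤-trans (≈⇒≤ (∣∣-cong (solve 2 (λ a b → :- a :- :- b := :- (a :- b)) ≈-refl (X n) x)))
           (≈⇒≤ (∣-x∣≈∣x∣ (X n - x)))) near) (cX ε 0<ε)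
  where open ℝ-Solver

converges-+ : ∀ {X Y x y} → Converges X x → Converges Y y → Converges (λ n → X n + Y n) (x + y)
converges-+ {X} {Y} {x} {y} cX cY ε 0<ε = map₂
  (λ n near near′ → begin
    ∣ X n + Y n - (x + y) ∣
      ≈⟨ ∣∣-cong (solve 4 (λ X Y x y → X :+ Y :- (x :+ y) := X :- x :+ (Y :- y)) ≈-refl (X n) (Y n) x y) ⟩
    ∣ X n - x + (Y n - y) ∣              ≤⟨ ∣x+y∣≤∣x∣+∣y∣ _ _ ⟩
    ∣ X n - x ∣ + ∣ Y n - y ∣            ≤⟨ +-mono-≤ near near′ ⟩
    fromℚ (ℚ.½ ℚ.* ε) + fromℚ (ℚ.½ ℚ.* ε)  ≈⟨ (pointwise⇒≈ λ _ → half+half ε) ⟩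
    fromℚ ε ∎)
  (cX _ (half 0<ε)) (cY _ (half 0<ε))
  where
  open ≤-Reasoning
  open ℝ-Solver

converges-* : ∀ {X Y x y} → Converges X x → Converges Y y → Converges (λ n → X n * Y n) (x * y)
converges-* {X} {Y} {x} {y} cX cY ε 0<ε = map₂
  (λ n near near′ → begin
    ∣ X n * Y n - x * y ∣
      ≈⟨ ∣∣-cong (solve 4 (λ X Y x y → X :* Y :- x :* y := (X :- x) :* (Y :- y) :+ (x :* (Y :- y) :+ (X :- x) :* y))
           ≈-refl (X n) (Y n) x y) ⟩
    ∣ (X n - x) * (Y n - y) + (x * (Y n - y) + (X n - x) * y) ∣
      ≤⟨ ≤-trans (∣x+y∣≤∣x∣+∣y∣ _ _) (+-monoʳ-≤ _ (∣x+y∣≤∣x∣+∣y∣ _ _)) ⟩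
    ∣ (X n - x) * (Y n - y) ∣ + (∣ x * (Y n - y) ∣ + ∣ (X n - x) * y ∣)
      ≈⟨ +-cong (∣x*y∣≈∣x∣*∣y∣ _ _) (+-cong (∣x*y∣≈∣x∣*∣y∣ _ _) (∣x*y∣≈∣x∣*∣y∣ _ _)) ⟩
    ∣ X n - x ∣ * ∣ Y n - y ∣ + (∣ x ∣ * ∣ Y n - y ∣ + ∣ X n - x ∣ * ∣ y ∣)
      ≤⟨ +-mono-≤ (*-mono-≤ (0≤∣x∣ _) 0≤1ℝ (≤-trans near (fromℚ-mono δ≤1)) near′)
           (+-mono-≤ (*-mono-≤ (0≤∣x∣ _) (fromℚ-mono (0≤fromℕ Bₓ)) (proj₂ (∃rationalBound x)) near′)
                     (*-mono-≤ (0≤∣x∣ y) (fromℚ-mono (ℚ.<⇒≤ 0<δ)) near (proj₂ (∃rationalBound y)))) ⟩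
    1ℝ * fromℚ δ + (fromℚ (fromℕ Bₓ) * fromℚ δ + fromℚ δ * fromℚ (fromℕ Bᵧ))
      ≤⟨ pointwise⇒≤ (λ _ → δ-scaled) ⟩
    fromℚ ε ∎)
  (cX δ 0<δ) (cY δ 0<δ)
  where
  open ≤-Reasoning
  open ℝ-Solver
  Bₓ = proj₁ (∃rationalBound x)
  Bᵧ = proj₁ (∃rationalBound y)
  0≤1ℝ : 0ℝ ≤ 1ℝ
  0≤1ℝ = fromℚ-mono 0≤1
  -- Capping ε at 1 gives δ ≤ 1, so the quadratic error (X n - x) (Y n - y) is at most δ and all
  -- errors add up to at most (1 + Bₓ + Bᵧ) δ = ε′.
  ε′ = ε ℚ.⊓ ℚ.1ℚ
  0<ε′ : ℚ.0ℚ ℚ.< ε′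
  0<ε′ with ℚ.≤-total ε ℚ.1ℚ
  ... | inj₁ ε≤1 rewrite ℚ.p≤q⇒p⊓q≡p ε≤1 = 0<ε
  ... | inj₂ 1≤ε rewrite ℚ.p≥q⇒p⊓q≡q 1≤ε = 0<1
  δ = inv-suc (Bₓ ℕ.+ Bᵧ) ℚ.* ε′
  0<δ : ℚ.0ℚ ℚ.< δ
  0<δ = 0<* (inv-suc-pos (Bₓ ℕ.+ Bᵧ)) 0<ε′
  δ≤1 : δ ℚ.≤ ℚ.1ℚ
  δ≤1 = *-mono {inv-suc (Bₓ ℕ.+ Bᵧ)} {ℚ.1ℚ} (ℚ.<⇒≤ 0<ε′) 0≤1 (inv-suc-anti {0} {Bₓ ℕ.+ Bᵧ} ℕ.z≤n) (ℚ.p⊓q≤q ε ℚ.1ℚ)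
  δ-scaled : ℚ.1ℚ ℚ.* δ ℚ.+ (fromℕ Bₓ ℚ.* δ ℚ.+ δ ℚ.* fromℕ Bᵧ) ℚ.≤ ε
  δ-scaled = ℚ.≤-trans (ℚ.≤-reflexive eq) (ℚ.p⊓q≤p ε ℚ.1ℚ)
    where
    B : ℕ
    B = Bₓ ℕ.+ Bᵧ
    collect : ∀ d a b → ℚ.1ℚ ℚ.* d ℚ.+ (a ℚ.* d ℚ.+ d ℚ.* b) ≡ (ℚ.1ℚ ℚ.+ (a ℚ.+ b)) ℚ.* d
    collect = Q.solve 3 (λ d a b → Q.con ℚ.1ℚ Q.:* d Q.:+ (a Q.:* d Q.:+ d Q.:* b) Q.:= (Q.con ℚ.1ℚ Q.:+ (a Q.:+ b)) Q.:* d) refl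
      where module Q = ℚ.+-*-Solver
    eq : ℚ.1ℚ ℚ.* δ ℚ.+ (fromℕ Bₓ ℚ.* δ ℚ.+ δ ℚ.* fromℕ Bᵧ) ≡ ε′
    eq = trans (collect δ (fromℕ Bₓ) (fromℕ Bᵧ))
      (trans (cong (ℚ._* δ) (trans (cong (ℚ.1ℚ ℚ.+_) (fromℤ-+ (+ Bₓ) (+ Bᵧ))) (sym (fromℕ-suc B))))
      (trans (sym (ℚ.*-assoc (fromℕ (suc B)) (inv-suc B) ε′))
      (trans (cong (ℚ._* ε′) (inv-r (fromℕ (suc B)) (0<fromℕ-suc B))) (ℚ.*-identityˡ ε′))))

-- Geometric series

½^ : ℕ → ℚ
½^ zero    = ℚ.1ℚ
½^ (suc n) = ℚ.½ ℚ.* ½^ n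

0<½^ : ∀ n → ℚ.0ℚ ℚ.< ½^ n
0<½^ zero    = 0<1
0<½^ (suc n) = half (0<½^ n)

0≤½^ : ∀ n → ℚ.0ℚ ℚ.≤ ½^ n
0≤½^ n = ℚ.<⇒≤ (0<½^ n)

½^-anti : ∀ d n → ½^ (d ℕ.+ n) ℚ.≤ ½^ n
½^-anti zero    n = ℚ.≤-refl
½^-anti (suc d) n = ℚ.≤-trans (ℚ.≤-trans (p≤p+q _ (0≤½^ (suc d ℕ.+ n))) (ℚ.≤-reflexive (half+half (½^ (d ℕ.+ n))))) (½^-anti d n)

-- Supplies the decay of the powers of ½: they are at most 1 / (n + 1), which `archimedean` makes
-- small.
n*½^n≤1 : ∀ n → fromℕ (suc n) ℚ.* ½^ n ℚ.≤ ℚ.1ℚ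
n*½^n≤1 zero    = ℚ.≤-refl
n*½^n≤1 (suc n) = begin
  fromℕ (suc (suc n)) ℚ.* (ℚ.½ ℚ.* ½^ n)
    ≡⟨ cong (ℚ._* (ℚ.½ ℚ.* ½^ n)) (trans (fromℕ-suc (suc n)) (cong (ℚ.1ℚ ℚ.+_) (fromℕ-suc n))) ⟩
  (ℚ.1ℚ ℚ.+ (ℚ.1ℚ ℚ.+ fromℕ n)) ℚ.* (ℚ.½ ℚ.* ½^ n)
    ≤⟨ p≤p+q _ (0≤* (0≤fromℕ n) (0≤½^ (suc n))) ⟩
  (ℚ.1ℚ ℚ.+ (ℚ.1ℚ ℚ.+ fromℕ n)) ℚ.* (ℚ.½ ℚ.* ½^ n) ℚ.+ fromℕ n ℚ.* (ℚ.½ ℚ.* ½^ n)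
    ≡⟨ solve 2 (λ m h → (con ℚ.1ℚ :+ (con ℚ.1ℚ :+ m)) :* (con ℚ.½ :* h) :+ m :* (con ℚ.½ :* h) := (con ℚ.1ℚ :+ m) :* h)
         refl (fromℕ n) (½^ n) ⟩
  (ℚ.1ℚ ℚ.+ fromℕ n) ℚ.* ½^ n
    ≡⟨ cong (ℚ._* ½^ n) (fromℕ-suc n) ⟨
  fromℕ (suc n) ℚ.* ½^ n
    ≤⟨ n*½^n≤1 n ⟩
  ℚ.1ℚ ∎
  where
  open ℚ.≤-Reasoning
  open ℚ.+-*-Solver

geometric-small : ∀ B ε → ℚ.0ℚ ℚ.< ε → Eventually (λ n → fromℕ B ℚ.* ½^ n ℚ.≤ ε)
geometric-small B ε 0<ε = m , λ n m≤n → begin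
  fromℕ B ℚ.* ½^ n                                 ≤⟨ *-monoʳ (0≤½^ n) (fromℕ-mono (ℕ.n≤1+n B)) ⟩
  fromℕ (suc B) ℚ.* ½^ n                           ≤⟨ *-monoˡ (0≤fromℕ (suc B)) (½^n≤ n m≤n) ⟩
  fromℕ (suc B) ℚ.* (inv-suc B ℚ.* ε)              ≡⟨ ℚ.*-assoc (fromℕ (suc B)) (inv-suc B) ε ⟨
  fromℕ (suc B) ℚ.* inv-suc B ℚ.* ε                ≡⟨ cong (ℚ._* ε) (inv-r (fromℕ (suc B)) (0<fromℕ-suc B)) ⟩
  ℚ.1ℚ ℚ.* ε                                       ≡⟨ ℚ.*-identityˡ ε ⟩
  ε                                                ∎
  where
  open ℚ.≤-Reasoning
  open ℚ.+-*-Solver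
  0<δ : ℚ.0ℚ ℚ.< inv-suc B ℚ.* ε
  0<δ = 0<* (inv-suc-pos B) 0<ε
  m = proj₁ (archimedean 0<δ)
  ½^n≤ : ∀ n → m ℕ.≤ n → ½^ n ℚ.≤ inv-suc B ℚ.* ε
  ½^n≤ n m≤n = begin
    ½^ n                                       ≡⟨ ℚ.*-identityˡ (½^ n) ⟨
    ℚ.1ℚ ℚ.* ½^ n                              ≡⟨ cong (ℚ._* ½^ n) (inv-r (fromℕ (suc n)) (0<fromℕ-suc n)) ⟨
    fromℕ (suc n) ℚ.* inv-suc n ℚ.* ½^ n       ≡⟨ solve 3 (λ a b c → a :* b :* c := b :* (a :* c)) refl (fromℕ (suc n)) (inv-suc n) (½^ n) ⟩
    inv-suc n ℚ.* (fromℕ (suc n) ℚ.* ½^ n)     ≤⟨ *-monoˡ (ℚ.<⇒≤ (inv-suc-pos n)) (n*½^n≤1 n) ⟩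
    inv-suc n ℚ.* ℚ.1ℚ                         ≡⟨ ℚ.*-identityʳ (inv-suc n) ⟩
    inv-suc n                                  ≤⟨ ℚ.≤-trans (inv-suc-anti m≤n) (proj₂ (archimedean 0<δ)) ⟩
    inv-suc B ℚ.* ε                            ∎

module _ (u : ℕ → ℝ) (B : ℕ) (u≤ : ∀ n → ∣ u n ∣ ≤ fromℚ (fromℕ B ℚ.* ½^ n)) where

  private
    g : ℕ → ℝ
    g n = fromℚ (fromℕ B ℚ.* ½^ n)

    g-halves : ∀ n → g (suc n) + g (suc n) ≈ g n
    g-halves n = pointwise⇒≈ λ _ → solve 2 (λ b h → b :* (con ℚ.½ :* h) :+ b :* (con ℚ.½ :* h) := b :* h) refl (fromℕ B) (½^ n)
      where open ℚ.+-*-Solver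

    0≤g : ∀ n → 0ℝ ≤ g n
    0≤g n = fromℚ-mono (0≤* (0≤fromℕ B) (0≤½^ n))

    -- The allowance g + g for all later terms stands on the left to make the induction close: a new
    -- term costs at most g n, which is exactly what the allowance loses in passing from n to n + 1.
    tail : ∀ m d → ∣ partialSum u (d ℕ.+ m) - partialSum u m ∣ + (g (d ℕ.+ m) + g (d ℕ.+ m)) ≤ g m + g m
    tail m zero = ≤-trans (+-monoˡ-≤ _ (≤-trans (≈⇒≤ (∣∣-cong (-‿inverseʳ _))) (≈⇒≤ (0≤x⇒∣x∣≈x ≤-refl))))
                          (≈⇒≤ (+-identityˡ _))
    tail m (suc d) = begin
      ∣ S + u n - partialSum u m ∣ + (g (suc n) + g (suc n))
        ≈⟨ +-cong (∣∣-cong (solve 3 (λ s u t → s :+ u :- t := s :- t :+ u) ≈-refl S (u n) (partialSum u m))) (g-halves n) ⟩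
      ∣ S - partialSum u m + u n ∣ + g n
        ≤⟨ +-monoˡ-≤ (g n) (≤-trans (∣x+y∣≤∣x∣+∣y∣ _ _) (+-monoʳ-≤ _ (u≤ n))) ⟩
      ∣ S - partialSum u m ∣ + g n + g n
        ≈⟨ +-assoc _ _ _ ⟩
      ∣ S - partialSum u m ∣ + (g n + g n)
        ≤⟨ tail m d ⟩
      g m + g m ∎
      where
      open ≤-Reasoning
      open ℝ-Solver
      n = d ℕ.+ m
      S = partialSum u n

    tail′ : ∀ m n → m ℕ.≤ n → ∣ partialSum u n - partialSum u m ∣ ≤ g m + g m
    tail′ m n m≤n = subst (λ n → ∣ partialSum u n - partialSum u m ∣ ≤ g m + g m) (ℕ.m∸n+n≡m m≤n)
      (≤-trans (≈⇒≤ (≈-sym (+-identityʳ _)))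
        (≤-trans (+-monoʳ-≤ _ (+-nonNeg (0≤g (n ℕ.∸ m ℕ.+ m)) (0≤g (n ℕ.∸ m ℕ.+ m)))) (tail m (n ℕ.∸ m))))

  geometric⇒cauchy : IsCauchySequence (partialSum u)
  geometric⇒cauchy ε 0<ε = m , λ i j m≤i m≤j → begin
    ∣ partialSum u i - partialSum u j ∣
      ≤⟨ ∣x-z∣≤∣x-y∣+∣y-z∣ _ (partialSum u m) _ ⟩
    ∣ partialSum u i - partialSum u m ∣ + ∣ partialSum u m - partialSum u j ∣
      ≤⟨ +-mono-≤ (tail′ m i m≤i) (≤-trans (≈⇒≤ (∣x-y∣≈∣y-x∣ _ _)) (tail′ m j m≤j)) ⟩
    (g m + g m) + (g m + g m)
      ≤⟨ pointwise⇒≤ (λ _ → ℚ.≤-trans (ℚ.≤-reflexive quadruple) small) ⟩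
    fromℚ ε ∎
    where
    open ≤-Reasoning
    m = proj₁ (geometric-small (4 ℕ.* B) ε 0<ε)
    small = now (geometric-small (4 ℕ.* B) ε 0<ε)
    quadruple : fromℕ B ℚ.* ½^ m ℚ.+ fromℕ B ℚ.* ½^ m ℚ.+ (fromℕ B ℚ.* ½^ m ℚ.+ fromℕ B ℚ.* ½^ m) ≡ fromℕ (4 ℕ.* B) ℚ.* ½^ m
    quadruple = trans (solve 2 (λ b h → b :* h :+ b :* h :+ (b :* h :+ b :* h) := con (fromℕ 4) :* b :* h) refl (fromℕ B) (½^ m))
      (cong (ℚ._* ½^ m) (fromℕ-* 4 B))
      where open ℚ.+-*-Solver

  geometric⇒hasSum : HasSum u (lim (partialSum u) geometric⇒cauchy)
  geometric⇒hasSum = lim-converges (partialSum u) geometric⇒cauchy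

-- Complex numbers with rational parts

-- Holds the approximants of a complex number at one index. Here equality is `_≡_` and the algebra
-- of power series is exact, so that only error bounds have to be carried over to `ℂ`.
ℚᶜ : Set
ℚᶜ = ℚ × ℚ

infixl 6 _⊕_ _⊖_
infixl 7 _⊗_

0# 1# : ℚᶜ
0# = ℚ.0ℚ , ℚ.0ℚ
1# = ℚ.1ℚ , ℚ.0ℚ

_⊕_ _⊗_ _⊖_ : ℚᶜ → ℚᶜ → ℚᶜ
(a , b) ⊕ (c , d) = a ℚ.+ c , b ℚ.+ d
(a , b) ⊗ (c , d) = a ℚ.* c ℚ.- b ℚ.* d , a ℚ.* d ℚ.+ b ℚ.* c

neg conj : ℚᶜ → ℚᶜ
neg  (a , b) = ℚ.- a , ℚ.- b
conj (a , b) = a , ℚ.- b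

z ⊖ w = z ⊕ neg w

ℚᶜ-commutativeRing : CommutativeRing 0ℓ 0ℓ
ℚᶜ-commutativeRing = record
  { Carrier = ℚᶜ ; _≈_ = _≡_ ; _+_ = _⊕_ ; _*_ = _⊗_ ; -_ = neg ; 0# = 0# ; 1# = 1#
  ; isCommutativeRing = record
    { isRing = record
      { +-isAbelianGroup = record
        { isGroup = record
          { isMonoid = record
            { isSemigroup = record
              { isMagma = record { isEquivalence = isEquivalence ; ∙-cong = cong₂ _⊕_ }
              ; assoc = λ { (a , b) (c , d) (e , f) → cong₂ _,_ (ℚ.+-assoc a c e) (ℚ.+-assoc b d f) } }
            ; identity = (λ { (a , b) → cong₂ _,_ (ℚ.+-identityˡ a) (ℚ.+-identityˡ b) })
                       , (λ { (a , b) → cong₂ _,_ (ℚ.+-identityʳ a) (ℚ.+-identityʳ b) }) }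
          ; inverse = (λ { (a , b) → cong₂ _,_ (ℚ.+-inverseˡ a) (ℚ.+-inverseˡ b) })
                    , (λ { (a , b) → cong₂ _,_ (ℚ.+-inverseʳ a) (ℚ.+-inverseʳ b) })
          ; ⁻¹-cong = cong neg }
        ; comm = λ { (a , b) (c , d) → cong₂ _,_ (ℚ.+-comm a c) (ℚ.+-comm b d) } }
      ; *-cong = cong₂ _⊗_
      ; *-assoc = λ { (a , b) (c , d) (e , f) → cong₂ _,_
          (solve 6 (λ a b c d e f → (a :* c :- b :* d) :* e :- (a :* d :+ b :* c) :* f :=
                                    a :* (c :* e :- d :* f) :- b :* (c :* f :+ d :* e)) refl a b c d e f)
          (solve 6 (λ a b c d e f → (a :* c :- b :* d) :* f :+ (a :* d :+ b :* c) :* e :=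
                                    a :* (c :* f :+ d :* e) :+ b :* (c :* e :- d :* f)) refl a b c d e f) }
      ; *-identity =
          (λ { (a , b) → cong₂ _,_ (solve 2 (λ a b → con ℚ.1ℚ :* a :- con ℚ.0ℚ :* b := a) refl a b)
                                   (solve 2 (λ a b → con ℚ.1ℚ :* b :+ con ℚ.0ℚ :* a := b) refl a b) })
        , (λ { (a , b) → cong₂ _,_ (solve 2 (λ a b → a :* con ℚ.1ℚ :- b :* con ℚ.0ℚ := a) refl a b)
                                   (solve 2 (λ a b → a :* con ℚ.0ℚ :+ b :* con ℚ.1ℚ := b) refl a b) })
      ; distrib =
          (λ { (a , b) (c , d) (e , f) → cong₂ _,_
            (solve 6 (λ a b c d e f → a :* (c :+ e) :- b :* (d :+ f) := (a :* c :- b :* d) :+ (a :* e :- b :* f)) refl a b c d e f)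
            (solve 6 (λ a b c d e f → a :* (d :+ f) :+ b :* (c :+ e) := (a :* d :+ b :* c) :+ (a :* f :+ b :* e)) refl a b c d e f) })
        , (λ { (a , b) (c , d) (e , f) → cong₂ _,_
            (solve 6 (λ a b c d e f → (c :+ e) :* a :- (d :+ f) :* b := (c :* a :- d :* b) :+ (e :* a :- f :* b)) refl a b c d e f)
            (solve 6 (λ a b c d e f → (c :+ e) :* b :+ (d :+ f) :* a := (c :* b :+ d :* a) :+ (e :* b :+ f :* a)) refl a b c d e f) }) }
    ; *-comm = λ { (a , b) (c , d) → cong₂ _,_
        (solve 4 (λ a b c d → a :* c :- b :* d := c :* a :- d :* b) refl a b c d)
        (solve 4 (λ a b c d → a :* d :+ b :* c := c :* b :+ d :* a) refl a b c d) } } }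
  where open ℚ.+-*-Solver

module ℚᶜ-Solver = Algebra.Solver.Ring.Simple (fromCommutativeRing ℚᶜ-commutativeRing) (×.≡-dec ℚ._≟_ ℚ._≟_)

ι : ℚ → ℚᶜ
ι p = p , ℚ.0ℚ

ι-* : ∀ p q → ι p ⊗ ι q ≡ ι (p ℚ.* q)
ι-* p q = cong₂ _,_
  (solve 2 (λ p q → p :* q :- con ℚ.0ℚ :* con ℚ.0ℚ := p :* q) refl p q)
  (solve 2 (λ p q → p :* con ℚ.0ℚ :+ con ℚ.0ℚ :* q := con ℚ.0ℚ) refl p q)
  where open ℚ.+-*-Solver

ι-suc : ∀ n → ι (fromℕ (suc n)) ≡ 1# ⊕ ι (fromℕ n)
ι-suc n = cong₂ _,_ (fromℕ-suc n) refl

-- The ℓ¹ norm: rational-valued, in contrast to the modulus, and still submultiplicative.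
‖_‖ : ℚᶜ → ℚ
‖ a , b ‖ = ℚ.∣ a ∣ ℚ.+ ℚ.∣ b ∣

0≤‖‖ : ∀ z → ℚ.0ℚ ℚ.≤ ‖ z ‖
0≤‖‖ (a , b) = 0≤+ (ℚ.0≤∣p∣ a) (ℚ.0≤∣p∣ b)

‖⊕‖≤ : ∀ z w → ‖ z ⊕ w ‖ ℚ.≤ ‖ z ‖ ℚ.+ ‖ w ‖
‖⊕‖≤ (a , b) (c , d) = ℚ.≤-trans (ℚ.+-mono-≤ (ℚ.∣p+q∣≤∣p∣+∣q∣ a c) (ℚ.∣p+q∣≤∣p∣+∣q∣ b d))
  (ℚ.≤-reflexive (solve 4 (λ a b c d → a :+ c :+ (b :+ d) := a :+ b :+ (c :+ d)) refl ℚ.∣ a ∣ ℚ.∣ b ∣ ℚ.∣ c ∣ ℚ.∣ d ∣))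
  where open ℚ.+-*-Solver

‖⊗‖≤ : ∀ z w → ‖ z ⊗ w ‖ ℚ.≤ ‖ z ‖ ℚ.* ‖ w ‖
‖⊗‖≤ (a , b) (c , d) = begin
  ℚ.∣ a ℚ.* c ℚ.- b ℚ.* d ∣ ℚ.+ ℚ.∣ a ℚ.* d ℚ.+ b ℚ.* c ∣
    ≤⟨ ℚ.+-mono-≤ (ℚ.∣p+q∣≤∣p∣+∣q∣ (a ℚ.* c) (ℚ.- (b ℚ.* d))) (ℚ.∣p+q∣≤∣p∣+∣q∣ (a ℚ.* d) (b ℚ.* c)) ⟩
  ℚ.∣ a ℚ.* c ∣ ℚ.+ ℚ.∣ ℚ.- (b ℚ.* d) ∣ ℚ.+ (ℚ.∣ a ℚ.* d ∣ ℚ.+ ℚ.∣ b ℚ.* c ∣)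
    ≡⟨ cong₂ ℚ._+_ (cong₂ ℚ._+_ (ℚ.∣p*q∣≡∣p∣*∣q∣ a c) (trans (ℚ.∣-p∣≡∣p∣ (b ℚ.* d)) (ℚ.∣p*q∣≡∣p∣*∣q∣ b d)))
                   (cong₂ ℚ._+_ (ℚ.∣p*q∣≡∣p∣*∣q∣ a d) (ℚ.∣p*q∣≡∣p∣*∣q∣ b c)) ⟩
  ℚ.∣ a ∣ ℚ.* ℚ.∣ c ∣ ℚ.+ ℚ.∣ b ∣ ℚ.* ℚ.∣ d ∣ ℚ.+ (ℚ.∣ a ∣ ℚ.* ℚ.∣ d ∣ ℚ.+ ℚ.∣ b ∣ ℚ.* ℚ.∣ c ∣)
    ≡⟨ solve 4 (λ a b c d → a :* c :+ b :* d :+ (a :* d :+ b :* c) := (a :+ b) :* (c :+ d)) refl ℚ.∣ a ∣ ℚ.∣ b ∣ ℚ.∣ c ∣ ℚ.∣ d ∣ ⟩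
  (ℚ.∣ a ∣ ℚ.+ ℚ.∣ b ∣) ℚ.* (ℚ.∣ c ∣ ℚ.+ ℚ.∣ d ∣) ∎
  where
  open ℚ.≤-Reasoning
  open ℚ.+-*-Solver

‖⊗‖-mono : ∀ z w {p q} → ‖ z ‖ ℚ.≤ p → ‖ w ‖ ℚ.≤ q → ‖ z ⊗ w ‖ ℚ.≤ p ℚ.* q
‖⊗‖-mono z w z≤p w≤q = ℚ.≤-trans (‖⊗‖≤ z w) (*-mono (0≤‖‖ w) (ℚ.≤-trans (0≤‖‖ z) z≤p) z≤p w≤q)

‖⊕‖-mono : ∀ z w {p q} → ‖ z ‖ ℚ.≤ p → ‖ w ‖ ℚ.≤ q → ‖ z ⊕ w ‖ ℚ.≤ p ℚ.+ q
‖⊕‖-mono z w z≤p w≤q = ℚ.≤-trans (‖⊕‖≤ z w) (ℚ.+-mono-≤ z≤p w≤q)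

‖ι‖ : ∀ {p} → ℚ.0ℚ ℚ.≤ p → ‖ ι p ‖ ≡ p
‖ι‖ {p} 0≤p = trans (ℚ.+-identityʳ ℚ.∣ p ∣) (ℚ.0≤p⇒∣p∣≡p 0≤p)

-- Power series

∑ᶜ : (ℕ → ℚᶜ) → ℕ → ℚᶜ
∑ᶜ a zero    = 0#
∑ᶜ a (suc n) = ∑ᶜ a n ⊕ a n

∑ᶜ-cong : ∀ {a b} → (∀ k → a k ≡ b k) → ∀ n → ∑ᶜ a n ≡ ∑ᶜ b n
∑ᶜ-cong a≡b zero    = refl
∑ᶜ-cong a≡b (suc n) = cong₂ _⊕_ (∑ᶜ-cong a≡b n) (a≡b n)

∑ᶜ-front : ∀ a n → ∑ᶜ a (suc n) ≡ a 0 ⊕ ∑ᶜ (a ∘ suc) n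
∑ᶜ-front a zero    = solve 1 (λ x → con 0# :+ x := x :+ con 0#) refl (a 0)
  where open ℚᶜ-Solver
∑ᶜ-front a (suc n) = trans (cong (_⊕ a (suc n)) (∑ᶜ-front a n))
  (solve 3 (λ x y z → x :+ y :+ z := x :+ (y :+ z)) refl (a 0) (∑ᶜ (a ∘ suc) n) (a (suc n)))
  where open ℚᶜ-Solver

-- The Cauchy product, whose k-th coefficient is the sum of a i ⊗ b j over i + j = k.
conv : (a b : ℕ → ℚᶜ) → ℕ → ℚᶜ
conv a b zero    = a 0 ⊗ b 0
conv a b (suc k) = a 0 ⊗ b (suc k) ⊕ conv (a ∘ suc) b k

conv-cong : ∀ {a a′ b b′} → (∀ k → a k ≡ a′ k) → (∀ k → b k ≡ b′ k) → ∀ k → conv a b k ≡ conv a′ b′ k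
conv-cong a≡a′ b≡b′ zero    = cong₂ _⊗_ (a≡a′ 0) (b≡b′ 0)
conv-cong a≡a′ b≡b′ (suc k) = cong₂ _⊕_ (cong₂ _⊗_ (a≡a′ 0) (b≡b′ (suc k))) (conv-cong (a≡a′ ∘ suc) b≡b′ k)

conv-+ˡ : ∀ a a′ b k → conv (λ i → a i ⊕ a′ i) b k ≡ conv a b k ⊕ conv a′ b k
conv-+ˡ a a′ b zero    = solve 3 (λ x y z → (x :+ y) :* z := x :* z :+ y :* z) refl (a 0) (a′ 0) (b 0)
  where open ℚᶜ-Solver
conv-+ˡ a a′ b (suc k) = trans (cong ((a 0 ⊕ a′ 0) ⊗ b (suc k) ⊕_) (conv-+ˡ (a ∘ suc) (a′ ∘ suc) b k))
  (solve 5 (λ x y z s t → (x :+ y) :* z :+ (s :+ t) := (x :* z :+ s) :+ (y :* z :+ t)) refl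
    (a 0) (a′ 0) (b (suc k)) (conv (a ∘ suc) b k) (conv (a′ ∘ suc) b k))
  where open ℚᶜ-Solver

conv-scaleˡ : ∀ z a b k → conv (λ i → z ⊗ a i) b k ≡ z ⊗ conv a b k
conv-scaleˡ z a b zero    = solve 3 (λ z x y → z :* x :* y := z :* (x :* y)) refl z (a 0) (b 0)
  where open ℚᶜ-Solver
conv-scaleˡ z a b (suc k) = trans (cong (z ⊗ a 0 ⊗ b (suc k) ⊕_) (conv-scaleˡ z (a ∘ suc) b k))
  (solve 4 (λ z x y s → z :* x :* y :+ z :* s := z :* (x :* y :+ s)) refl z (a 0) (b (suc k)) (conv (a ∘ suc) b k))
  where open ℚᶜ-Solver

conv-scaleʳ : ∀ z a b k → conv a (λ i → z ⊗ b i) k ≡ z ⊗ conv a b k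
conv-scaleʳ z a b zero    = solve 3 (λ z x y → x :* (z :* y) := z :* (x :* y)) refl z (a 0) (b 0)
  where open ℚᶜ-Solver
conv-scaleʳ z a b (suc k) = trans (cong (a 0 ⊗ (z ⊗ b (suc k)) ⊕_) (conv-scaleʳ z (a ∘ suc) b k))
  (solve 4 (λ z x y s → x :* (z :* y) :+ z :* s := z :* (x :* y :+ s)) refl z (a 0) (b (suc k)) (conv (a ∘ suc) b k))
  where open ℚᶜ-Solver

deriv : (ℕ → ℚᶜ) → ℕ → ℚᶜ
deriv a k = ι (fromℕ (suc k)) ⊗ a (suc k)

-- Writing k + 2 as 1 + (k + 1), the induction hypothesis for a ∘ suc takes the part with k + 1. The
-- remaining copy of `conv a′ b` turns the derivative of the shifted sequence into the shifted
-- derivative, as recorded by `shift`.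
leibniz : ∀ a b k → deriv (conv a b) k ≡ conv (deriv a) b k ⊕ conv a (deriv b) k
leibniz a b zero = solve 4 (λ x x′ y y′ → con 1# :* (x :* y′ :+ x′ :* y) := con 1# :* x′ :* y :+ x :* (con 1# :* y′)) refl
    (a 0) (a 1) (b 0) (b 1)
  where open ℚᶜ-Solver
leibniz a b (suc k) = begin
  m′ ⊗ (a 0 ⊗ b″ ⊕ conv a′ b (suc k))
    ≡⟨ cong (λ m → m ⊗ (a 0 ⊗ b″ ⊕ conv a′ b (suc k))) (ι-suc (suc k)) ⟩
  (1# ⊕ m) ⊗ (a 0 ⊗ b″ ⊕ conv a′ b (suc k))
    ≡⟨ solve 4 (λ m x y c → (con 1# :+ m) :* (x :* y :+ c) := (con 1# :+ m) :* (x :* y) :+ c :+ m :* c) refl m (a 0) b″ (conv a′ b (suc k)) ⟩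
  (1# ⊕ m) ⊗ (a 0 ⊗ b″) ⊕ conv a′ b (suc k) ⊕ m ⊗ conv a′ b (suc k)
    ≡⟨ cong₂ (λ m c → m ⊗ (a 0 ⊗ b″) ⊕ conv a′ b (suc k) ⊕ c) (sym (ι-suc (suc k))) (leibniz a′ b k) ⟩
  m′ ⊗ (a 0 ⊗ b″) ⊕ (a 1 ⊗ b (suc k) ⊕ conv (a′ ∘ suc) b k) ⊕ (conv (deriv a′) b k ⊕ conv a′ (deriv b) k)
    ≡⟨ solve 8 (λ m x y x′ y′ c d e → m :* (x :* y) :+ (x′ :* y′ :+ c) :+ (d :+ e) := (con 1# :* x′ :* y′ :+ (c :+ d)) :+ (x :* (m :* y) :+ e)) refl
         m′ (a 0) b″ (a 1) (b (suc k)) (conv (a′ ∘ suc) b k) (conv (deriv a′) b k) (conv a′ (deriv b) k) ⟩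
  (1# ⊗ a 1 ⊗ b (suc k) ⊕ (conv (a′ ∘ suc) b k ⊕ conv (deriv a′) b k)) ⊕ (a 0 ⊗ (m′ ⊗ b″) ⊕ conv a′ (deriv b) k)
    ≡⟨ cong (λ c → (1# ⊗ a 1 ⊗ b (suc k) ⊕ c) ⊕ conv a (deriv b) (suc k)) (trans
         (sym (conv-+ˡ (a′ ∘ suc) (deriv a′) b k))
         (conv-cong shift (λ _ → refl) k)) ⟩
  conv (deriv a) b (suc k) ⊕ conv a (deriv b) (suc k) ∎
  where
  open ≡-Reasoning
  open ℚᶜ-Solver
  m = ι (fromℕ (suc k))
  m′ = ι (fromℕ (suc (suc k)))
  a′ = a ∘ suc
  b″ = b (suc (suc k))
  shift : ∀ i → a′ (suc i) ⊕ deriv a′ i ≡ deriv a (suc i)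
  shift i = trans (solve 2 (λ x m → x :+ m :* x := (con 1# :+ m) :* x) refl (a (suc (suc i))) (ι (fromℕ (suc i))))
    (cong (_⊗ a (suc (suc i))) (sym (ι-suc (suc i))))

-- This is z^k / k!, in a recursive form that makes the differential equation `deriv-expTerm`
-- immediate; `at-expTerm` links it to `expTerm`.
expTermℚᶜ : ℚᶜ → ℕ → ℚᶜ
expTermℚᶜ z zero    = 1#
expTermℚᶜ z (suc k) = ι (inv-suc k) ⊗ (z ⊗ expTermℚᶜ z k)

deriv-expTerm : ∀ z k → deriv (expTermℚᶜ z) k ≡ z ⊗ expTermℚᶜ z k
deriv-expTerm z k = begin
  ι (fromℕ (suc k)) ⊗ (ι (inv-suc k) ⊗ (z ⊗ expTermℚᶜ z k))
    ≡⟨ solve 3 (λ m i t → m :* (i :* t) := m :* i :* t) refl (ι (fromℕ (suc k))) (ι (inv-suc k)) (z ⊗ expTermℚᶜ z k) ⟩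
  ι (fromℕ (suc k)) ⊗ ι (inv-suc k) ⊗ (z ⊗ expTermℚᶜ z k)
    ≡⟨ cong (_⊗ (z ⊗ expTermℚᶜ z k)) (trans (ι-* (fromℕ (suc k)) (inv-suc k)) (cong ι (inv-r (fromℕ (suc k)) (0<fromℕ-suc k)))) ⟩
  1# ⊗ (z ⊗ expTermℚᶜ z k)
    ≡⟨ solve 1 (λ x → con 1# :* x := x) refl (z ⊗ expTermℚᶜ z k) ⟩
  z ⊗ expTermℚᶜ z k ∎
  where
  open ≡-Reasoning
  open ℚᶜ-Solver

-- Both sides satisfy (k + 1) c (k + 1) = (z + w) c k.
conv-expTerm : ∀ z w k → conv (expTermℚᶜ z) (expTermℚᶜ w) k ≡ expTermℚᶜ (z ⊕ w) k
conv-expTerm z w zero    = refl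
conv-expTerm z w (suc k) = begin
  c (suc k)
    ≡⟨ solve 1 (λ x → con 1# :* x := x) refl (c (suc k)) ⟨
  1# ⊗ c (suc k)
    ≡⟨ cong (_⊗ c (suc k)) (trans (ι-* (fromℕ (suc k)) (inv-suc k)) (cong ι (inv-r (fromℕ (suc k)) (0<fromℕ-suc k)))) ⟨
  ι (fromℕ (suc k)) ⊗ ι (inv-suc k) ⊗ c (suc k)
    ≡⟨ solve 3 (λ m i t → m :* i :* t := i :* (m :* t)) refl (ι (fromℕ (suc k))) (ι (inv-suc k)) (c (suc k)) ⟩
  ι (inv-suc k) ⊗ (ι (fromℕ (suc k)) ⊗ c (suc k))
    ≡⟨ cong (ι (inv-suc k) ⊗_) (leibniz (expTermℚᶜ z) (expTermℚᶜ w) k) ⟩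
  ι (inv-suc k) ⊗ (conv (deriv (expTermℚᶜ z)) (expTermℚᶜ w) k ⊕ conv (expTermℚᶜ z) (deriv (expTermℚᶜ w)) k)
    ≡⟨ cong (ι (inv-suc k) ⊗_) (cong₂ _⊕_
         (trans (conv-cong (deriv-expTerm z) (λ _ → refl) k) (conv-scaleˡ z (expTermℚᶜ z) (expTermℚᶜ w) k))
         (trans (conv-cong (λ _ → refl) (deriv-expTerm w) k) (conv-scaleʳ w (expTermℚᶜ z) (expTermℚᶜ w) k))) ⟩
  ι (inv-suc k) ⊗ (z ⊗ c k ⊕ w ⊗ c k)
    ≡⟨ cong (ι (inv-suc k) ⊗_) (solve 3 (λ z w c → z :* c :+ w :* c := (z :+ w) :* c) refl z w (c k)) ⟩
  ι (inv-suc k) ⊗ ((z ⊕ w) ⊗ c k)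
    ≡⟨ cong (λ t → ι (inv-suc k) ⊗ ((z ⊕ w) ⊗ t)) (conv-expTerm z w k) ⟩
  expTermℚᶜ (z ⊕ w) (suc k) ∎
  where
  open ≡-Reasoning
  open ℚᶜ-Solver
  c = conv (expTermℚᶜ z) (expTermℚᶜ w)

-- The sum of a i ⊗ b j over i + j < n.
triangle : (a b : ℕ → ℚᶜ) → ℕ → ℚᶜ
triangle a b zero    = 0#
triangle a b (suc n) = a 0 ⊗ ∑ᶜ b (suc n) ⊕ triangle (a ∘ suc) b n

triangle-suc : ∀ a b n → triangle a b (suc n) ≡ triangle a b n ⊕ conv a b n
triangle-suc a b zero = solve 2 (λ x y → x :* (con 0# :+ y) :+ con 0# := con 0# :+ x :* y) refl (a 0) (b 0)
  where open ℚᶜ-Solver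
triangle-suc a b (suc n) = trans (cong (a 0 ⊗ ∑ᶜ b (suc (suc n)) ⊕_) (triangle-suc (a ∘ suc) b n))
  (solve 5 (λ x y s t u → x :* (s :+ y) :+ (t :+ u) := (x :* s :+ t) :+ (x :* y :+ u)) refl
    (a 0) (b (suc n)) (∑ᶜ b (suc n)) (triangle (a ∘ suc) b n) (conv (a ∘ suc) b n))
  where open ℚᶜ-Solver

∑ᶜ-conv : ∀ a b n → ∑ᶜ (conv a b) n ≡ triangle a b n
∑ᶜ-conv a b zero    = refl
∑ᶜ-conv a b (suc n) = trans (cong (_⊕ conv a b n) (∑ᶜ-conv a b n)) (sym (triangle-suc a b n))

module _ {b : ℕ → ℚᶜ} {C : ℚ} (0≤C : ℚ.0ℚ ℚ.≤ C) (b≤ : ∀ k → ‖ b k ‖ ℚ.≤ C ℚ.* ½^ k) where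

  open ℚ.≤-Reasoning

  ∑ᶜ-tail : ∀ d n → ‖ ∑ᶜ b (d ℕ.+ n) ⊖ ∑ᶜ b n ‖ ℚ.+ fromℕ 2 ℚ.* C ℚ.* ½^ (d ℕ.+ n) ℚ.≤ fromℕ 2 ℚ.* C ℚ.* ½^ n
  ∑ᶜ-tail zero n = ℚ.≤-reflexive (trans
    (cong (λ z → ‖ z ‖ ℚ.+ fromℕ 2 ℚ.* C ℚ.* ½^ n) (CommutativeRing.-‿inverseʳ ℚᶜ-commutativeRing (∑ᶜ b n)))
    (ℚ.+-identityˡ (fromℕ 2 ℚ.* C ℚ.* ½^ n)))
  ∑ᶜ-tail (suc d) n = begin
    ‖ S ⊕ b k ⊖ ∑ᶜ b n ‖ ℚ.+ fromℕ 2 ℚ.* C ℚ.* (ℚ.½ ℚ.* ½^ k)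
      ≡⟨ cong (λ z → ‖ z ‖ ℚ.+ fromℕ 2 ℚ.* C ℚ.* (ℚ.½ ℚ.* ½^ k))
           (solveᶜ 3 (λ s t u → s ⊹ t ∸ u ≑ s ∸ u ⊹ t) refl S (b k) (∑ᶜ b n)) ⟩
    ‖ (S ⊖ ∑ᶜ b n) ⊕ b k ‖ ℚ.+ fromℕ 2 ℚ.* C ℚ.* (ℚ.½ ℚ.* ½^ k)
      ≤⟨ ℚ.+-monoˡ-≤ _ (‖⊕‖-mono (S ⊖ ∑ᶜ b n) (b k) ℚ.≤-refl (b≤ k)) ⟩
    ‖ S ⊖ ∑ᶜ b n ‖ ℚ.+ C ℚ.* ½^ k ℚ.+ fromℕ 2 ℚ.* C ℚ.* (ℚ.½ ℚ.* ½^ k)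
      ≡⟨ solve 3 (λ s c h → s :+ c :* h :+ con (fromℕ 2) :* c :* (con ℚ.½ :* h) := s :+ con (fromℕ 2) :* c :* h) refl ‖ S ⊖ ∑ᶜ b n ‖ C (½^ k) ⟩
    ‖ S ⊖ ∑ᶜ b n ‖ ℚ.+ fromℕ 2 ℚ.* C ℚ.* ½^ k
      ≤⟨ ∑ᶜ-tail d n ⟩
    fromℕ 2 ℚ.* C ℚ.* ½^ n ∎
    where
    open ℚ.+-*-Solver
    open ℚᶜ-Solver using () renaming (solve to solveᶜ; _:+_ to infixl 6 _⊹_; _:-_ to infixl 6 _∸_; _:=_ to infix 4 _≑_)
    k = d ℕ.+ n
    S = ∑ᶜ b k

  ∑ᶜ-tail′ : ∀ {m n} → n ℕ.≤ m → ‖ ∑ᶜ b m ⊖ ∑ᶜ b n ‖ ℚ.≤ fromℕ 2 ℚ.* C ℚ.* ½^ n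
  ∑ᶜ-tail′ {m} {n} n≤m = subst (λ m → ‖ ∑ᶜ b m ⊖ ∑ᶜ b n ‖ ℚ.≤ fromℕ 2 ℚ.* C ℚ.* ½^ n) (ℕ.m∸n+n≡m n≤m)
    (ℚ.≤-trans (p≤p+q ‖ ∑ᶜ b (m ℕ.∸ n ℕ.+ n) ⊖ ∑ᶜ b n ‖ (0≤* (0≤* (0≤fromℕ 2) 0≤C) (0≤½^ (m ℕ.∸ n ℕ.+ n)))) (∑ᶜ-tail (m ℕ.∸ n) n))

  -- Row i of the square misses the terms of b from index n - i on, of total norm at most 2 C / 2^(n
  -- - i). The decay 4^-i of a leaves 2 A C / 2^(n + i) for this row, and all rows together stay
  -- below 4 A C / 2^n; with decay 2^-i only, each row would count equally. In the induction,
  -- shifting a divides A by 4 while dropping a row merely doubles the power of ½.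
  square-triangle : ∀ a {A} m n → ℚ.0ℚ ℚ.≤ A → (∀ k → ‖ a k ‖ ℚ.≤ A ℚ.* (½^ k ℚ.* ½^ k)) → n ℕ.≤ m →
    ‖ ∑ᶜ a n ⊗ ∑ᶜ b m ⊖ triangle a b n ‖ ℚ.≤ fromℕ 4 ℚ.* A ℚ.* C ℚ.* ½^ n
  square-triangle a {A} m zero 0≤A a≤ n≤m = begin
    ‖ 0# ⊗ ∑ᶜ b m ⊖ 0# ‖ ≡⟨ vanishes (∑ᶜ b m) ⟩
    ℚ.0ℚ                ≤⟨ 0≤* (0≤* (0≤* (0≤fromℕ 4) 0≤A) 0≤C) 0≤1 ⟩
    fromℕ 4 ℚ.* A ℚ.* C ℚ.* ℚ.1ℚ ∎
    where
    open ℚᶜ-Solver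
    vanishes : ∀ z → ‖ 0# ⊗ z ⊖ 0# ‖ ≡ ℚ.0ℚ
    vanishes z = cong ‖_‖ {0# ⊗ z ⊖ 0#} {0#} (solve 1 (λ x → con 0# :* x :- con 0# := con 0#) refl z)
  square-triangle a {A} m (suc n) 0≤A a≤ n<m = begin
    ‖ ∑ᶜ a (suc n) ⊗ B ⊖ triangle a b (suc n) ‖
      ≡⟨ cong (λ s → ‖ s ⊗ B ⊖ triangle a b (suc n) ‖) (∑ᶜ-front a n) ⟩
    ‖ (a 0 ⊕ ∑ᶜ a′ n) ⊗ B ⊖ (a 0 ⊗ Bₙ ⊕ triangle a′ b n) ‖
      ≡⟨ cong ‖_‖ (solveᶜ 5 (λ x s B B′ t → (x ⊹ s) ⊛ B ∸ (x ⊛ B′ ⊹ t) ≑ x ⊛ (B ∸ B′) ⊹ (s ⊛ B ∸ t)) refl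
           (a 0) (∑ᶜ a′ n) B Bₙ (triangle a′ b n)) ⟩
    ‖ a 0 ⊗ (B ⊖ Bₙ) ⊕ (∑ᶜ a′ n ⊗ B ⊖ triangle a′ b n) ‖
      ≤⟨ ‖⊕‖-mono (a 0 ⊗ (B ⊖ Bₙ)) (∑ᶜ a′ n ⊗ B ⊖ triangle a′ b n)
           (‖⊗‖-mono (a 0) (B ⊖ Bₙ) (a≤ 0) (∑ᶜ-tail′ n<m))
           (square-triangle a′ m n (0≤* (ℚ.<⇒≤ (ℚ.positive⁻¹ (+ 1 ℚ./ 4))) 0≤A) a′≤ (ℕ.≤-trans (ℕ.n≤1+n n) n<m)) ⟩
    A ℚ.* (ℚ.1ℚ ℚ.* ℚ.1ℚ) ℚ.* (fromℕ 2 ℚ.* C ℚ.* (ℚ.½ ℚ.* ½^ n)) ℚ.+ fromℕ 4 ℚ.* (+ 1 ℚ./ 4 ℚ.* A) ℚ.* C ℚ.* ½^ n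
      ≡⟨ solve 3 (λ a c h → a :* (con ℚ.1ℚ :* con ℚ.1ℚ) :* (con (fromℕ 2) :* c :* (con ℚ.½ :* h)) :+ con (fromℕ 4) :* (con (+ 1 ℚ./ 4) :* a) :* c :* h
           := con (fromℕ 4) :* a :* c :* (con ℚ.½ :* h)) refl A C (½^ n) ⟩
    fromℕ 4 ℚ.* A ℚ.* C ℚ.* (ℚ.½ ℚ.* ½^ n) ∎
    where
    open ℚ.+-*-Solver
    open ℚᶜ-Solver using () renaming (solve to solveᶜ; _:+_ to infixl 6 _⊹_; _:-_ to infixl 6 _∸_; _:*_ to infixl 7 _⊛_; _:=_ to infix 4 _≑_)
    a′ = a ∘ suc
    B = ∑ᶜ b m
    Bₙ = ∑ᶜ b (suc n)
    a′≤ : ∀ k → ‖ a (suc k) ‖ ℚ.≤ (+ 1 ℚ./ 4 ℚ.* A) ℚ.* (½^ k ℚ.* ½^ k)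
    a′≤ k = ℚ.≤-trans (a≤ (suc k)) (ℚ.≤-reflexive
      (solve 2 (λ a h → a :* (con ℚ.½ :* h :* (con ℚ.½ :* h)) := con (+ 1 ℚ./ 4) :* a :* (h :* h)) refl A (½^ k)))

-- Majorants

-- The sequence B^k / k!, by the same recursion as `expTermℚᶜ`.
majorant : ℕ → ℕ → ℚ
majorant B zero    = ℚ.1ℚ
majorant B (suc k) = inv-suc k ℚ.* (fromℕ B ℚ.* majorant B k)

0≤majorant : ∀ B k → ℚ.0ℚ ℚ.≤ majorant B k
0≤majorant B zero    = 0≤1
0≤majorant B (suc k) = 0≤* (ℚ.<⇒≤ (inv-suc-pos k)) (0≤* (0≤fromℕ B) (0≤majorant B k))

‖expTerm‖≤majorant : ∀ B z → ‖ z ‖ ℚ.≤ fromℕ B → ∀ k → ‖ expTermℚᶜ z k ‖ ℚ.≤ majorant B k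
‖expTerm‖≤majorant B z z≤B zero    = ℚ.≤-refl
‖expTerm‖≤majorant B z z≤B (suc k) = ‖⊗‖-mono (ι (inv-suc k)) (z ⊗ expTermℚᶜ z k) (ℚ.≤-reflexive (‖ι‖ (ℚ.<⇒≤ (inv-suc-pos k))))
  (‖⊗‖-mono z (expTermℚᶜ z k) z≤B (‖expTerm‖≤majorant B z z≤B k))

majorant-decreasing : ∀ B k → B ℕ.≤ suc k → majorant B (suc k) ℚ.≤ majorant B k
majorant-decreasing B k B≤1+k = begin
  inv-suc k ℚ.* (fromℕ B ℚ.* majorant B k)
    ≤⟨ *-monoˡ (ℚ.<⇒≤ (inv-suc-pos k)) (*-monoʳ (0≤majorant B k) (fromℕ-mono B≤1+k)) ⟩
  inv-suc k ℚ.* (fromℕ (suc k) ℚ.* majorant B k)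
    ≡⟨ solve 3 (λ i m b → i :* (m :* b) := m :* i :* b) refl (inv-suc k) (fromℕ (suc k)) (majorant B k) ⟩
  fromℕ (suc k) ℚ.* inv-suc k ℚ.* majorant B k
    ≡⟨ trans (cong (ℚ._* majorant B k) (inv-r (fromℕ (suc k)) (0<fromℕ-suc k))) (ℚ.*-identityˡ (majorant B k)) ⟩
  majorant B k ∎
  where
  open ℚ.≤-Reasoning
  open ℚ.+-*-Solver

abstract
  -- Once k + 1 reaches B the sequence stops growing, so the maximum over the indices up to B bounds
  -- all of it.
  majorant-bounded : ∀ B → ∃[ C ] (∀ k → majorant B k ℚ.≤ fromℕ C)
  majorant-bounded B = C , λ k → ℚ.≤-trans (majorant≤M k) (proj₂ (∃fromℕ≥ M))
    where
    M : ℚ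
    M = proj₁ (CauchyLemmas.max-prefix (majorant B) B)
    C : ℕ
    C = proj₁ (∃fromℕ≥ M)
    majorant≤M : ∀ k → majorant B k ℚ.≤ M
    majorant≤M zero = ℚ.≤-trans (p≤∣p∣ ℚ.1ℚ) (proj₂ (CauchyLemmas.max-prefix (majorant B) B) 0 ℕ.z≤n)
    majorant≤M (suc k) with ℕ.≤-total B (suc k)
    ... | inj₁ B≤1+k = ℚ.≤-trans (majorant-decreasing B k B≤1+k) (majorant≤M k)
    ... | inj₂ 1+k≤B = ℚ.≤-trans (p≤∣p∣ (majorant B (suc k))) (proj₂ (CauchyLemmas.max-prefix (majorant B) B) (suc k) 1+k≤B)

-- Turns boundedness into geometric decay: (4 B)^k / k! is bounded, so B^k / k! decays like 4^-k.
-- This is the rate that `square-triangle` requires of one factor.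
majorant-rescale : ∀ B k → majorant B k ≡ majorant (4 ℕ.* B) k ℚ.* (½^ k ℚ.* ½^ k)
majorant-rescale B zero    = refl
majorant-rescale B (suc k) = begin
  inv-suc k ℚ.* (fromℕ B ℚ.* majorant B k)
    ≡⟨ cong (λ t → inv-suc k ℚ.* (fromℕ B ℚ.* t)) (majorant-rescale B k) ⟩
  inv-suc k ℚ.* (fromℕ B ℚ.* (majorant (4 ℕ.* B) k ℚ.* (½^ k ℚ.* ½^ k)))
    ≡⟨ solve 4 (λ i b c h → i :* (b :* (c :* (h :* h))) := i :* (con (fromℕ 4) :* b :* c) :* (con ℚ.½ :* h :* (con ℚ.½ :* h))) refl
         (inv-suc k) (fromℕ B) (majorant (4 ℕ.* B) k) (½^ k) ⟩
  inv-suc k ℚ.* (fromℕ 4 ℚ.* fromℕ B ℚ.* majorant (4 ℕ.* B) k) ℚ.* (½^ (suc k) ℚ.* ½^ (suc k))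
    ≡⟨ cong (λ b → inv-suc k ℚ.* (b ℚ.* majorant (4 ℕ.* B) k) ℚ.* (½^ (suc k) ℚ.* ½^ (suc k))) (fromℕ-* 4 B) ⟩
  majorant (4 ℕ.* B) (suc k) ℚ.* (½^ (suc k) ℚ.* ½^ (suc k)) ∎
  where
  open ≡-Reasoning
  open ℚ.+-*-Solver

majorantBound : ℕ → ℕ
majorantBound B = proj₁ (majorant-bounded (4 ℕ.* B))

majorant≤¼^ : ∀ B k → majorant B k ℚ.≤ fromℕ (majorantBound B) ℚ.* (½^ k ℚ.* ½^ k)
majorant≤¼^ B k = ℚ.≤-trans (ℚ.≤-reflexive (majorant-rescale B k))
  (*-monoʳ (0≤* (0≤½^ k) (0≤½^ k)) (proj₂ (majorant-bounded (4 ℕ.* B)) k))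

½^≤1 : ∀ n → ½^ n ℚ.≤ ℚ.1ℚ
½^≤1 n = subst (λ m → ½^ m ℚ.≤ ℚ.1ℚ) (ℕ.+-identityʳ n) (½^-anti n 0)

majorant≤½^ : ∀ B k → majorant B k ℚ.≤ fromℕ (majorantBound B) ℚ.* ½^ k
majorant≤½^ B k = ℚ.≤-trans (majorant≤¼^ B k) (*-monoˡ (0≤fromℕ (majorantBound B))
  (ℚ.≤-trans (*-monoˡ (0≤½^ k) (½^≤1 k)) (ℚ.≤-reflexive (ℚ.*-identityʳ (½^ k)))))

-- Partial sums of the exponential series

expSumℚᶜ : ℕ → ℚᶜ → ℚᶜ
expSumℚᶜ n z = ∑ᶜ (expTermℚᶜ z) n

expSum-* : ∀ B z w → ‖ z ‖ ℚ.≤ fromℕ B → ‖ w ‖ ℚ.≤ fromℕ B → ∀ n →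
  ‖ expSumℚᶜ n z ⊗ expSumℚᶜ n w ⊖ expSumℚᶜ n (z ⊕ w) ‖ ℚ.≤ fromℕ (4 ℕ.* majorantBound B ℕ.* majorantBound B) ℚ.* ½^ n
expSum-* B z w z≤B w≤B n = begin
  ‖ expSumℚᶜ n z ⊗ expSumℚᶜ n w ⊖ expSumℚᶜ n (z ⊕ w) ‖
    ≡⟨ cong (λ t → ‖ expSumℚᶜ n z ⊗ expSumℚᶜ n w ⊖ t ‖) (trans (sym (∑ᶜ-cong (conv-expTerm z w) n)) (∑ᶜ-conv (expTermℚᶜ z) (expTermℚᶜ w) n)) ⟩
  ‖ expSumℚᶜ n z ⊗ expSumℚᶜ n w ⊖ triangle (expTermℚᶜ z) (expTermℚᶜ w) n ‖
    ≤⟨ square-triangle (0≤fromℕ (majorantBound B)) (λ k → ℚ.≤-trans (‖expTerm‖≤majorant B w w≤B k) (majorant≤½^ B k)) (expTermℚᶜ z) n n (0≤fromℕ (majorantBound B))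
         (λ k → ℚ.≤-trans (‖expTerm‖≤majorant B z z≤B k) (majorant≤¼^ B k)) ℕ.≤-refl ⟩
  fromℕ 4 ℚ.* fromℕ (majorantBound B) ℚ.* fromℕ (majorantBound B) ℚ.* ½^ n
    ≡⟨ cong (ℚ._* ½^ n) (trans (cong (ℚ._* fromℕ (majorantBound B)) (fromℕ-* 4 (majorantBound B))) (fromℕ-* (4 ℕ.* majorantBound B) (majorantBound B))) ⟩
  fromℕ (4 ℕ.* majorantBound B ℕ.* majorantBound B) ℚ.* ½^ n ∎
  where open ℚ.≤-Reasoning

module _ B z w (z≤B : ‖ z ‖ ℚ.≤ fromℕ B) (w≤B : ‖ w ‖ ℚ.≤ fromℕ B) where

  open ℚ.≤-Reasoning

  private
    δ = ‖ z ⊖ w ‖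

  -- The mean value inequality for z^(k + 1) / (k + 1)!. In z t - w u = (z - w) t + w (t - u) the
  -- first summand contributes one copy of B^k / k! times δ and, by induction, the second
  -- contributes k copies; the factor 1 / (k + 1) cancels their number.
  expTerm-lipschitz : ∀ k → ‖ expTermℚᶜ z (suc k) ⊖ expTermℚᶜ w (suc k) ‖ ℚ.≤ majorant B k ℚ.* δ
  expTerm-lipschitz zero = ℚ.≤-reflexive (trans
    (cong ‖_‖ (solve 2 (λ z w → con 1# :* (z :* con 1#) :- con 1# :* (w :* con 1#) := z :- w) refl z w))
    (sym (ℚ.*-identityˡ δ)))
    where open ℚᶜ-Solver
  expTerm-lipschitz (suc j) = begin
    ‖ i ⊗ (z ⊗ expTermℚᶜ z k) ⊖ i ⊗ (w ⊗ expTermℚᶜ w k) ‖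
      ≡⟨ cong ‖_‖ (solveᶜ 5 (λ i z w t u → i ⊛ (z ⊛ t) ∸ i ⊛ (w ⊛ u) ≑ i ⊛ ((z ∸ w) ⊛ t ⊹ w ⊛ (t ∸ u))) refl i z w (expTermℚᶜ z k) (expTermℚᶜ w k)) ⟩
    ‖ i ⊗ ((z ⊖ w) ⊗ expTermℚᶜ z k ⊕ w ⊗ (expTermℚᶜ z k ⊖ expTermℚᶜ w k)) ‖
      ≤⟨ ‖⊗‖-mono i ((z ⊖ w) ⊗ expTermℚᶜ z k ⊕ w ⊗ (expTermℚᶜ z k ⊖ expTermℚᶜ w k)) (ℚ.≤-reflexive (‖ι‖ (ℚ.<⇒≤ (inv-suc-pos k))))
           (‖⊕‖-mono ((z ⊖ w) ⊗ expTermℚᶜ z k) (w ⊗ (expTermℚᶜ z k ⊖ expTermℚᶜ w k))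
             (‖⊗‖-mono (z ⊖ w) (expTermℚᶜ z k) ℚ.≤-refl (‖expTerm‖≤majorant B z z≤B k))
             (‖⊗‖-mono w (expTermℚᶜ z k ⊖ expTermℚᶜ w k) w≤B (expTerm-lipschitz j))) ⟩
    inv-suc k ℚ.* (δ ℚ.* majorant B k ℚ.+ fromℕ B ℚ.* (majorant B j ℚ.* δ))
      ≡⟨ cong (λ t → inv-suc k ℚ.* (δ ℚ.* majorant B k ℚ.+ t)) recurrence ⟩
    inv-suc k ℚ.* (δ ℚ.* majorant B k ℚ.+ fromℕ k ℚ.* (majorant B k ℚ.* δ))
      ≡⟨ solve 4 (λ i d b k → i :* (d :* b :+ k :* (b :* d)) := (con ℚ.1ℚ :+ k) :* i :* (b :* d)) refl (inv-suc k) δ (majorant B k) (fromℕ k) ⟩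
    (ℚ.1ℚ ℚ.+ fromℕ k) ℚ.* inv-suc k ℚ.* (majorant B k ℚ.* δ)
      ≡⟨ cong (ℚ._* (majorant B k ℚ.* δ)) (trans (cong (ℚ._* inv-suc k) (sym (fromℕ-suc k))) (inv-r (fromℕ (suc k)) (0<fromℕ-suc k))) ⟩
    ℚ.1ℚ ℚ.* (majorant B k ℚ.* δ)
      ≡⟨ ℚ.*-identityˡ (majorant B k ℚ.* δ) ⟩
    majorant B k ℚ.* δ ∎
    where
    open ℚ.+-*-Solver
    open ℚᶜ-Solver using () renaming (solve to solveᶜ; _:+_ to infixl 6 _⊹_; _:-_ to infixl 6 _∸_; _:*_ to infixl 7 _⊛_; _:=_ to infix 4 _≑_)
    k = suc j
    i = ι (inv-suc k)
    recurrence : fromℕ B ℚ.* (majorant B j ℚ.* δ) ≡ fromℕ k ℚ.* (majorant B k ℚ.* δ)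
    recurrence = trans (sym (ℚ.*-identityˡ _)) (trans
      (cong (ℚ._* (fromℕ B ℚ.* (majorant B j ℚ.* δ))) (sym (inv-r (fromℕ (suc j)) (0<fromℕ-suc j))))
      (solve 5 (λ m i b c d → m :* i :* (b :* (c :* d)) := m :* (i :* (b :* c) :* d)) refl
        (fromℕ (suc j)) (inv-suc j) (fromℕ B) (majorant B j) δ))

  expSum-lipschitz : ∀ n → ‖ expSumℚᶜ n z ⊖ expSumℚᶜ n w ‖ ℚ.≤ fromℕ (2 ℕ.* majorantBound B) ℚ.* δ
  expSum-lipschitz n = ℚ.≤-trans (go n) (*-monoʳ (0≤‖‖ (z ⊖ w)) (ℚ.≤-reflexive (fromℕ-* 2 (majorantBound B))))
    where
    open ℚ.+-*-Solver
    open ℚᶜ-Solver using () renaming (solve to solveᶜ; _:+_ to infixl 6 _⊹_; _:-_ to infixl 6 _∸_; _:=_ to infix 4 _≑_)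
    K = fromℕ (majorantBound B)
    -- The constant terms cancel, so the estimate starts after one term, and the n-th bound belongs
    -- to term n + 1. The second summand on the left is the allowance for the terms still to come.
    shifted : ∀ n → ‖ expSumℚᶜ (suc n) z ⊖ expSumℚᶜ (suc n) w ‖ ℚ.+ fromℕ 2 ℚ.* K ℚ.* ½^ n ℚ.* δ ℚ.≤ fromℕ 2 ℚ.* K ℚ.* δ
    shifted zero = ℚ.≤-reflexive (solve 2 (λ k d → con ℚ.0ℚ :+ con (fromℕ 2) :* k :* con ℚ.1ℚ :* d := con (fromℕ 2) :* k :* d) refl K δ)
    shifted (suc n) = begin
      ‖ Pz ⊕ expTermℚᶜ z (suc n) ⊖ (Pw ⊕ expTermℚᶜ w (suc n)) ‖ ℚ.+ fromℕ 2 ℚ.* K ℚ.* (ℚ.½ ℚ.* ½^ n) ℚ.* δ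
        ≡⟨ cong (λ t → ‖ t ‖ ℚ.+ fromℕ 2 ℚ.* K ℚ.* (ℚ.½ ℚ.* ½^ n) ℚ.* δ)
             (solveᶜ 4 (λ p t q u → p ⊹ t ∸ (q ⊹ u) ≑ p ∸ q ⊹ (t ∸ u)) refl Pz (expTermℚᶜ z (suc n)) Pw (expTermℚᶜ w (suc n))) ⟩
      ‖ (Pz ⊖ Pw) ⊕ (expTermℚᶜ z (suc n) ⊖ expTermℚᶜ w (suc n)) ‖ ℚ.+ fromℕ 2 ℚ.* K ℚ.* (ℚ.½ ℚ.* ½^ n) ℚ.* δ
        ≤⟨ ℚ.+-monoˡ-≤ _ (‖⊕‖-mono (Pz ⊖ Pw) (expTermℚᶜ z (suc n) ⊖ expTermℚᶜ w (suc n)) ℚ.≤-refl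
             (ℚ.≤-trans (expTerm-lipschitz n) (*-monoʳ (0≤‖‖ (z ⊖ w)) (majorant≤½^ B n)))) ⟩
      ‖ Pz ⊖ Pw ‖ ℚ.+ K ℚ.* ½^ n ℚ.* δ ℚ.+ fromℕ 2 ℚ.* K ℚ.* (ℚ.½ ℚ.* ½^ n) ℚ.* δ
        ≡⟨ solve 4 (λ p k h d → p :+ k :* h :* d :+ con (fromℕ 2) :* k :* (con ℚ.½ :* h) :* d := p :+ con (fromℕ 2) :* k :* h :* d) refl
             ‖ Pz ⊖ Pw ‖ K (½^ n) δ ⟩
      ‖ Pz ⊖ Pw ‖ ℚ.+ fromℕ 2 ℚ.* K ℚ.* ½^ n ℚ.* δ
        ≤⟨ shifted n ⟩
      fromℕ 2 ℚ.* K ℚ.* δ ∎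
      where
      Pz = expSumℚᶜ (suc n) z
      Pw = expSumℚᶜ (suc n) w
    go : ∀ n → ‖ expSumℚᶜ n z ⊖ expSumℚᶜ n w ‖ ℚ.≤ fromℕ 2 ℚ.* K ℚ.* δ
    go zero    = 0≤* (0≤* (0≤fromℕ 2) (0≤fromℕ (majorantBound B))) (0≤‖‖ (z ⊖ w))
    go (suc n) = ℚ.≤-trans (p≤p+q _ (0≤* (0≤* (0≤* (0≤fromℕ 2) (0≤fromℕ (majorantBound B))) (0≤½^ n)) (0≤‖‖ (z ⊖ w)))) (shifted n)

conj-⊗ : ∀ z w → conj (z ⊗ w) ≡ conj z ⊗ conj w
conj-⊗ (a , b) (c , d) = cong₂ _,_
  (solve 4 (λ a b c d → a :* c :- b :* d := a :* c :- (:- b) :* (:- d)) refl a b c d)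
  (solve 4 (λ a b c d → :- (a :* d :+ b :* c) := a :* (:- d) :+ (:- b) :* c) refl a b c d)
  where open ℚ.+-*-Solver

expTerm-conj : ∀ z k → expTermℚᶜ (conj z) k ≡ conj (expTermℚᶜ z k)
expTerm-conj z zero    = refl
expTerm-conj z (suc k) = begin
  ι (inv-suc k) ⊗ (conj z ⊗ expTermℚᶜ (conj z) k)         ≡⟨ cong (λ t → ι (inv-suc k) ⊗ (conj z ⊗ t)) (expTerm-conj z k) ⟩
  conj (ι (inv-suc k)) ⊗ (conj z ⊗ conj (expTermℚᶜ z k))  ≡⟨ cong (conj (ι (inv-suc k)) ⊗_) (conj-⊗ z (expTermℚᶜ z k)) ⟨
  conj (ι (inv-suc k)) ⊗ conj (z ⊗ expTermℚᶜ z k)         ≡⟨ conj-⊗ (ι (inv-suc k)) (z ⊗ expTermℚᶜ z k) ⟨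
  conj (expTermℚᶜ z (suc k))                              ∎
  where open ≡-Reasoning

expSum-conj : ∀ n z → expSumℚᶜ n (conj z) ≡ conj (expSumℚᶜ n z)
expSum-conj zero    z = refl
expSum-conj (suc n) z = trans (cong₂ _⊕_ (expSum-conj n z) (expTerm-conj z n))
  (cong₂ _,_ refl (sym (ℚ.neg-distrib-+ (proj₂ (expSumℚᶜ n z)) (proj₂ (expTermℚᶜ z n)))))

expSum-0 : ∀ n → expSumℚᶜ (suc n) 0# ≡ 1#
expSum-0 zero    = refl
expSum-0 (suc n) = trans (cong₂ _⊕_ (expSum-0 n) (solve 2 (λ i t → i :* (con 0# :* t) := con 0#) refl (ι (inv-suc n)) (expTermℚᶜ 0# n))) refl
  where open ℚᶜ-Solver

-- Passage to the complex exponential function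

at : ℂ → ℕ → ℚᶜ
at z j = seq (re z) j , seq (im z) j

at-expTerm : ∀ z k j → at (expTerm z k) j ≡ expTermℚᶜ (at z j) k
at-expTerm z zero    j = refl
at-expTerm z (suc k) j = begin
  (f′ ℚ.* (a ℚ.* p ℚ.- b ℚ.* q) , f′ ℚ.* (a ℚ.* q ℚ.+ b ℚ.* p))
    ≡⟨ cong (λ f → f ℚ.* (a ℚ.* p ℚ.- b ℚ.* q) , f ℚ.* (a ℚ.* q ℚ.+ b ℚ.* p)) step ⟩
  (i ℚ.* f ℚ.* (a ℚ.* p ℚ.- b ℚ.* q) , i ℚ.* f ℚ.* (a ℚ.* q ℚ.+ b ℚ.* p))
    ≡⟨ cong₂ _,_
         (solve 6 (λ i f a b p q → i :* f :* (a :* p :- b :* q) :=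
            i :* (a :* (f :* p) :- b :* (f :* q)) :- con ℚ.0ℚ :* (a :* (f :* q) :+ b :* (f :* p))) refl i f a b p q)
         (solve 6 (λ i f a b p q → i :* f :* (a :* q :+ b :* p) :=
            i :* (a :* (f :* q) :+ b :* (f :* p)) :+ con ℚ.0ℚ :* (a :* (f :* p) :- b :* (f :* q))) refl i f a b p q) ⟩
  ι i ⊗ (at z j ⊗ at (expTerm z k) j)
    ≡⟨ cong (λ t → ι i ⊗ (at z j ⊗ t)) (at-expTerm z k j) ⟩
  expTermℚᶜ (at z j) (suc k) ∎
  where
  open ≡-Reasoning
  open ℚ.+-*-Solver
  a = seq (re z) j
  b = seq (im z) j
  p = seq (re (z ^ᶜ k)) j
  q = seq (im (z ^ᶜ k)) j
  f = ExpLemmas.1/! k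
  f′ = ExpLemmas.1/! (suc k)
  i = inv-suc k
  step : f′ ≡ i ℚ.* f
  step = begin
    f′                                ≡⟨ ℚ.*-identityˡ f′ ⟨
    ℚ.1ℚ ℚ.* f′                       ≡⟨ cong (ℚ._* f′) (inv-r (fromℕ (suc k)) (0<fromℕ-suc k)) ⟨
    fromℕ (suc k) ℚ.* i ℚ.* f′        ≡⟨ solve 3 (λ m i f → m :* i :* f := i :* (m :* f)) refl (fromℕ (suc k)) i f′ ⟩
    i ℚ.* (fromℕ (suc k) ℚ.* f′)      ≡⟨ cong (i ℚ.*_) (ExpLemmas.1/!-suc k) ⟨
    i ℚ.* f                           ∎

expSum : ℂ → ℕ → ℂ
expSum z n = partialSum (λ k → re (expTerm z k)) n +i partialSum (λ k → im (expTerm z k)) n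

at-expSum : ∀ z n j → at (expSum z n) j ≡ expSumℚᶜ n (at z j)
at-expSum z zero    j = refl
at-expSum z (suc n) j = cong₂ _⊕_ (at-expSum z n j) (at-expTerm z n j)

re-exp-converges : ∀ z → Converges (λ n → re (expSum z n)) (re (exp z))
re-exp-converges z = lim-converges _ (ExpLemmas.re-cauchy z)

im-exp-converges : ∀ z → Converges (λ n → im (expSum z n)) (im (exp z))
im-exp-converges z = lim-converges _ (ExpLemmas.im-cauchy z)

∣re∣≤‖‖ : ∀ z → ℚ.∣ proj₁ z ∣ ℚ.≤ ‖ z ‖
∣re∣≤‖‖ (a , b) = p≤p+q ℚ.∣ a ∣ (ℚ.0≤∣p∣ b)

∣im∣≤‖‖ : ∀ z → ℚ.∣ proj₂ z ∣ ℚ.≤ ‖ z ‖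
∣im∣≤‖‖ (a , b) = ℚ.≤-trans (p≤p+q ℚ.∣ b ∣ (ℚ.0≤∣p∣ a)) (ℚ.≤-reflexive (ℚ.+-comm ℚ.∣ b ∣ ℚ.∣ a ∣))

abstract
  ∃‖at‖≤ : ∀ z → ∃[ B ] (∀ j → ‖ at z j ‖ ℚ.≤ fromℕ B)
  ∃‖at‖≤ z = proj₁ (∃bound (re z)) ℕ.+ proj₁ (∃bound (im z)) , λ j →
    ℚ.≤-trans (ℚ.+-mono-≤ (proj₂ (∃bound (re z)) j) (proj₂ (∃bound (im z)) j))
      (ℚ.≤-reflexive (fromℤ-+ (+ proj₁ (∃bound (re z))) (+ proj₁ (∃bound (im z)))))

-- One geometric bound on the defect of the n-th partial sums holds at all approximation indices,
-- because B bounds all approximants of z and w at once. It is thus a bound between reals for each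
-- n, and it vanishes in the limit.
exp-+ : ∀ z w → exp (z +ᶜ w) ≈ᶜ (exp z *ᶜ exp w)
exp-+ z w =
    ≈-sym (converges-unique
      (converges-+ (converges-* (re-exp-converges z) (re-exp-converges w))
        (converges-neg (converges-* (im-exp-converges z) (im-exp-converges w))))
      (re-exp-converges (z +ᶜ w))
      (λ ε 0<ε → map₁ (λ n small → pointwise⇒≤ λ j →
        ℚ.≤-trans (∣re∣≤‖‖ (at (expSum z n *ᶜ expSum w n) j ⊖ at (expSum (z +ᶜ w) n) j)) (ℚ.≤-trans (close n j) small))
        (geometric-small K ε 0<ε)))
  , ≈-sym (converges-unique
      (converges-+ (converges-* (re-exp-converges z) (im-exp-converges w))
        (converges-* (im-exp-converges z) (re-exp-converges w)))
      (im-exp-converges (z +ᶜ w))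
      (λ ε 0<ε → map₁ (λ n small → pointwise⇒≤ λ j →
        ℚ.≤-trans (∣im∣≤‖‖ (at (expSum z n *ᶜ expSum w n) j ⊖ at (expSum (z +ᶜ w) n) j)) (ℚ.≤-trans (close n j) small))
        (geometric-small K ε 0<ε)))
  where
  B = proj₁ (∃‖at‖≤ z) ℕ.+ proj₁ (∃‖at‖≤ w)
  K = 4 ℕ.* majorantBound B ℕ.* majorantBound B
  close : ∀ n j → ‖ at (expSum z n) j ⊗ at (expSum w n) j ⊖ at (expSum (z +ᶜ w) n) j ‖ ℚ.≤ fromℕ K ℚ.* ½^ n
  close n j = ℚ.≤-trans
    (ℚ.≤-reflexive (cong ‖_‖ (cong₂ _⊖_ (cong₂ _⊗_ (at-expSum z n j) (at-expSum w n j)) (at-expSum (z +ᶜ w) n j))))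
    (expSum-* B (at z j) (at w j)
      (ℚ.≤-trans (proj₂ (∃‖at‖≤ z) j) (fromℕ-mono (ℕ.m≤m+n (proj₁ (∃‖at‖≤ z)) (proj₁ (∃‖at‖≤ w)))))
      (ℚ.≤-trans (proj₂ (∃‖at‖≤ w) j) (fromℕ-mono (ℕ.m≤n+m (proj₁ (∃‖at‖≤ w)) (proj₁ (∃‖at‖≤ z))))) n)

dist₁ : ℂ → ℂ → ℝ
dist₁ z w = ∣ re z - re w ∣ + ∣ im z - im w ∣

module _ B z w (z≤B : Eventually (λ j → ‖ at z j ‖ ℚ.≤ fromℕ B)) (w≤B : Eventually (λ j → ‖ at w j ‖ ℚ.≤ fromℕ B)) where

  private
    K = 2 ℕ.* majorantBound B

    close : ∀ n → Eventually λ j → ‖ at (expSum z n) j ⊖ at (expSum w n) j ‖ ℚ.≤ fromℕ K ℚ.* seq (dist₁ z w) j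
    close n = map₂ (λ j p q → subst₂ (λ s t → ‖ s ⊖ t ‖ ℚ.≤ fromℕ K ℚ.* seq (dist₁ z w) j)
      (sym (at-expSum z n j)) (sym (at-expSum w n j)) (expSum-lipschitz B (at z j) (at w j) p q n)) z≤B w≤B

  -- The constant does not depend on n and so survives the limit. Bounds on late approximants
  -- suffice as input, which is all that an inequality between reals can provide.
  re-exp-lipschitz : ∣ re (exp z) - re (exp w) ∣ ≤ fromℚ (fromℕ K) * dist₁ z w
  re-exp-lipschitz = converges-dist (re-exp-converges z) (re-exp-converges w) (0 , λ n _ → eventually⇒≤ (map₁
    (λ j → ℚ.≤-trans (∣re∣≤‖‖ (at (expSum z n) j ⊖ at (expSum w n) j))) (close n)))

  im-exp-lipschitz : ∣ im (exp z) - im (exp w) ∣ ≤ fromℚ (fromℕ K) * dist₁ z w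
  im-exp-lipschitz = converges-dist (im-exp-converges z) (im-exp-converges w) (0 , λ n _ → eventually⇒≤ (map₁
    (λ j → ℚ.≤-trans (∣im∣≤‖‖ (at (expSum z n) j ⊖ at (expSum w n) j))) (close n)))

x≈y⇒∣x-y∣≈0 : ∀ {x y} → x ≈ y → ∣ x - y ∣ ≈ 0ℝ
x≈y⇒∣x-y∣≈0 {x} {y} x≈y = ≈-trans (∣∣-cong (≈-trans (+-congʳ x≈y) (-‿inverseʳ y))) (0≤x⇒∣x∣≈x ≤-refl)

∣x-y∣≤0⇒x≈y : ∀ {x y} → ∣ x - y ∣ ≤ 0ℝ → x ≈ y
∣x-y∣≤0⇒x≈y h = ∣x-y∣≤ε⇒x≈y λ ε 0<ε → ≤-trans h (fromℚ-mono (ℚ.<⇒≤ 0<ε))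

-- Different Cauchy sequences may represent the same number, so congruence needs an argument: the
-- Lipschitz bounds at distance zero.
exp-cong : ∀ {z w} → z ≈ᶜ w → exp z ≈ᶜ exp w
exp-cong {z} {w} (re≈ , im≈) =
    ∣x-y∣≤0⇒x≈y (≤-trans (re-exp-lipschitz B z w z≤B w≤B) vanishes)
  , ∣x-y∣≤0⇒x≈y (≤-trans (im-exp-lipschitz B z w z≤B w≤B) vanishes)
  where
  B = proj₁ (∃‖at‖≤ z) ℕ.+ proj₁ (∃‖at‖≤ w)
  z≤B : Eventually (λ j → ‖ at z j ‖ ℚ.≤ fromℕ B)
  z≤B = 0 , λ j _ → ℚ.≤-trans (proj₂ (∃‖at‖≤ z) j) (fromℕ-mono (ℕ.m≤m+n (proj₁ (∃‖at‖≤ z)) (proj₁ (∃‖at‖≤ w))))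
  w≤B : Eventually (λ j → ‖ at w j ‖ ℚ.≤ fromℕ B)
  w≤B = 0 , λ j _ → ℚ.≤-trans (proj₂ (∃‖at‖≤ w) j) (fromℕ-mono (ℕ.m≤n+m (proj₁ (∃‖at‖≤ w)) (proj₁ (∃‖at‖≤ z))))
  vanishes : ∀ {k} → fromℚ k * dist₁ z w ≤ 0ℝ
  vanishes {k} = ≈⇒≤ (≈-trans (*-congˡ (+-cong (x≈y⇒∣x-y∣≈0 re≈) (x≈y⇒∣x-y∣≈0 im≈)))
    (solve 1 (λ k → k :* (con ℚ.0ℚ :+ con ℚ.0ℚ) := con ℚ.0ℚ) ≈-refl (fromℚ k)))
    where open ℝ-Solver

exp-0 : exp 0ᶜ ≈ᶜ 1ᶜ
exp-0 = ∣x-y∣≤ε⇒x≈y (λ ε 0<ε → converges-dist (re-exp-converges 0ᶜ) (constant 1ℝ) (1 , λ { (suc n) _ → tiny ε 0<ε (at₀ n proj₁) }))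
      , ∣x-y∣≤ε⇒x≈y (λ ε 0<ε → converges-dist (im-exp-converges 0ᶜ) (constant 0ℝ) (1 , λ { (suc n) _ → tiny ε 0<ε (at₀ n proj₂) }))
  where
  constant : ∀ x → Converges (λ _ → x) x
  constant x ε 0<ε = 0 , λ _ _ → ≤-trans (≈⇒≤ (x≈y⇒∣x-y∣≈0 ≈-refl)) (fromℚ-mono (ℚ.<⇒≤ 0<ε))
  at₀ : ∀ n (π : ℚᶜ → ℚ) j → π (at (expSum 0ᶜ (suc n)) j) ≡ π 1#
  at₀ n π j = cong π (trans (at-expSum 0ᶜ (suc n) j) (expSum-0 n))
  tiny : ∀ ε → ℚ.0ℚ ℚ.< ε → ∀ {x y} → (∀ j → seq x j ≡ seq y j) → ∣ x - y ∣ ≤ fromℚ ε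
  tiny ε 0<ε eq = ≤-trans (≈⇒≤ (x≈y⇒∣x-y∣≈0 (pointwise⇒≈ eq))) (fromℚ-mono (ℚ.<⇒≤ 0<ε))

conjᶜ : ℂ → ℂ
conjᶜ z = re z +i (- im z)

exp-conj : ∀ z → exp (conjᶜ z) ≈ᶜ conjᶜ (exp z)
exp-conj z =
    converges-unique (re-exp-converges (conjᶜ z)) (re-exp-converges z) (λ ε 0<ε → 0 , λ n _ →
      ≤-trans (≈⇒≤ (x≈y⇒∣x-y∣≈0 (pointwise⇒≈ λ j → cong proj₁ (pt n j)))) (fromℚ-mono (ℚ.<⇒≤ 0<ε)))
  , converges-unique (im-exp-converges (conjᶜ z)) (converges-neg (im-exp-converges z)) (λ ε 0<ε → 0 , λ n _ →
      ≤-trans (≈⇒≤ (x≈y⇒∣x-y∣≈0 (pointwise⇒≈ λ j → cong proj₂ (pt n j)))) (fromℚ-mono (ℚ.<⇒≤ 0<ε)))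
  where
  pt : ∀ n j → at (expSum (conjᶜ z) n) j ≡ conj (at (expSum z n) j)
  pt n j = trans (at-expSum (conjᶜ z) n j) (trans (expSum-conj n (at z j)) (cong conj (sym (at-expSum z n j))))

-- The unit circle

cis : ℝ → ℂ
cis s = exp (s · 𝕚)

cis-cong : ∀ {s t} → s ≈ t → cis s ≈ᶜ cis t
cis-cong {s} {t} s≈t = exp-cong {s · 𝕚} {t · 𝕚} (*-congʳ s≈t , *-congʳ s≈t)

cis-+ : ∀ s t → cis (s + t) ≈ᶜ (cis s *ᶜ cis t)
cis-+ s t =
  let (re≈ , im≈) = exp-cong {(s + t) · 𝕚} {s · 𝕚 +ᶜ t · 𝕚} (distribʳ 0ℝ s t , distribʳ 1ℝ s t)
      (re≈′ , im≈′) = exp-+ (s · 𝕚) (t · 𝕚)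
  in ≈-trans re≈ re≈′ , ≈-trans im≈ im≈′

cis-neg : ∀ s → cis (- s) ≈ᶜ conjᶜ (cis s)
cis-neg s =
  let (re≈ , im≈) = exp-cong {(- s) · 𝕚} {conjᶜ (s · 𝕚)}
        (solve 1 (λ s → (:- s) :* con ℚ.0ℚ := s :* con ℚ.0ℚ) ≈-refl s , solve 1 (λ s → (:- s) :* con ℚ.1ℚ := :- (s :* con ℚ.1ℚ)) ≈-refl s)
      (re≈′ , im≈′) = exp-conj (s · 𝕚)
  in ≈-trans re≈ re≈′ , ≈-trans im≈ im≈′
  where open ℝ-Solver

module _ B {s t} (s≤B : ∣ s ∣ ≤ fromℚ (fromℕ B)) (t≤B : ∣ t ∣ ≤ fromℚ (fromℕ B)) where

  private
    -- A bound on the real number s constrains its approximants only eventually and up to a positive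
    -- error; with error 1, B becomes `suc B`.
    eventually-bounded : ∀ {s} → ∣ s ∣ ≤ fromℚ (fromℕ B) → Eventually (λ j → ‖ at (s · 𝕚) j ‖ ℚ.≤ fromℕ (suc B))
    eventually-bounded {s} h = map₁ (λ j s≤ → begin
        ℚ.∣ seq s j ℚ.* ℚ.0ℚ ∣ ℚ.+ ℚ.∣ seq s j ℚ.* ℚ.1ℚ ∣
          ≡⟨ cong₂ (λ x y → ℚ.∣ x ∣ ℚ.+ ℚ.∣ y ∣) (ℚ.*-zeroʳ (seq s j)) (ℚ.*-identityʳ (seq s j)) ⟩
        ℚ.0ℚ ℚ.+ ℚ.∣ seq s j ∣       ≡⟨ ℚ.+-identityˡ ℚ.∣ seq s j ∣ ⟩
        ℚ.∣ seq s j ∣                ≤⟨ s≤ ⟩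
        fromℕ B ℚ.+ ℚ.1ℚ             ≡⟨ trans (ℚ.+-comm (fromℕ B) ℚ.1ℚ) (sym (fromℕ-suc B)) ⟩
        fromℕ (suc B)                ∎)
      (eventually≤ h ℚ.1ℚ 0<1)
      where open ℚ.≤-Reasoning

    dist≈ : dist₁ (s · 𝕚) (t · 𝕚) ≈ ∣ s - t ∣
    dist≈ = ≈-trans (+-cong (≈-trans (∣∣-cong (solve 2 (λ s t → s :* con ℚ.0ℚ :- t :* con ℚ.0ℚ := con ℚ.0ℚ) ≈-refl s t)) (0≤x⇒∣x∣≈x ≤-refl))
                            (∣∣-cong (+-cong (*-identityʳ s) (neg-cong (*-identityʳ t)))))
              (+-identityˡ ∣ s - t ∣)
      where open ℝ-Solver

  re-cis-lipschitz : ∣ re (cis s) - re (cis t) ∣ ≤ fromℚ (fromℕ (2 ℕ.* majorantBound (suc B))) * ∣ s - t ∣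
  re-cis-lipschitz = ≤-trans (re-exp-lipschitz (suc B) (s · 𝕚) (t · 𝕚) (eventually-bounded s≤B) (eventually-bounded t≤B))
    (≈⇒≤ (*-congˡ dist≈))

  im-cis-lipschitz : ∣ im (cis s) - im (cis t) ∣ ≤ fromℚ (fromℕ (2 ℕ.* majorantBound (suc B))) * ∣ s - t ∣
  im-cis-lipschitz = ≤-trans (im-exp-lipschitz (suc B) (s · 𝕚) (t · 𝕚) (eventually-bounded s≤B) (eventually-bounded t≤B))
    (≈⇒≤ (*-congˡ dist≈))

cis-0 : cis 0ℝ ≈ᶜ 1ᶜ
cis-0 =
  let (re≈ , im≈) = exp-cong {0ℝ · 𝕚} {0ᶜ} ((pointwise⇒≈ λ _ → refl) , pointwise⇒≈ λ _ → refl)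
  in ≈-trans re≈ (proj₁ exp-0) , ≈-trans im≈ (proj₂ exp-0)

abstract
  -- Abstract, so that sums of cosines and sines never unfold to limits of series. The laws in this
  -- block are the whole interface, with `cis≈cos+isin` as the way back to `exp`.
  cos sin : ℝ → ℝ
  cos s = re (cis s)
  sin s = im (cis s)

  cis≈cos+isin : ∀ s → exp (s · 𝕚) ≈ᶜ (cos s +i sin s)
  cis≈cos+isin s = ≈-refl , ≈-refl

  cos-cong : ∀ {s t} → s ≈ t → cos s ≈ cos t
  cos-cong s≈t = proj₁ (cis-cong s≈t)

  sin-cong : ∀ {s t} → s ≈ t → sin s ≈ sin t
  sin-cong s≈t = proj₂ (cis-cong s≈t)

  cos-0 : cos 0ℝ ≈ 1ℝ
  cos-0 = proj₁ cis-0

  cos-+ : ∀ s t → cos (s + t) ≈ cos s * cos t - sin s * sin t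
  cos-+ s t = proj₁ (cis-+ s t)

  sin-+ : ∀ s t → sin (s + t) ≈ cos s * sin t + sin s * cos t
  sin-+ s t = proj₂ (cis-+ s t)

  cos-neg : ∀ s → cos (- s) ≈ cos s
  cos-neg s = proj₁ (cis-neg s)

  sin-neg : ∀ s → sin (- s) ≈ - sin s
  sin-neg s = proj₂ (cis-neg s)

  cos-lipschitz : ∀ B {s t} → ∣ s ∣ ≤ fromℚ (fromℕ B) → ∣ t ∣ ≤ fromℚ (fromℕ B) →
    ∣ cos s - cos t ∣ ≤ fromℚ (fromℕ (2 ℕ.* majorantBound (suc B))) * ∣ s - t ∣
  cos-lipschitz = re-cis-lipschitz

  sin-lipschitz : ∀ B {s t} → ∣ s ∣ ≤ fromℚ (fromℕ B) → ∣ t ∣ ≤ fromℚ (fromℕ B) →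
    ∣ sin s - sin t ∣ ≤ fromℚ (fromℕ (2 ℕ.* majorantBound (suc B))) * ∣ s - t ∣
  sin-lipschitz = im-cis-lipschitz

cos-minus : ∀ s t → cos (s - t) ≈ cos s * cos t + sin s * sin t
cos-minus s t = begin-equality
  cos (s - t)                                  ≈⟨ cos-+ s (- t) ⟩
  cos s * cos (- t) - sin s * sin (- t)        ≈⟨ +-cong (*-congˡ (cos-neg t)) (neg-cong (*-congˡ (sin-neg t))) ⟩
  cos s * cos t - sin s * - sin t              ≈⟨ solve 4 (λ a b c d → a :* c :- b :* (:- d) := a :* c :+ b :* d) ≈-refl (cos s) (sin s) (cos t) (sin t) ⟩
  cos s * cos t + sin s * sin t                ∎
  where
  open ≤-Reasoning
  open ℝ-Solver

sin-minus : ∀ s t → sin (s - t) ≈ sin s * cos t - cos s * sin t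
sin-minus s t = begin-equality
  sin (s - t)                                  ≈⟨ sin-+ s (- t) ⟩
  cos s * sin (- t) + sin s * cos (- t)        ≈⟨ +-cong (*-congˡ (sin-neg t)) (*-congˡ (cos-neg t)) ⟩
  cos s * (- sin t) + sin s * cos t            ≈⟨ solve 4 (λ a b c d → a :* (:- d) :+ b :* c := b :* c :- a :* d) ≈-refl (cos s) (sin s) (cos t) (sin t) ⟩
  sin s * cos t - cos s * sin t                ∎
  where
  open ≤-Reasoning
  open ℝ-Solver

cos²+sin²≈1 : ∀ s → cos s * cos s + sin s * sin s ≈ 1ℝ
cos²+sin²≈1 s = ≈-trans (≈-sym (cos-minus s s)) (≈-trans (cos-cong (-‿inverseʳ s)) cos-0)

-- Finite sums

open Algebra.Properties.Semiring.Sum (CommutativeRing.semiring ℝ-commutativeRing)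
  using (∑-comm; ∑-distrib-+; *-distribˡ-sum; *-distribʳ-sum; sum-replicate-zero)

sum-cong : ∀ {n} {u v : Vector ℝ n} → (∀ i → u i ≈ v i) → sum u ≈ sum v
sum-cong {zero}  u≈v = ≈-refl
sum-cong {suc n} u≈v = +-cong (u≈v zero) (sum-cong (u≈v ∘ suc))

sum-*ˡ : ∀ {n} x (u : Vector ℝ n) → x * sum u ≈ sum (λ i → x * u i)
sum-*ˡ x u = *-distribˡ-sum x u

sum-*ʳ : ∀ {n} x (u : Vector ℝ n) → sum u * x ≈ sum (λ i → u i * x)
sum-*ʳ x u = *-distribʳ-sum x u

sum-comm : ∀ {m n} (u : Fin m → Fin n → ℝ) → sum (λ i → sum λ j → u i j) ≈ sum (λ j → sum λ i → u i j)
sum-comm u = ∑-comm u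

sum-+ : ∀ {n} (u v : Vector ℝ n) → sum (λ i → u i + v i) ≈ sum u + sum v
sum-+ u v = ∑-distrib-+ u v

sum-mono : ∀ {n} {u v : Vector ℝ n} → (∀ i → u i ≤ v i) → sum u ≤ sum v
sum-mono {zero}  u≤v = ≤-refl
sum-mono {suc n} u≤v = +-mono-≤ (u≤v zero) (sum-mono (u≤v ∘ suc))

sum-nonNeg : ∀ {n} {u : Vector ℝ n} → (∀ i → 0ℝ ≤ u i) → 0ℝ ≤ sum u
sum-nonNeg {zero}  0≤u = ≤-refl
sum-nonNeg {suc n} 0≤u = +-nonNeg (0≤u zero) (sum-nonNeg (0≤u ∘ suc))

term≤sum : ∀ {n} {u : Vector ℝ n} → (∀ i → 0ℝ ≤ u i) → ∀ k → u k ≤ sum u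
term≤sum {u = u} 0≤u zero = ≤-trans (≈⇒≤ (≈-sym (+-identityʳ (u zero)))) (+-monoʳ-≤ (u zero) (sum-nonNeg (0≤u ∘ suc)))
term≤sum {u = u} 0≤u (suc k) = ≤-trans (term≤sum (0≤u ∘ suc) k)
  (≤-trans (≈⇒≤ (≈-sym (+-identityˡ (sum (u ∘ suc))))) (+-monoˡ-≤ (sum (u ∘ suc)) (0≤u zero)))

∣sum∣≤ : ∀ {n} (u : Vector ℝ n) → ∣ sum u ∣ ≤ sum (λ i → ∣ u i ∣)
∣sum∣≤ {zero}  u = ≈⇒≤ (0≤x⇒∣x∣≈x ≤-refl)
∣sum∣≤ {suc n} u = ≤-trans (∣x+y∣≤∣x∣+∣y∣ (u zero) (sum (u ∘ suc))) (+-monoʳ-≤ ∣ u zero ∣ (∣sum∣≤ (u ∘ suc)))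

⌜_⌝ : ℕ → ℝ
⌜ n ⌝ = fromℚ (fromℕ n)

0≤⌜_⌝ : ∀ n → 0ℝ ≤ ⌜ n ⌝
0≤⌜ n ⌝ = fromℚ-mono (0≤fromℕ n)

⌜suc⌝ : ∀ n → ⌜ suc n ⌝ ≈ 1ℝ + ⌜ n ⌝
⌜suc⌝ n = pointwise⇒≈ λ _ → fromℕ-suc n

⌜+⌝ : ∀ m n → ⌜ m ℕ.+ n ⌝ ≈ ⌜ m ⌝ + ⌜ n ⌝
⌜+⌝ m n = pointwise⇒≈ λ _ → sym (fromℤ-+ (+ m) (+ n))

⌜*⌝ : ∀ m n → ⌜ m ℕ.* n ⌝ ≈ ⌜ m ⌝ * ⌜ n ⌝
⌜*⌝ m n = pointwise⇒≈ λ _ → sym (fromℕ-* m n)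

sum-const : ∀ n x → sum {n} (λ _ → x) ≈ ⌜ n ⌝ * x
sum-const zero    x = solve 1 (λ x → con ℚ.0ℚ := con ℚ.0ℚ :* x) ≈-refl x
  where open ℝ-Solver
sum-const (suc n) x = begin-equality
  x + sum {n} (λ _ → x)  ≈⟨ +-congˡ (sum-const n x) ⟩
  x + ⌜ n ⌝ * x          ≈⟨ solve 2 (λ x n → x :+ n :* x := (con ℚ.1ℚ :+ n) :* x) ≈-refl x ⌜ n ⌝ ⟩
  (1ℝ + ⌜ n ⌝) * x       ≈⟨ *-congʳ (⌜suc⌝ n) ⟨
  ⌜ suc n ⌝ * x          ∎
  where
  open ≤-Reasoning
  open ℝ-Solver

sum-single : ∀ {n} (u : Vector ℝ n) k → (∀ i → i ≢ k → u i ≈ 0ℝ) → sum u ≈ u k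
sum-single {suc n} u zero    u≈0 = ≈-trans
  (+-congˡ (≈-trans (sum-cong (λ i → u≈0 (suc i) λ ())) (sum-replicate-zero n))) (+-identityʳ (u zero))
sum-single {suc n} u (suc k) u≈0 = ≈-trans
  (+-cong (u≈0 zero λ ()) (sum-single (u ∘ suc) k (λ i i≢k → u≈0 (suc i) (i≢k ∘ Fin.suc-injective))))
  (+-identityˡ (u (suc k)))

sum*sum : ∀ {m n} (u : Vector ℝ m) (v : Vector ℝ n) → sum u * sum v ≈ sum (λ i → sum (λ j → u i * v j))
sum*sum u v = ≈-trans (sum-*ʳ (sum v) u) (sum-cong λ i → sum-*ˡ (u i) v)

diagonal≤ : ∀ {n} {u : Fin n → Fin n → ℝ} → (∀ i j → 0ℝ ≤ u i j) → sum (λ i → u i i) ≤ sum (λ i → sum (u i))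
diagonal≤ 0≤u = sum-mono λ i → term≤sum (0≤u i) i

∑∑-comm : ∀ {m n} (u : Fin m → Fin m → Fin n → Fin n → ℝ) →
  sum (λ i → sum λ j → sum λ k → sum λ l → u i j k l) ≈ sum (λ k → sum λ l → sum λ i → sum λ j → u i j k l)
∑∑-comm u = begin-equality
  sum (λ i → sum λ j → sum λ k → sum λ l → u i j k l)
    ≈⟨ sum-cong (λ i → sum-comm (λ j k → sum λ l → u i j k l)) ⟩
  sum (λ i → sum λ k → sum λ j → sum λ l → u i j k l)
    ≈⟨ sum-cong (λ i → sum-cong λ k → sum-comm (λ j l → u i j k l)) ⟩
  sum (λ i → sum λ k → sum λ l → sum λ j → u i j k l)
    ≈⟨ sum-comm (λ i k → sum λ l → sum λ j → u i j k l) ⟩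
  sum (λ k → sum λ i → sum λ l → sum λ j → u i j k l)
    ≈⟨ sum-cong (λ k → sum-comm (λ i l → sum λ j → u i j k l)) ⟩
  sum (λ k → sum λ l → sum λ i → sum λ j → u i j k l) ∎
  where open ≤-Reasoning

-- Sums over initial segments of ℕ

partialSum-cong : ∀ {u v} n → (∀ i → i ℕ.< n → u i ≈ v i) → partialSum u n ≈ partialSum v n
partialSum-cong zero    u≈v = ≈-refl
partialSum-cong (suc n) u≈v = +-cong (partialSum-cong n λ i i<n → u≈v i (ℕ.m≤n⇒m≤1+n i<n)) (u≈v n ℕ.≤-refl)

partialSum-mono : ∀ {u v} n → (∀ i → i ℕ.< n → u i ≤ v i) → partialSum u n ≤ partialSum v n
partialSum-mono zero    u≤v = ≤-refl
partialSum-mono (suc n) u≤v = +-mono-≤ (partialSum-mono n λ i i<n → u≤v i (ℕ.m≤n⇒m≤1+n i<n)) (u≤v n ℕ.≤-refl)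

partialSum-split : ∀ u m n → partialSum u (m ℕ.+ n) ≈ partialSum u m + partialSum (λ i → u (m ℕ.+ i)) n
partialSum-split u m zero    rewrite ℕ.+-identityʳ m = ≈-sym (+-identityʳ (partialSum u m))
partialSum-split u m (suc n) rewrite ℕ.+-suc m n =
  ≈-trans (+-congʳ (partialSum-split u m n)) (+-assoc (partialSum u m) (partialSum (λ i → u (m ℕ.+ i)) n) (u (m ℕ.+ n)))

partialSum-nonNeg : ∀ {u} → (∀ i → 0ℝ ≤ u i) → ∀ n → 0ℝ ≤ partialSum u n
partialSum-nonNeg 0≤u zero    = ≤-refl
partialSum-nonNeg 0≤u (suc n) = +-nonNeg (partialSum-nonNeg 0≤u n) (0≤u n)

window≤partialSum : ∀ {u} → (∀ i → 0ℝ ≤ u i) → ∀ d {n m} → d ℕ.+ n ℕ.≤ m →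
  partialSum (λ i → u (d ℕ.+ i)) n ≤ partialSum u m
window≤partialSum {u} 0≤u d {n} {m} d+n≤m = begin
  W                                        ≈⟨ +-identityˡ W ⟨
  0ℝ + W                                   ≤⟨ +-monoˡ-≤ W (partialSum-nonNeg 0≤u d) ⟩
  partialSum u d + W                       ≈⟨ partialSum-split u d n ⟨
  partialSum u (d ℕ.+ n)                   ≈⟨ +-identityʳ _ ⟨
  partialSum u (d ℕ.+ n) + 0ℝ              ≤⟨ +-monoʳ-≤ _ (partialSum-nonNeg (λ i → 0≤u (d ℕ.+ n ℕ.+ i)) e) ⟩
  partialSum u (d ℕ.+ n) + partialSum (λ i → u (d ℕ.+ n ℕ.+ i)) e
                                           ≈⟨ partialSum-split u (d ℕ.+ n) e ⟨
  partialSum u (d ℕ.+ n ℕ.+ e)             ≡⟨ cong (partialSum u) (ℕ.m+[n∸m]≡n d+n≤m) ⟩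
  partialSum u m                           ∎
  where
  open ≤-Reasoning
  W = partialSum (λ i → u (d ℕ.+ i)) n
  e = m ℕ.∸ (d ℕ.+ n)

sum≈partialSum : ∀ u n → sum {n} (u ∘ toℕ) ≈ partialSum u n
sum≈partialSum u zero    = ≈-refl
sum≈partialSum u (suc n) = begin-equality
  u 0 + sum {n} (u ∘ suc ∘ toℕ)          ≈⟨ +-congˡ (sum≈partialSum (u ∘ suc) n) ⟩
  u 0 + partialSum (u ∘ suc) n           ≈⟨ +-congʳ (+-identityˡ (u 0)) ⟨
  0ℝ + u 0 + partialSum (u ∘ suc) n      ≈⟨ partialSum-split u 1 n ⟨
  partialSum u (suc n)                   ∎
  where open ≤-Reasoning

partialSum-double : ∀ u n → partialSum u (n ℕ.+ n) ≈ partialSum (λ j → u (j ℕ.+ j) + u (suc (j ℕ.+ j))) n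
partialSum-double u zero    = ≈-refl
partialSum-double u (suc n) rewrite ℕ.+-suc n n = ≈-trans (+-assoc _ _ _) (+-congʳ (partialSum-double u n))

partialSum-+ : ∀ u v n → partialSum (λ i → u i + v i) n ≈ partialSum u n + partialSum v n
partialSum-+ u v zero    = ≈-sym (+-identityˡ 0ℝ)
partialSum-+ u v (suc n) = ≈-trans (+-congʳ (partialSum-+ u v n))
  (solve 4 (λ a b c d → a :+ b :+ (c :+ d) := a :+ c :+ (b :+ d)) ≈-refl (partialSum u n) (partialSum v n) (u n) (v n))
  where open ℝ-Solver

partialSum-*ˡ : ∀ x u n → partialSum (λ i → x * u i) n ≈ x * partialSum u n
partialSum-*ˡ x u zero    = solve 1 (λ x → con ℚ.0ℚ := x :* con ℚ.0ℚ) ≈-refl x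
  where open ℝ-Solver
partialSum-*ˡ x u (suc n) = ≈-trans (+-congʳ (partialSum-*ˡ x u n)) (≈-sym (distribˡ x (partialSum u n) (u n)))

partialSum-const : ∀ x n → partialSum (λ _ → x) n ≈ ⌜ n ⌝ * x
partialSum-const x n = ≈-trans (≈-sym (sum≈partialSum (λ _ → x) n)) (sum-const n x)

-- Strict order and dyadic nodes

<⇒≱ : ∀ {x y} → x < y → ¬ (y ≤ x)
<⇒≱ {x} {y} (mk< δ 0<δ h) y≤x = ℚ.<-irrefl refl (ℚ.<-≤-trans (ℚ.+-monoʳ-< (seq x n) ½δ<δ) (begin
  seq x n ℚ.+ δ              ≤⟨ proj₁ both ⟩
  seq y n                    ≤⟨ proj₂ both ⟩
  seq x n ℚ.+ ℚ.½ ℚ.* δ      ∎))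
  where
  open ℚ.≤-Reasoning
  e = map₂ {R = λ i → seq x i ℚ.+ δ ℚ.≤ seq y i × seq y i ℚ.≤ seq x i ℚ.+ ℚ.½ ℚ.* δ} (λ _ → _,_) h (eventually≤ y≤x (ℚ.½ ℚ.* δ) (half 0<δ))
  n = proj₁ e
  both = now e
  ½δ<δ : ℚ.½ ℚ.* δ ℚ.< δ
  ½δ<δ = ℚ.<-≤-trans
    (ℚ.<-respˡ-≡ (ℚ.+-identityʳ (ℚ.½ ℚ.* δ)) (ℚ.+-monoʳ-< (ℚ.½ ℚ.* δ) (half 0<δ)))
    (ℚ.≤-reflexive (half+half δ))

2^ : ℕ → ℕ
2^ zero    = 1
2^ (suc n) = 2^ n ℕ.+ 2^ n

2^*½^ : ∀ n → fromℕ (2^ n) ℚ.* ½^ n ≡ ℚ.1ℚ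
2^*½^ zero    = refl
2^*½^ (suc n) = begin
  fromℕ (2^ n ℕ.+ 2^ n) ℚ.* (ℚ.½ ℚ.* ½^ n)                ≡⟨ cong (ℚ._* (ℚ.½ ℚ.* ½^ n)) (fromℤ-+ (+ 2^ n) (+ 2^ n)) ⟨
  (fromℕ (2^ n) ℚ.+ fromℕ (2^ n)) ℚ.* (ℚ.½ ℚ.* ½^ n)
    ≡⟨ solve 2 (λ a h → (a :+ a) :* (con ℚ.½ :* h) := a :* h) refl (fromℕ (2^ n)) (½^ n) ⟩
  fromℕ (2^ n) ℚ.* ½^ n                                   ≡⟨ 2^*½^ n ⟩
  ℚ.1ℚ                                                    ∎
  where
  open ≡-Reasoning
  open ℚ.+-*-Solver

-- The nodes of the n-th dyadic subdivision of [-1 , 1].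
abstract
  node : ℕ → ℕ → ℚ
  node n j = fromℕ j ℚ.* (fromℕ 2 ℚ.* ½^ n) ℚ.- ℚ.1ℚ

  node-def : ∀ n j → node n j ≡ fromℕ j ℚ.* (fromℕ 2 ℚ.* ½^ n) ℚ.- ℚ.1ℚ
  node-def n j = refl

  -- Old nodes reappear under even indices, as equal rationals. Positions on successive levels are
  -- then equal in the sense of `_≡_` and may be replaced inside the argument of an arbitrary f.
  node-refine : ∀ n j → node (suc n) (j ℕ.+ j) ≡ node n j
  node-refine n j = trans
    (cong (λ m → m ℚ.* (fromℕ 2 ℚ.* (ℚ.½ ℚ.* ½^ n)) ℚ.- ℚ.1ℚ) (sym (fromℤ-+ (+ j) (+ j))))
    (solve 2 (λ j h → (j :+ j) :* (con (fromℕ 2) :* (con ℚ.½ :* h)) :- con ℚ.1ℚ := j :* (con (fromℕ 2) :* h) :- con ℚ.1ℚ) refl (fromℕ j) (½^ n))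
    where open ℚ.+-*-Solver

  node-refine-suc : ∀ n j → node (suc n) (suc (suc (j ℕ.+ j))) ≡ node n (suc j)
  node-refine-suc n j = trans (cong (λ i → node (suc n) (suc i)) (sym (ℕ.+-suc j j))) (node-refine n (suc j))

  node-suc : ∀ n j → node n (suc j) ≡ node n j ℚ.+ fromℕ 2 ℚ.* ½^ n
  node-suc n j = trans
    (cong (λ m → m ℚ.* (fromℕ 2 ℚ.* ½^ n) ℚ.- ℚ.1ℚ) (fromℕ-suc j))
    (solve 2 (λ j h → (con ℚ.1ℚ :+ j) :* h :- con ℚ.1ℚ := j :* h :- con ℚ.1ℚ :+ h) refl (fromℕ j) (fromℕ 2 ℚ.* ½^ n))
    where open ℚ.+-*-Solver

  node-mono : ∀ n {i j} → i ℕ.≤ j → node n i ℚ.≤ node n j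
  node-mono n i≤j = ℚ.+-monoˡ-≤ (ℚ.- ℚ.1ℚ) (*-monoʳ (0≤* (0≤fromℕ 2) (0≤½^ n)) (fromℕ-mono i≤j))

  node-first : ∀ n → node n 0 ≡ ℚ.- ℚ.1ℚ
  node-first n = solve 1 (λ h → con ℚ.0ℚ :* h :- con ℚ.1ℚ := :- con ℚ.1ℚ) refl (fromℕ 2 ℚ.* ½^ n)
    where open ℚ.+-*-Solver

  node-last : ∀ n → node n (2^ n) ≡ ℚ.1ℚ
  node-last n = trans
    (solve 2 (λ a h → a :* (con (fromℕ 2) :* h) :- con ℚ.1ℚ := con (fromℕ 2) :* (a :* h) :- con ℚ.1ℚ) refl (fromℕ (2^ n)) (½^ n))
    (cong (λ p → fromℕ 2 ℚ.* p ℚ.- ℚ.1ℚ) (2^*½^ n))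
    where open ℚ.+-*-Solver

double-suc≤ : ∀ {j m} → j ℕ.< m → suc (suc (j ℕ.+ j)) ℕ.≤ m ℕ.+ m
double-suc≤ {j} {m} j<m = subst (ℕ._≤ m ℕ.+ m) (cong suc (ℕ.+-suc j j)) (ℕ.+-mono-≤ j<m j<m)

-- Integrals of Lipschitz functions

IsLipschitz : ℝ → ℕ → (ℝ → ℝ) → Set
IsLipschitz T K f = ∀ s t → ∣ s ∣ ≤ T → ∣ t ∣ ≤ T → ∣ f s - f t ∣ ≤ ⌜ K ⌝ * ∣ s - t ∣

isLebesgueIntegral-cong : ∀ {f g a b I} → (∀ x → f x ≈ g x) → IsLebesgueIntegral f a b I → IsLebesgueIntegral g a b I
isLebesgueIntegral-cong f≈g (S , summable , hasSum , pointwise) = S , summable , hasSum ,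
  λ x a<x x<b x∈? converges ε 0<ε → map₁
    (λ n near → ≤-trans (≈⇒≤ (∣∣-cong (+-congˡ (neg-cong (≈-sym (f≈g x)))))) near)
    (pointwise x a<x x<b x∈? converges ε 0<ε)

-- The first term comes from the coarsest step function and not from a refinement, hence its
-- separate bound. Moving the index by one turns A into 2 A.
shift-geometric : ∀ (u : ℕ → ℝ) M A → ∣ u 0 ∣ ≤ ⌜ M ⌝ → (∀ n → ∣ u (suc n) ∣ ≤ fromℚ (fromℕ A ℚ.* ½^ n)) →
  ∀ n → ∣ u n ∣ ≤ fromℚ (fromℕ (M ℕ.+ (A ℕ.+ A)) ℚ.* ½^ n)
shift-geometric u M A u₀≤M h = bound
  where
  times-one : ∀ p q → q ≡ ℚ.1ℚ → p ℚ.* q ≡ p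
  times-one p q refl = ℚ.*-identityʳ p
  first : fromℕ M ℚ.≤ fromℕ (M ℕ.+ (A ℕ.+ A)) ℚ.* ½^ 0
  first = ℚ.≤-trans (fromℕ-mono (ℕ.m≤m+n M (A ℕ.+ A))) (ℚ.≤-reflexive (sym (times-one (fromℕ (M ℕ.+ (A ℕ.+ A))) (½^ 0) refl)))
  later : ∀ n → fromℕ A ℚ.* ½^ n ℚ.≤ fromℕ (M ℕ.+ (A ℕ.+ A)) ℚ.* ½^ (suc n)
  later n = begin
    fromℕ A ℚ.* ½^ n
      ≡⟨ solve 2 (λ a h → a :* h := (a :+ a) :* (con ℚ.½ :* h)) refl (fromℕ A) (½^ n) ⟩
    (fromℕ A ℚ.+ fromℕ A) ℚ.* ½^ (suc n)
      ≡⟨ cong (ℚ._* ½^ (suc n)) (fromℤ-+ (+ A) (+ A)) ⟩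
    fromℕ (A ℕ.+ A) ℚ.* ½^ (suc n)
      ≤⟨ *-monoʳ (0≤½^ (suc n)) (fromℕ-mono (ℕ.m≤n+m (A ℕ.+ A) M)) ⟩
    fromℕ (M ℕ.+ (A ℕ.+ A)) ℚ.* ½^ (suc n) ∎
    where
    open ℚ.≤-Reasoning
    open ℚ.+-*-Solver
  bound : ∀ n → ∣ u n ∣ ≤ fromℚ (fromℕ (M ℕ.+ (A ℕ.+ A)) ℚ.* ½^ n)
  bound zero    = ≤-trans u₀≤M (fromℚ-mono first)
  bound (suc n) = ≤-trans (h n) (fromℚ-mono (later n))

-- The n-th partial sum of the brick series below is the step function that takes, on each interval
-- of the (n ∸ 1)-st dyadic subdivision of [-T , T], the value of f at the left endpoint.
module LeftEndpoints (f : ℝ → ℝ) (T : ℝ) (0<T : 0ℝ < T) (K : ℕ) (lipschitz : IsLipschitz T K f) where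

  pos : ℕ → ℕ → ℝ
  pos n j = T * fromℚ (node n j)

  0≤T : 0ℝ ≤ T
  0≤T = <⇒≤ 0<T

  pos-mono : ∀ n {i j} → i ℕ.≤ j → pos n i ≤ pos n j
  pos-mono n i≤j = *-monoˡ-≤ 0≤T (fromℚ-mono (node-mono n i≤j))

  pos-first : ∀ n → pos n 0 ≈ - T
  pos-first n = ≈-trans (*-congˡ (pointwise⇒≈ λ _ → node-first n))
    (solve 1 (λ T → T :* con (ℚ.- ℚ.1ℚ) := :- T) ≈-refl T)
    where open ℝ-Solver

  pos-last : ∀ n → pos n (2^ n) ≈ T
  pos-last n = ≈-trans (*-congˡ (pointwise⇒≈ λ _ → node-last n)) (*-identityʳ T)

  -T≤pos : ∀ n j → - T ≤ pos n j
  -T≤pos n j = ≤-trans (≈⇒≤ (≈-sym (pos-first n))) (pos-mono n ℕ.z≤n)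

  pos≤T : ∀ n {j} → j ℕ.≤ 2^ n → pos n j ≤ T
  pos≤T n j≤ = ≤-trans (pos-mono n j≤) (≈⇒≤ (pos-last n))

  ∣pos∣≤T : ∀ n {j} → j ℕ.≤ 2^ n → ∣ pos n j ∣ ≤ T
  ∣pos∣≤T n {j} j≤ = ∣∣-lub (pos≤T n j≤) (≤-trans (neg-anti-≤ (-T≤pos n j)) (≈⇒≤ (solve 1 (λ T → :- (:- T) := T) ≈-refl T)))
    where open ℝ-Solver

  pos-step : ∀ n j → pos n (suc j) - pos n j ≈ T * fromℚ (fromℕ 2 ℚ.* ½^ n)
  pos-step n j = pointwise⇒≈ λ i → trans
    (cong (λ p → seq T i ℚ.* p ℚ.- seq T i ℚ.* node n j) (node-suc n j))
    (solve 3 (λ t x h → t :* (x :+ h) :- t :* x := t :* h) refl (seq T i) (node n j) (fromℕ 2 ℚ.* ½^ n))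
    where open ℚ.+-*-Solver

  half-step : ∀ n j → pos (suc n) (suc j) - pos (suc n) j ≈ T * fromℚ (½^ n)
  half-step n j = ≈-trans (pos-step (suc n) j) (pointwise⇒≈ λ i → cong (seq T i ℚ.*_)
    (solve 1 (λ h → con (fromℕ 2) :* (con ℚ.½ :* h) := h) refl (½^ n)))
    where open ℚ.+-*-Solver

  -- The two positions are the midpoint and the left end of the j-th interval of level n. Passing to
  -- level n + 1 changes the step function by this amount on the right half of that interval.
  jump : ℕ → ℕ → ℝ
  jump n j = f (pos (suc n) (suc (j ℕ.+ j))) - f (pos (suc n) (j ℕ.+ j))

  series : BrickSeries (- T) T
  series .BrickSeries.size zero    = 1
  series .BrickSeries.size (suc n) = 2^ n
  series .BrickSeries.brick zero _ = record
    { coeff      = f (pos 0 0)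
    ; left       = pos 0 0
    ; right      = pos 0 1
    ; a≤left     = -T≤pos 0 0
    ; left≤right = pos-mono 0 {0} {1} ℕ.z≤n
    ; right≤b    = pos≤T 0 {1} ℕ.≤-refl
    }
  series .BrickSeries.brick (suc n) j = record
    { coeff      = jump n (toℕ j)
    ; left       = pos (suc n) (suc (toℕ j ℕ.+ toℕ j))
    ; right      = pos (suc n) (suc (suc (toℕ j ℕ.+ toℕ j)))
    ; a≤left     = -T≤pos (suc n) (suc (toℕ j ℕ.+ toℕ j))
    ; left≤right = pos-mono (suc n) (ℕ.n≤1+n (suc (toℕ j ℕ.+ toℕ j)))
    ; right≤b    = pos≤T (suc n) (double-suc≤ (Fin.toℕ<n j))
    }

  open BrickSeries series using (brick)
  open Brick

  τ : ℕ
  τ = proj₁ (∃rationalBound T)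

  T≤τ : T ≤ ⌜ τ ⌝
  T≤τ = ≤-trans (x≤∣x∣ T) (proj₂ (∃rationalBound T))

  w : ℕ → ℝ
  w n = T * fromℚ (½^ n)

  0≤w : ∀ n → 0ℝ ≤ w n
  0≤w n = *-nonNeg 0≤T (fromℚ-mono (0≤½^ n))

  ∣jump∣≤ : ∀ n j → j ℕ.< 2^ n → ∣ jump n j ∣ ≤ ⌜ K ⌝ * w n
  ∣jump∣≤ n j j<2^n = ≤-trans
    (lipschitz _ _ (∣pos∣≤T (suc n) (ℕ.≤-trans (ℕ.n≤1+n _) (double-suc≤ j<2^n)))
                   (∣pos∣≤T (suc n) (ℕ.≤-trans (ℕ.≤-trans (ℕ.n≤1+n _) (ℕ.n≤1+n _)) (double-suc≤ j<2^n))))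
    (≈⇒≤ (*-congˡ (≈-trans (∣∣-cong (half-step n (j ℕ.+ j))) (0≤x⇒∣x∣≈x (0≤w n)))))

  A : ℕ
  A = K ℕ.* (τ ℕ.* τ)

  -- There are 2^n bricks, with coefficients at most K T / 2^n and lengths T / 2^n, so one factor
  -- 2^-n survives the summation.
  absIntegralTerm≤ : ∀ n → absIntegralTerms series (suc n) ≤ fromℚ (fromℕ A ℚ.* ½^ n)
  absIntegralTerm≤ n = begin
    sum (λ j → ∣ coeff (brick (suc n) j) ∣ * length (brick (suc n) j))
      ≤⟨ sum-mono (λ j → *-mono-≤ (0≤length j) (*-nonNeg 0≤⌜ K ⌝ (0≤w n)) (∣jump∣≤ n (toℕ j) (Fin.toℕ<n j))
           (≈⇒≤ (half-step n (suc (toℕ j ℕ.+ toℕ j))))) ⟩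
    sum {2^ n} (λ j → ⌜ K ⌝ * w n * w n)
      ≈⟨ sum-const (2^ n) (⌜ K ⌝ * w n * w n) ⟩
    ⌜ 2^ n ⌝ * (⌜ K ⌝ * w n * w n)
      ≈⟨ solve 4 (λ m k t h → m :* (k :* (t :* h) :* (t :* h)) := k :* (t :* t) :* ((m :* h) :* h)) ≈-refl ⌜ 2^ n ⌝ ⌜ K ⌝ T (fromℚ (½^ n)) ⟩
    ⌜ K ⌝ * (T * T) * (⌜ 2^ n ⌝ * fromℚ (½^ n) * fromℚ (½^ n))
      ≈⟨ *-congˡ (≈-trans (*-congʳ (pointwise⇒≈ λ _ → 2^*½^ n)) (*-identityˡ (fromℚ (½^ n)))) ⟩
    ⌜ K ⌝ * (T * T) * fromℚ (½^ n)
      ≤⟨ *-monoʳ-≤ (fromℚ-mono (0≤½^ n)) (*-monoˡ-≤ 0≤⌜ K ⌝ (*-mono-≤ 0≤T 0≤⌜ τ ⌝ T≤τ T≤τ)) ⟩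
    ⌜ K ⌝ * (⌜ τ ⌝ * ⌜ τ ⌝) * fromℚ (½^ n)
      ≈⟨ *-congʳ (≈-trans (⌜*⌝ K (τ ℕ.* τ)) (*-congˡ (⌜*⌝ τ τ))) ⟨
    ⌜ A ⌝ * fromℚ (½^ n)
      ≈⟨ fromℚ-* (fromℕ A) (½^ n) ⟩
    fromℚ (fromℕ A ℚ.* ½^ n) ∎
    where
    open ≤-Reasoning
    open ℝ-Solver
    0≤length : ∀ j → 0ℝ ≤ length (brick (suc n) j)
    0≤length j = x≤y⇒0≤y-x (left≤right (brick (suc n) j))

  absIntegralTerms-nonNeg : ∀ n → 0ℝ ≤ absIntegralTerms series n
  absIntegralTerms-nonNeg n = sum-nonNeg λ j →
    *-nonNeg (0≤∣x∣ (coeff (brick n j))) (x≤y⇒0≤y-x (left≤right (brick n j)))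

  ∣absIntegralTerm∣≤ : ∀ n → ∣ absIntegralTerms series (suc n) ∣ ≤ fromℚ (fromℕ A ℚ.* ½^ n)
  ∣absIntegralTerm∣≤ n = ≤-trans (≈⇒≤ (0≤x⇒∣x∣≈x (absIntegralTerms-nonNeg (suc n)))) (absIntegralTerm≤ n)

  ∣integralTerm∣≤ : ∀ n → ∣ integralTerms series (suc n) ∣ ≤ fromℚ (fromℕ A ℚ.* ½^ n)
  ∣integralTerm∣≤ n = ≤-trans (∣sum∣≤ (λ j → coeff (brick (suc n) j) * length (brick (suc n) j)))
    (≤-trans (sum-mono λ j → ≈⇒≤ (≈-trans (∣x*y∣≈∣x∣*∣y∣ (coeff (brick (suc n) j)) (length (brick (suc n) j)))
      (*-congˡ (0≤x⇒∣x∣≈x (x≤y⇒0≤y-x (left≤right (brick (suc n) j))))))) (absIntegralTerm≤ n))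

  absIntegralTerms-geometric : ∃[ B ] (∀ n → ∣ absIntegralTerms series n ∣ ≤ fromℚ (fromℕ B ℚ.* ½^ n))
  absIntegralTerms-geometric = _ , shift-geometric (absIntegralTerms series) _ A
    (proj₂ (∃rationalBound (absIntegralTerms series 0))) ∣absIntegralTerm∣≤

  integralTerms-geometric : ∃[ B ] (∀ n → ∣ integralTerms series n ∣ ≤ fromℚ (fromℕ B ℚ.* ½^ n))
  integralTerms-geometric = _ , shift-geometric (integralTerms series) _ A
    (proj₂ (∃rationalBound (integralTerms series 0))) ∣integralTerm∣≤

  absolutely-summable : Summable (absIntegralTerms series)
  absolutely-summable = _ , geometric⇒hasSum (absIntegralTerms series) _ (proj₂ absIntegralTerms-geometric)

  integral : ℝ
  integral = lim (partialSum (integralTerms series)) (geometric⇒cauchy (integralTerms series) _ (proj₂ integralTerms-geometric))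

  integral-hasSum : HasSum (integralTerms series) integral
  integral-hasSum = geometric⇒hasSum (integralTerms series) _ (proj₂ integralTerms-geometric)

  riemannSum : ℕ → ℝ
  riemannSum n = T * fromℚ (fromℕ 2 ℚ.* ½^ n) * partialSum (λ i → f (pos n i)) (2^ n)

  integralTerm : ∀ n → integralTerms series (suc n) ≈ w n * partialSum (jump n) (2^ n)
  integralTerm n = begin-equality
    sum (λ j → coeff (brick (suc n) j) * length (brick (suc n) j))
      ≈⟨ sum-cong {2^ n} {λ j → coeff (brick (suc n) j) * length (brick (suc n) j)} {λ j → w n * jump n (toℕ j)}
           (λ j → ≈-trans (*-congˡ (half-step n (suc (toℕ j ℕ.+ toℕ j)))) (*-comm (jump n (toℕ j)) (w n))) ⟩
    sum {2^ n} (λ j → w n * jump n (toℕ j))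
      ≈⟨ sum-*ˡ {2^ n} (w n) (λ j → jump n (toℕ j)) ⟨
    w n * sum {2^ n} (λ j → jump n (toℕ j))
      ≈⟨ *-congˡ (sum≈partialSum (jump n) (2^ n)) ⟩
    w n * partialSum (jump n) (2^ n) ∎
    where open ≤-Reasoning

  -- Halving the mesh counts each old value twice with half the weight; the jump then trades one of
  -- the two copies for the value at the midpoint.
  partialSum-integralTerms : ∀ n → partialSum (integralTerms series) (suc n) ≈ riemannSum n
  partialSum-integralTerms zero = begin-equality
    0ℝ + (f (pos 0 0) * (pos 0 1 - pos 0 0) + 0ℝ)
      ≈⟨ +-congˡ (+-congʳ (*-congˡ (pos-step 0 0))) ⟩
    0ℝ + (f (pos 0 0) * (T * fromℚ (fromℕ 2 ℚ.* ½^ 0)) + 0ℝ)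
      ≈⟨ solve 2 (λ y h → con ℚ.0ℚ :+ (y :* h :+ con ℚ.0ℚ) := h :* (con ℚ.0ℚ :+ y)) ≈-refl (f (pos 0 0)) (T * fromℚ (fromℕ 2 ℚ.* ½^ 0)) ⟩
    riemannSum 0 ∎
    where
    open ≤-Reasoning
    open ℝ-Solver
  partialSum-integralTerms (suc n) = begin-equality
    partialSum (integralTerms series) (suc n) + integralTerms series (suc n)
      ≈⟨ +-cong (partialSum-integralTerms n) (integralTerm n) ⟩
    T * fromℚ (fromℕ 2 ℚ.* ½^ n) * partialSum (λ i → f (pos n i)) (2^ n) + w n * partialSum (jump n) (2^ n)
      ≈⟨ +-congʳ (*-cong
           (pointwise⇒≈ λ i → doubling (seq T i) (½^ n))
           (partialSum-cong (2^ n) λ i _ → ≡⇒≈ (cong (λ p → f (T * fromℚ p)) (sym (node-refine n i))))) ⟩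
    (w n + w n) * partialSum even (2^ n) + w n * partialSum (jump n) (2^ n)
      ≈⟨ solve 3 (λ w s t → (w :+ w) :* s :+ w :* t := w :* ((s :+ s) :+ t)) ≈-refl (w n) (partialSum even (2^ n)) (partialSum (jump n) (2^ n)) ⟩
    w n * ((partialSum even (2^ n) + partialSum even (2^ n)) + partialSum (jump n) (2^ n))
      ≈⟨ *-congˡ (+-congʳ (partialSum-+ even even (2^ n))) ⟨
    w n * (partialSum (λ i → even i + even i) (2^ n) + partialSum (jump n) (2^ n))
      ≈⟨ *-congˡ (partialSum-+ (λ i → even i + even i) (jump n) (2^ n)) ⟨
    w n * partialSum (λ i → (even i + even i) + jump n i) (2^ n)
      ≈⟨ *-congˡ (partialSum-cong (2^ n) λ i _ → telescope (even i) (odd i)) ⟩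
    w n * partialSum (λ i → even i + odd i) (2^ n)
      ≈⟨ *-cong (pointwise⇒≈ λ i → halving (seq T i) (½^ n)) (≈-sym (partialSum-double (λ i → f (pos (suc n) i)) (2^ n))) ⟩
    riemannSum (suc n) ∎
    where
    open ≤-Reasoning
    open ℝ-Solver
    ≡⇒≈ : ∀ {x y} → x ≡ y → x ≈ y
    ≡⇒≈ refl = ≈-refl
    even odd : ℕ → ℝ
    even i = f (pos (suc n) (i ℕ.+ i))
    odd i = f (pos (suc n) (suc (i ℕ.+ i)))
    telescope : ∀ x y → (x + x) + (y - x) ≈ x + y
    telescope = solve 2 (λ x y → (x :+ x) :+ (y :- x) := x :+ y) ≈-refl
    doubling : ∀ t h → t ℚ.* (fromℕ 2 ℚ.* h) ≡ t ℚ.* h ℚ.+ t ℚ.* h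
    doubling = Q.solve 2 (λ t h → t Q.:* (Q.con (fromℕ 2) Q.:* h) Q.:= t Q.:* h Q.:+ t Q.:* h) refl
      where module Q = ℚ.+-*-Solver
    halving : ∀ t h → t ℚ.* h ≡ t ℚ.* (fromℕ 2 ℚ.* (ℚ.½ ℚ.* h))
    halving = Q.solve 2 (λ t h → t Q.:* h Q.:= t Q.:* (Q.con (fromℕ 2) Q.:* (Q.con ℚ.½ Q.:* h))) refl
      where module Q = ℚ.+-*-Solver

  module Pointwise (x : ℝ) (-T<x : - T < x) (x<T : x < T) (x∈? : Decides series x) where

    -- ¬ (right ≤ x) instead of x < right: if x is not in the right half of the interval, it does not
    -- follow constructively that x < mid, only that ¬ (mid ≤ x).
    record Located (n j : ℕ) : Set where
      field
        j<2^n  : j ℕ.< 2^ n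
        left≤x : pos n j ≤ x
        right≰x : ¬ (pos n (suc j) ≤ x)
        sum≈   : partialSum (terms series x x∈?) (suc n) ≈ f (pos n j)

    open Located

    present : ∀ {Q : Set} (d : Dec Q) → Q → ∀ c → c * χ d ≈ c
    present (yes _) _ c = *-identityʳ c
    present (no ¬q) q c = contradiction q ¬q

    absent : ∀ {Q : Set} (d : Dec Q) → ¬ Q → ∀ c → c * χ d ≈ 0ℝ
    absent (yes q) ¬q c = contradiction q ¬q
    absent (no _)  ¬q c = solve 1 (λ c → c :* con ℚ.0ℚ := con ℚ.0ℚ) ≈-refl c
      where open ℝ-Solver

    locate-first : Located 0 0
    locate-first = go (x∈? 0 zero)
      where
      left≤ : pos 0 0 ≤ x
      left≤ = ≤-trans (≈⇒≤ (pos-first 0)) (<⇒≤ -T<x)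
      right≰ : ¬ (pos 0 1 ≤ x)
      right≰ 1≤x = <⇒≱ x<T (≤-trans (≈⇒≤ (≈-sym (pos-last 0))) 1≤x)
      go : Dec (x ∈ brick 0 zero) → Located 0 0
      -- The first brick covers all of [-T , T), so a negative decision is contradictory.
      go (no x∉) = contradiction (≮⇒≥ λ x<right → x∉ (left≤ , x<right)) right≰
      go (yes x∈) = record
        { j<2^n = ℕ.≤-refl ; left≤x = left≤ ; right≰x = right≰
        ; sum≈ = ≈-trans (+-congˡ (+-congʳ (present (x∈? 0 zero) x∈ (f (pos 0 0)))))
            (solve 1 (λ c → con ℚ.0ℚ :+ (c :+ con ℚ.0ℚ) := c) ≈-refl (f (pos 0 0))) }
        where open ℝ-Solver

    -- The other bricks of the block lie over intervals on which x is not located and cannot contain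
    -- it. The decision for brick k therefore selects the half to continue with and fixes the
    -- contribution of the whole block: one jump or nothing.
    locate-next : ∀ n k → Located n (toℕ k) → ∃[ j ] Located (suc n) j
    locate-next n k loc = go (x∈? (suc n) k)
      where
      J = toℕ k

      refine : pos (suc n) (J ℕ.+ J) ≡ pos n J
      refine = cong (λ p → T * fromℚ p) (node-refine n J)

      refine-suc : ∀ j → pos (suc n) (suc (suc (j ℕ.+ j))) ≡ pos n (suc j)
      refine-suc j = cong (λ p → T * fromℚ p) (node-refine-suc n j)

      elsewhere : ∀ i → i ≢ k → ¬ (x ∈ brick (suc n) i)
      elsewhere i i≢k (mid≤x , x<right) with ℕ.<-cmp (toℕ i) J
      ... | tri< i<J _ _ = <⇒≱ x<right (≤-trans
              (subst (_≤ pos n J) (sym (refine-suc (toℕ i))) (pos-mono n i<J)) (left≤x loc))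
      ... | tri≈ _ i≡J _ = i≢k (Fin.toℕ-injective i≡J)
      ... | tri> _ _ J<i = right≰x loc (≤-trans (subst (_≤ pos (suc n) (toℕ i ℕ.+ toℕ i)) (refine-suc J)
              (pos-mono (suc n) (double-suc≤ J<i))) (≤-trans (pos-mono (suc n) (ℕ.n≤1+n (toℕ i ℕ.+ toℕ i))) mid≤x))

      block : terms series x x∈? (suc n) ≈ jump n J * χ (x∈? (suc n) k)
      block = sum-single (λ i → jump n (toℕ i) * χ (x∈? (suc n) i)) k
        (λ i i≢k → absent (x∈? (suc n) i) (elsewhere i i≢k) (jump n (toℕ i)))

      previous : partialSum (terms series x x∈?) (suc n) ≈ f (pos (suc n) (J ℕ.+ J))
      previous = subst (λ p → partialSum (terms series x x∈?) (suc n) ≈ f p) (sym refine) (sum≈ loc)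

      go : Dec (x ∈ brick (suc n) k) → ∃[ j ] Located (suc n) j
      go (yes x∈) = suc (J ℕ.+ J) , record
        { j<2^n = double-suc≤ (j<2^n loc) ; left≤x = proj₁ x∈ ; right≰x = <⇒≱ (proj₂ x∈)
        ; sum≈ = ≈-trans (+-cong previous (≈-trans block (present (x∈? (suc n) k) x∈ (jump n J))))
            (solve 2 (λ a b → a :+ (b :- a) := b) ≈-refl (f (pos (suc n) (J ℕ.+ J))) (f (pos (suc n) (suc (J ℕ.+ J))))) }
        where open ℝ-Solver
      go (no x∉) = J ℕ.+ J , record
        { j<2^n = ℕ.≤-trans (ℕ.n≤1+n _) (double-suc≤ (j<2^n loc))
        ; left≤x = subst (_≤ x) (sym refine) (left≤x loc)
        ; right≰x = λ mid≤x → right≰x loc (subst (_≤ x) (refine-suc J) (≮⇒≥ λ x<right → x∉ (mid≤x , x<right)))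
        ; sum≈ = ≈-trans (+-cong previous (≈-trans block (absent (x∈? (suc n) k) x∉ (jump n J))))
            (+-identityʳ (f (pos (suc n) (J ℕ.+ J)))) }

    locate : ∀ n → ∃[ j ] Located n j
    locate zero    = 0 , locate-first
    locate (suc n) =
      let (j , loc) = locate n
      in locate-next n (fromℕ< (j<2^n loc)) (subst (Located n) (sym (Fin.toℕ-fromℕ< (j<2^n loc))) loc)

    ∣x∣≤T : ∣ x ∣ ≤ T
    ∣x∣≤T = ∣∣-lub (<⇒≤ x<T) (≤-trans (neg-anti-≤ (<⇒≤ -T<x)) (≈⇒≤ (solve 1 (λ T → :- (:- T) := T) ≈-refl T)))
      where open ℝ-Solver

    near : ∀ n → ∣ partialSum (terms series x x∈?) (suc n) - f x ∣ ≤ fromℚ (fromℕ (K ℕ.* (τ ℕ.* 2)) ℚ.* ½^ n)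
    near n = begin
      ∣ partialSum (terms series x x∈?) (suc n) - f x ∣
        ≈⟨ ∣∣-cong (+-congʳ (sum≈ loc)) ⟩
      ∣ f (pos n j) - f x ∣
        ≤⟨ lipschitz (pos n j) x (∣pos∣≤T n (ℕ.<⇒≤ (j<2^n loc))) ∣x∣≤T ⟩
      ⌜ K ⌝ * ∣ pos n j - x ∣
        ≤⟨ *-monoˡ-≤ 0≤⌜ K ⌝ (≤-trans (≈⇒≤ (≈-trans (∣x-y∣≈∣y-x∣ (pos n j) x) (0≤x⇒∣x∣≈x (x≤y⇒0≤y-x (left≤x loc)))))
             -- Only the negation of right ≤ x is known; it refutes right < x, and that is enough
             -- for x ≤ right.
             (+-monoˡ-≤ (- pos n j) (≮⇒≥ λ right<x → right≰x loc (<⇒≤ right<x)))) ⟩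
      ⌜ K ⌝ * (pos n (suc j) - pos n j)
        ≈⟨ *-congˡ (pos-step n j) ⟩
      ⌜ K ⌝ * (T * fromℚ (fromℕ 2 ℚ.* ½^ n))
        ≤⟨ *-monoˡ-≤ 0≤⌜ K ⌝ (*-monoʳ-≤ (fromℚ-mono (0≤* (0≤fromℕ 2) (0≤½^ n))) T≤τ) ⟩
      ⌜ K ⌝ * (⌜ τ ⌝ * fromℚ (fromℕ 2 ℚ.* ½^ n))
        ≈⟨ (pointwise⇒≈ λ _ → trans
             (solve 3 (λ k t h → k :* (t :* (con (fromℕ 2) :* h)) := k :* (t :* con (fromℕ 2)) :* h) refl (fromℕ K) (fromℕ τ) (½^ n))
             (cong (ℚ._* ½^ n) (trans (cong (fromℕ K ℚ.*_) (fromℕ-* τ 2)) (fromℕ-* K (τ ℕ.* 2))))) ⟩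
      fromℚ (fromℕ (K ℕ.* (τ ℕ.* 2)) ℚ.* ½^ n) ∎
      where
      open ≤-Reasoning
      open ℚ.+-*-Solver
      j = proj₁ (locate n)
      loc = proj₂ (locate n)

    terms-hasSum : HasSum (terms series x x∈?) (f x)
    terms-hasSum ε 0<ε =
      let (N , small) = geometric-small (K ℕ.* (τ ℕ.* 2)) ε 0<ε
      in suc N , λ { (suc n) (ℕ.s≤s N≤n) → ≤-trans (near n) (fromℚ-mono (small n N≤n)) }

  isLebesgueIntegral : IsLebesgueIntegral f (- T) T integral
  isLebesgueIntegral = series , absolutely-summable , integral-hasSum ,
    λ x -T<x x<T x∈? _ → Pointwise.terms-hasSum x -T<x x<T x∈?

  integral≥ : ∀ {v} → (∀ n → v ≤ riemannSum (suc n)) → v ≤ integral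
  -- The partial sum of length n + 2 is the Riemann sum of level n + 1, and level 1 is the first to
  -- which the lower bound refers.
  integral≥ v≤ = converges-≥ integral-hasSum (2 , λ { (suc (suc n)) _ →
    ≤-trans (v≤ n) (≈⇒≤ (≈-sym (partialSum-integralTerms (suc n)))) ; (suc zero) (ℕ.s≤s ()) })

-- Lipschitz functions

module _ {T : ℝ} (0≤T : 0ℝ ≤ T) where

  IsLip : (ℝ → ℝ) → Set
  IsLip f = ∃[ K ] IsLipschitz T K f

  lip-bounded : ∀ f → IsLip f → ∃[ M ] (∀ t → ∣ t ∣ ≤ T → ∣ f t ∣ ≤ ⌜ M ⌝)
  lip-bounded f (K , lip) = K ℕ.* τ ℕ.+ M₀ , λ t t≤T → begin
    ∣ f t ∣
      ≈⟨ ∣∣-cong (solve 2 (λ x y → x := (x :- y) :+ y) ≈-refl (f t) (f 0ℝ)) ⟩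
    ∣ f t - f 0ℝ + f 0ℝ ∣
      ≤⟨ ∣x+y∣≤∣x∣+∣y∣ (f t - f 0ℝ) (f 0ℝ) ⟩
    ∣ f t - f 0ℝ ∣ + ∣ f 0ℝ ∣
      ≤⟨ +-mono-≤ (lip t 0ℝ t≤T (≤-trans (≈⇒≤ (0≤x⇒∣x∣≈x ≤-refl)) 0≤T)) (proj₂ (∃rationalBound (f 0ℝ))) ⟩
    ⌜ K ⌝ * ∣ t - 0ℝ ∣ + ⌜ M₀ ⌝
      ≈⟨ +-congʳ (*-congˡ (∣∣-cong (solve 1 (λ t → t :- con ℚ.0ℚ := t) ≈-refl t))) ⟩
    ⌜ K ⌝ * ∣ t ∣ + ⌜ M₀ ⌝
      ≤⟨ +-monoˡ-≤ ⌜ M₀ ⌝ (*-monoˡ-≤ 0≤⌜ K ⌝ (≤-trans t≤T (≤-trans (x≤∣x∣ T) (proj₂ (∃rationalBound T))))) ⟩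
    ⌜ K ⌝ * ⌜ τ ⌝ + ⌜ M₀ ⌝
      ≈⟨ +-congʳ (⌜*⌝ K τ) ⟨
    ⌜ K ℕ.* τ ⌝ + ⌜ M₀ ⌝
      ≈⟨ ⌜+⌝ (K ℕ.* τ) M₀ ⟨
    ⌜ K ℕ.* τ ℕ.+ M₀ ⌝ ∎
    where
    open ≤-Reasoning
    open ℝ-Solver
    τ M₀ : ℕ
    τ  = proj₁ (∃rationalBound T)
    M₀ = proj₁ (∃rationalBound (f 0ℝ))

  lip-const : ∀ c → IsLip (λ _ → c)
  lip-const c = 0 , λ s t _ _ → ≈⇒≤ (≈-trans (x≈y⇒∣x-y∣≈0 ≈-refl) (solve 1 (λ d → con ℚ.0ℚ := con ℚ.0ℚ :* d) ≈-refl ∣ s - t ∣))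
    where open ℝ-Solver

  lip-+ : ∀ f g → IsLip f → IsLip g → IsLip (λ t → f t + g t)
  lip-+ f g (K , lip) (L , lip′) = K ℕ.+ L , λ s t s≤T t≤T → begin
    ∣ f s + g s - (f t + g t) ∣
      ≈⟨ ∣∣-cong (solve 4 (λ a b c d → a :+ b :- (c :+ d) := (a :- c) :+ (b :- d)) ≈-refl (f s) (g s) (f t) (g t)) ⟩
    ∣ (f s - f t) + (g s - g t) ∣
      ≤⟨ ∣x+y∣≤∣x∣+∣y∣ (f s - f t) (g s - g t) ⟩
    ∣ f s - f t ∣ + ∣ g s - g t ∣
      ≤⟨ +-mono-≤ (lip s t s≤T t≤T) (lip′ s t s≤T t≤T) ⟩
    ⌜ K ⌝ * ∣ s - t ∣ + ⌜ L ⌝ * ∣ s - t ∣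
      ≈⟨ distribʳ ∣ s - t ∣ ⌜ K ⌝ ⌜ L ⌝ ⟨
    (⌜ K ⌝ + ⌜ L ⌝) * ∣ s - t ∣
      ≈⟨ *-congʳ (⌜+⌝ K L) ⟨
    ⌜ K ℕ.+ L ⌝ * ∣ s - t ∣ ∎
    where
    open ≤-Reasoning
    open ℝ-Solver

  lip-* : ∀ f g → IsLip f → IsLip g → IsLip (λ t → f t * g t)
  lip-* f g lf@(K , lip) lg@(L , lip′) = M ℕ.* L ℕ.+ K ℕ.* N , λ s t s≤T t≤T → begin
    ∣ f s * g s - f t * g t ∣
      ≈⟨ ∣∣-cong (solve 4 (λ a b c d → a :* b :- c :* d := a :* (b :- d) :+ (a :- c) :* d) ≈-refl (f s) (g s) (f t) (g t)) ⟩
    ∣ f s * (g s - g t) + (f s - f t) * g t ∣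
      ≤⟨ ∣x+y∣≤∣x∣+∣y∣ (f s * (g s - g t)) ((f s - f t) * g t) ⟩
    ∣ f s * (g s - g t) ∣ + ∣ (f s - f t) * g t ∣
      ≈⟨ +-cong (∣x*y∣≈∣x∣*∣y∣ (f s) (g s - g t)) (∣x*y∣≈∣x∣*∣y∣ (f s - f t) (g t)) ⟩
    ∣ f s ∣ * ∣ g s - g t ∣ + ∣ f s - f t ∣ * ∣ g t ∣
      ≤⟨ +-mono-≤ (*-mono-≤ (0≤∣x∣ (g s - g t)) 0≤⌜ M ⌝ (proj₂ (lip-bounded f lf) s s≤T) (lip′ s t s≤T t≤T))
                  (*-mono-≤ (0≤∣x∣ (g t)) (*-nonNeg 0≤⌜ K ⌝ (0≤∣x∣ (s - t))) (lip s t s≤T t≤T) (proj₂ (lip-bounded g lg) t t≤T)) ⟩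
    ⌜ M ⌝ * (⌜ L ⌝ * ∣ s - t ∣) + ⌜ K ⌝ * ∣ s - t ∣ * ⌜ N ⌝
      ≈⟨ solve 5 (λ m l k n d → m :* (l :* d) :+ k :* d :* n := (m :* l :+ k :* n) :* d) ≈-refl ⌜ M ⌝ ⌜ L ⌝ ⌜ K ⌝ ⌜ N ⌝ ∣ s - t ∣ ⟩
    (⌜ M ⌝ * ⌜ L ⌝ + ⌜ K ⌝ * ⌜ N ⌝) * ∣ s - t ∣
      ≈⟨ *-congʳ (≈-trans (⌜+⌝ (M ℕ.* L) (K ℕ.* N)) (+-cong (⌜*⌝ M L) (⌜*⌝ K N))) ⟨
    ⌜ M ℕ.* L ℕ.+ K ℕ.* N ⌝ * ∣ s - t ∣ ∎
    where
    open ≤-Reasoning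
    open ℝ-Solver
    M N : ℕ
    M = proj₁ (lip-bounded f lf)
    N = proj₁ (lip-bounded g lg)

  lip-sum : ∀ {n} (u : Fin n → ℝ → ℝ) → (∀ i → IsLip (u i)) → IsLip (λ t → sum (λ i → u i t))
  lip-sum {zero}  u lip = lip-const 0ℝ
  lip-sum {suc n} u lip = lip-+ (u zero) (λ t → sum (λ i → u (suc i) t)) (lip zero) (lip-sum (u ∘ suc) (lip ∘ suc))

  lip-^ : ∀ f → IsLip f → ∀ q → IsLip (λ t → f t ^ q)
  lip-^ f lip zero    = lip-const 1ℝ
  lip-^ f lip (suc q) = lip-* f (λ t → f t ^ q) lip (lip-^ f lip q)

  -- For `cos` and `sin` a Lipschitz constant is available on each bounded interval, growing with
  -- it. When |t| ≤ T the argument t φ stays in one such interval, with B a natural bound for T |φ|.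
  lip-compose : ∀ (h : ℝ → ℝ) (K : ℕ → ℕ) →
    (∀ B {s t} → ∣ s ∣ ≤ ⌜ B ⌝ → ∣ t ∣ ≤ ⌜ B ⌝ → ∣ h s - h t ∣ ≤ ⌜ K B ⌝ * ∣ s - t ∣) →
    ∀ φ → IsLip (λ t → h (t * φ))
  lip-compose h K lip φ = K B ℕ.* ψ , λ s t s≤T t≤T → begin
    ∣ h (s * φ) - h (t * φ) ∣
      ≤⟨ lip B (bound s s≤T) (bound t t≤T) ⟩
    ⌜ K B ⌝ * ∣ s * φ - t * φ ∣
      ≈⟨ *-congˡ (≈-trans (∣∣-cong (solve 3 (λ s t φ → s :* φ :- t :* φ := φ :* (s :- t)) ≈-refl s t φ)) (∣x*y∣≈∣x∣*∣y∣ φ (s - t))) ⟩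
    ⌜ K B ⌝ * (∣ φ ∣ * ∣ s - t ∣)
      ≤⟨ *-monoˡ-≤ 0≤⌜ K B ⌝ (*-monoʳ-≤ (0≤∣x∣ (s - t)) (proj₂ (∃rationalBound φ))) ⟩
    ⌜ K B ⌝ * (⌜ ψ ⌝ * ∣ s - t ∣)
      ≈⟨ *-assoc ⌜ K B ⌝ ⌜ ψ ⌝ ∣ s - t ∣ ⟨
    ⌜ K B ⌝ * ⌜ ψ ⌝ * ∣ s - t ∣
      ≈⟨ *-congʳ (⌜*⌝ (K B) ψ) ⟨
    ⌜ K B ℕ.* ψ ⌝ * ∣ s - t ∣ ∎
    where
    open ≤-Reasoning
    open ℝ-Solver
    τ ψ B : ℕ
    τ = proj₁ (∃rationalBound T)
    ψ = proj₁ (∃rationalBound φ)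
    B = τ ℕ.* ψ
    bound : ∀ t → ∣ t ∣ ≤ T → ∣ t * φ ∣ ≤ ⌜ B ⌝
    bound t t≤T = ≤-trans (≈⇒≤ (∣x*y∣≈∣x∣*∣y∣ t φ)) (≤-trans
      (*-mono-≤ (0≤∣x∣ φ) 0≤⌜ τ ⌝ (≤-trans t≤T (≤-trans (x≤∣x∣ T) (proj₂ (∃rationalBound T)))) (proj₂ (∃rationalBound φ)))
      (≈⇒≤ (≈-sym (⌜*⌝ τ ψ))))

-- Exponential sums

re-sumᶜ : ∀ {n} (z : Vector ℂ n) → re (sumᶜ z) ≡ sum (re ∘ z)
re-sumᶜ {zero}  z = refl
re-sumᶜ {suc n} z = cong (λ x → re (z zero) + x) (re-sumᶜ (z ∘ suc))

im-sumᶜ : ∀ {n} (z : Vector ℂ n) → im (sumᶜ z) ≡ sum (im ∘ z)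
im-sumᶜ {zero}  z = refl
im-sumᶜ {suc n} z = cong (λ x → im (z zero) + x) (im-sumᶜ (z ∘ suc))

open Algebra.Properties.CommutativeSemiring.Exp (CommutativeRing.commutativeSemiring ℝ-commutativeRing)
  using (^-congˡ; ^-assocʳ; ^-distrib-*)

-- The even exponent removes the square root of the modulus, which brings the integrand within reach
-- of the closure properties of Lipschitz functions.
∣z∣^2q≈ : ∀ z {x y} → re z ≈ x → im z ≈ y → ∀ q → ∣ z ∣ᶜ ^ (2 ℕ.* q) ≈ (x * x + y * y) ^ q
∣z∣^2q≈ z {x} {y} re≈ im≈ q = begin-equality
  (√ m) ^ (2 ℕ.* q)
    ≈⟨ ^-assocʳ (√ m) 2 q ⟨
  ((√ m) ^ 2) ^ q
    ≈⟨ ^-congˡ q (≈-trans (*-congˡ (*-identityʳ (√ m))) (≈-trans (√-square (+-nonNeg (0≤x² (re z)) (0≤x² (im z)))) m≈)) ⟩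
  (x * x + y * y) ^ q ∎
  where
  open ≤-Reasoning
  m = re z * re z + im z * im z
  m≈ : m ≈ x * x + y * y
  m≈ = +-cong (*-cong re≈ re≈) (*-cong im≈ im≈)

module ExponentialSum {N : ℕ} (φ a : Vector ℝ N) where

  -- `U` and `V` are the real and imaginary parts of f, and `G` is |f|².
  U V G : ℝ → ℝ
  U t = sum (λ n → a n * cos (t * φ n))
  V t = sum (λ n → a n * sin (t * φ n))
  G t = U t * U t + V t * V t

  0≤G : ∀ t → 0ℝ ≤ G t
  0≤G t = +-nonNeg (0≤x² (U t)) (0≤x² (V t))

  U-cong : ∀ {s t} → s ≈ t → U s ≈ U t
  U-cong {s} {t} s≈t = sum-cong {N} {λ n → a n * cos (s * φ n)} {λ n → a n * cos (t * φ n)} λ n → *-congˡ (cos-cong (*-congʳ s≈t))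

  V-cong : ∀ {s t} → s ≈ t → V s ≈ V t
  V-cong {s} {t} s≈t = sum-cong {N} {λ n → a n * sin (s * φ n)} {λ n → a n * sin (t * φ n)} λ n → *-congˡ (sin-cong (*-congʳ s≈t))

  G-cong : ∀ {s t} → s ≈ t → G s ≈ G t
  G-cong s≈t = +-cong (*-cong (U-cong s≈t) (U-cong s≈t)) (*-cong (V-cong s≈t) (V-cong s≈t))

  ∣∑∣^2q≈G^q : ∀ q t → ∣ sumᶜ (λ n → a n · exp ((t * φ n) · 𝕚)) ∣ᶜ ^ (2 ℕ.* q) ≈ G t ^ q
  ∣∑∣^2q≈G^q q t = ∣z∣^2q≈ (sumᶜ z)
    (≡-≈ (re-sumᶜ z) (sum-cong {N} {re ∘ z} {λ n → a n * cos (t * φ n)} λ n → *-congˡ (proj₁ (cis≈cos+isin (t * φ n)))))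
    (≡-≈ (im-sumᶜ z) (sum-cong {N} {im ∘ z} {λ n → a n * sin (t * φ n)} λ n → *-congˡ (proj₂ (cis≈cos+isin (t * φ n))))) q
    where
    z : Vector ℂ N
    z n = a n · exp ((t * φ n) · 𝕚)
    ≡-≈ : ∀ {x y w} → x ≡ y → y ≈ w → x ≈ w
    ≡-≈ refl y≈w = y≈w

  G-lipschitz : ∀ {T} (0≤T : 0ℝ ≤ T) → IsLip 0≤T G
  G-lipschitz 0≤T =
    lip-+ 0≤T (λ t → U t * U t) (λ t → V t * V t) (lip-* 0≤T U U U-lip U-lip) (lip-* 0≤T V V V-lip V-lip)
    where
    U-lip : IsLip 0≤T U
    U-lip = lip-sum 0≤T (λ n t → a n * cos (t * φ n)) λ n →
      lip-* 0≤T (λ _ → a n) (λ t → cos (t * φ n)) (lip-const 0≤T (a n)) (lip-compose 0≤T cos _ cos-lipschitz (φ n))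
    V-lip : IsLip 0≤T V
    V-lip = lip-sum 0≤T (λ n t → a n * sin (t * φ n)) λ n →
      lip-* 0≤T (λ _ → a n) (λ t → sin (t * φ n)) (lip-const 0≤T (a n)) (lip-compose 0≤T sin _ sin-lipschitz (φ n))

-- Convexity of powers and identities for the lower bound

^-nonNeg : ∀ {x} → 0ℝ ≤ x → ∀ n → 0ℝ ≤ x ^ n
^-nonNeg 0≤x zero    = fromℚ-mono 0≤1
^-nonNeg 0≤x (suc n) = *-nonNeg 0≤x (^-nonNeg 0≤x n)

-- Convexity of the power function without calculus. In the induction step, (p + 1) s^p (x - s)² ≥ 0
-- is added; what results is x times the left side of the induction hypothesis plus terms free of
-- higher powers of x.
tangent≤power : ∀ p {x s} → 0ℝ ≤ x → 0ℝ ≤ s → ⌜ suc p ⌝ * s ^ p * x ≤ x ^ suc p + ⌜ p ⌝ * s ^ suc p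
tangent≤power zero {x} {s} _ _ = ≈⇒≤ (solve 2 (λ x s → con ℚ.1ℚ :* con ℚ.1ℚ :* x := x :* con ℚ.1ℚ :+ con ℚ.0ℚ :* (s :* con ℚ.1ℚ)) ≈-refl x s)
  where open ℝ-Solver
tangent≤power (suc p) {x} {s} 0≤x 0≤s = begin
  ⌜ suc (suc p) ⌝ * (s * sᵖ) * x
    ≈⟨ *-congʳ (*-congʳ (⌜suc⌝ (suc p))) ⟩
  (1ℝ + ⌜ suc p ⌝) * (s * sᵖ) * x
    ≈⟨ +-identityʳ ((1ℝ + ⌜ suc p ⌝) * (s * sᵖ) * x) ⟨
  (1ℝ + ⌜ suc p ⌝) * (s * sᵖ) * x + 0ℝ
    ≤⟨ +-monoʳ-≤ ((1ℝ + ⌜ suc p ⌝) * (s * sᵖ) * x) (*-nonNeg (*-nonNeg 0≤⌜ suc p ⌝ (^-nonNeg 0≤s p)) (0≤x² (x - s))) ⟩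
  (1ℝ + ⌜ suc p ⌝) * (s * sᵖ) * x + ⌜ suc p ⌝ * sᵖ * ((x - s) * (x - s))
    ≈⟨ +-cong (*-congʳ (*-congʳ (+-congˡ (⌜suc⌝ p)))) (*-congʳ (*-congʳ (⌜suc⌝ p))) ⟩
  (1ℝ + (1ℝ + ⌜ p ⌝)) * (s * sᵖ) * x + (1ℝ + ⌜ p ⌝) * sᵖ * ((x - s) * (x - s))
    ≈⟨ solve 4 (λ k t s x → (con ℚ.1ℚ :+ (con ℚ.1ℚ :+ k)) :* (s :* t) :* x :+ (con ℚ.1ℚ :+ k) :* t :* ((x :- s) :* (x :- s))
         := x :* ((con ℚ.1ℚ :+ k) :* t :* x) :+ ((con ℚ.1ℚ :+ k) :* (s :* (s :* t)) :- k :* (s :* t) :* x)) ≈-refl ⌜ p ⌝ sᵖ s x ⟩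
  x * ((1ℝ + ⌜ p ⌝) * sᵖ * x) + ((1ℝ + ⌜ p ⌝) * (s * (s * sᵖ)) - ⌜ p ⌝ * (s * sᵖ) * x)
    ≈⟨ +-cong (*-congˡ (*-congʳ (*-congʳ (⌜suc⌝ p)))) (+-congʳ (*-congʳ (⌜suc⌝ p))) ⟨
  x * (⌜ suc p ⌝ * sᵖ * x) + (⌜ suc p ⌝ * (s * (s * sᵖ)) - ⌜ p ⌝ * (s * sᵖ) * x)
    ≤⟨ +-monoˡ-≤ (⌜ suc p ⌝ * (s * (s * sᵖ)) - ⌜ p ⌝ * (s * sᵖ) * x) (*-monoˡ-≤ 0≤x (tangent≤power p 0≤x 0≤s)) ⟩
  x * (x * x ^ p + ⌜ p ⌝ * (s * sᵖ)) + (⌜ suc p ⌝ * (s * (s * sᵖ)) - ⌜ p ⌝ * (s * sᵖ) * x)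
    ≈⟨ solve 5 (λ k k′ t x y → x :* (y :+ k :* t) :+ (k′ :- k :* t :* x) := x :* y :+ k′) ≈-refl
         ⌜ p ⌝ (⌜ suc p ⌝ * (s * (s * sᵖ))) (s * sᵖ) x (x * x ^ p) ⟩
  x * (x * x ^ p) + ⌜ suc p ⌝ * (s * (s * sᵖ)) ∎
  where
  open ≤-Reasoning
  open ℝ-Solver
  sᵖ : ℝ
  sᵖ = s ^ p

-- With z j = u j + i v j the summand is α Re (z j · conj (z l)), and the double sum is α |∑ z j|².
-- It serves twice: over frequencies, and over sample points.
sum-quadratic : ∀ {n} α (u v : Vector ℝ n) →
  sum (λ j → sum λ l → α * (u j * u l + v j * v l)) ≈ α * (sum u * sum u + sum v * sum v)
sum-quadratic {n} α u v = begin-equality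
  sum (λ j → sum λ l → α * (u j * u l + v j * v l))
    ≈⟨ sum-cong {n} {λ j → sum λ l → α * (u j * u l + v j * v l)} {λ j → α * (sum (λ l → u j * u l) + sum (λ l → v j * v l))} (λ j →
         ≈-trans (≈-sym (sum-*ˡ α (λ l → u j * u l + v j * v l))) (*-congˡ (sum-+ (λ l → u j * u l) (λ l → v j * v l)))) ⟩
  sum (λ j → α * (sum (λ l → u j * u l) + sum (λ l → v j * v l)))
    ≈⟨ sum-*ˡ α (λ j → sum (λ l → u j * u l) + sum (λ l → v j * v l)) ⟨
  α * sum (λ j → sum (λ l → u j * u l) + sum (λ l → v j * v l))
    ≈⟨ *-congˡ (sum-+ (λ j → sum (λ l → u j * u l)) (λ j → sum (λ l → v j * v l))) ⟩
  α * (sum (λ j → sum (λ l → u j * u l)) + sum (λ j → sum (λ l → v j * v l)))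
    ≈⟨ *-congˡ (+-cong (sum*sum u u) (sum*sum v v)) ⟨
  α * (sum u * sum u + sum v * sum v) ∎
  where open ≤-Reasoning

-- Level m + 1 divides [-1 , 1] with mesh 2^-m and has its node 0 at index 2^m, so the difference (j
-- - l) / 2^m sits at index 2^m - l + j.
node-shift : ∀ m j l d → l ℕ.+ d ≡ 2^ m → node (suc m) (d ℕ.+ j) ≡ fromℕ j ℚ.* ½^ m ℚ.- fromℕ l ℚ.* ½^ m
node-shift m j l d l+d≡2^m = begin
  node (suc m) (d ℕ.+ j)
    ≡⟨ node-def (suc m) (d ℕ.+ j) ⟩
  fromℕ (d ℕ.+ j) ℚ.* (fromℕ 2 ℚ.* (ℚ.½ ℚ.* ½^ m)) ℚ.- ℚ.1ℚ
    ≡⟨ cong₂ (λ x y → x ℚ.* (fromℕ 2 ℚ.* (ℚ.½ ℚ.* ½^ m)) ℚ.- y) (sym (fromℤ-+ (+ d) (+ j)))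
         (trans (sym (2^*½^ m)) (cong (ℚ._* ½^ m) (trans (cong fromℕ (sym l+d≡2^m)) (sym (fromℤ-+ (+ l) (+ d)))))) ⟩
  (fromℕ d ℚ.+ fromℕ j) ℚ.* (fromℕ 2 ℚ.* (ℚ.½ ℚ.* ½^ m)) ℚ.- (fromℕ l ℚ.+ fromℕ d) ℚ.* ½^ m
    ≡⟨ solve 4 (λ d j l h → (d :+ j) :* (con (fromℕ 2) :* (con ℚ.½ :* h)) :- (l :+ d) :* h := j :* h :- l :* h) refl
         (fromℕ d) (fromℕ j) (fromℕ l) (½^ m) ⟩
  fromℕ j ℚ.* ½^ m ℚ.- fromℕ l ℚ.* ½^ m ∎
  where
  open ≡-Reasoning
  open ℚ.+-*-Solver

-- Positive definiteness and the lower bound for Riemann sums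

module _ {N : ℕ} (φ a : Vector ℝ N) (0≤a : ∀ n → 0ℝ ≤ a n) where

  open ExponentialSum φ a

  private
    κ σ : Fin N → ℝ → ℝ
    κ n t = cos (t * φ n)
    σ n t = sin (t * φ n)

    -- The real and imaginary parts of e^{it(φ m - φ n)}.
    A D : Fin N → Fin N → ℝ → ℝ
    A m n t = κ m t * κ n t + σ m t * σ n t
    D m n t = σ m t * κ n t - κ m t * σ n t

    -- Equal to a m a n cos ((s - t) (φ m - φ n)), the contribution of the pair (m , n) to |f (s -
    -- t)|². It is kept as an inner product of a vector at s with one at t, so that summing over
    -- both points produces squares.
    X : Fin N → Fin N → ℝ → ℝ → ℝ
    X m n s t = a m * a n * (A m n s * A m n t + D m n s * D m n t)

  G-minus : ∀ s t → G (s - t) ≈ sum (λ m → sum λ n → X m n s t)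
  G-minus s t = begin-equality
    U (s - t) * U (s - t) + V (s - t) * V (s - t)
      ≈⟨ +-cong (*-cong U≈ U≈) (*-cong V≈ V≈) ⟩
    sum u * sum u + sum v * sum v
      ≈⟨ *-identityˡ (sum u * sum u + sum v * sum v) ⟨
    1ℝ * (sum u * sum u + sum v * sum v)
      ≈⟨ sum-quadratic 1ℝ u v ⟨
    sum (λ m → sum λ n → 1ℝ * (u m * u n + v m * v n))
      ≈⟨ sum-cong {N} {λ m → sum λ n → 1ℝ * (u m * u n + v m * v n)} {λ m → sum λ n → X m n s t} (λ m →
           sum-cong {N} {λ n → 1ℝ * (u m * u n + v m * v n)} {λ n → X m n s t} λ n →
             expand (a m) (a n) (κ m s) (κ m t) (κ n s) (κ n t) (σ m s) (σ m t) (σ n s) (σ n t)) ⟩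
    sum (λ m → sum λ n → X m n s t) ∎
    where
    open ≤-Reasoning
    u v : Vector ℝ N
    u n = a n * (κ n s * κ n t + σ n s * σ n t)
    v n = a n * (σ n s * κ n t - κ n s * σ n t)
    split : ∀ n → (s - t) * φ n ≈ s * φ n - t * φ n
    split n = solve 3 (λ s t φ → (s :- t) :* φ := s :* φ :- t :* φ) ≈-refl s t (φ n)
      where open ℝ-Solver
    U≈ : U (s - t) ≈ sum u
    U≈ = sum-cong {N} {λ n → a n * cos ((s - t) * φ n)} {u} λ n →
      *-congˡ (≈-trans (cos-cong (split n)) (cos-minus (s * φ n) (t * φ n)))
    V≈ : V (s - t) ≈ sum v
    V≈ = sum-cong {N} {λ n → a n * sin ((s - t) * φ n)} {v} λ n →
      *-congˡ (≈-trans (sin-cong (split n)) (sin-minus (s * φ n) (t * φ n)))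
    -- The left side pairs the factors by frequency, as in |f (s - t)|², and the right side by
    -- point, as in `X`; both are the same polynomial.
    expand : ∀ a b c c′ d d′ e e′ f f′ →
      1ℝ * (a * (c * c′ + e * e′) * (b * (d * d′ + f * f′)) + a * (e * c′ - c * e′) * (b * (f * d′ - d * f′)))
      ≈ a * b * ((c * d + e * f) * (c′ * d′ + e′ * f′) + (e * d - c * f) * (e′ * d′ - c′ * f′))
    expand = solve 10 (λ a b c c′ d d′ e e′ f f′ →
      con ℚ.1ℚ :* (a :* (c :* c′ :+ e :* e′) :* (b :* (d :* d′ :+ f :* f′)) :+ a :* (e :* c′ :- c :* e′) :* (b :* (f :* d′ :- d :* f′)))
      := a :* b :* ((c :* d :+ e :* f) :* (c′ :* d′ :+ e′ :* f′) :+ (e :* d :- c :* f) :* (e′ :* d′ :- c′ :* f′))) ≈-refl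
      where open ℝ-Solver

  ∑a² : ℝ
  ∑a² = sum (λ n → a n * a n)

  -- Each frequency pair contributes a m a n |∑ⱼ e^{i tⱼ (φ m - φ n)}|² ≥ 0; keep only m = n.
  ∑∑G≥ : ∀ {L} (t : Vector ℝ L) → ⌜ L ⌝ * ⌜ L ⌝ * ∑a² ≤ sum (λ j → sum λ l → G (t j - t l))
  ∑∑G≥ {L} t = begin
    ⌜ L ⌝ * ⌜ L ⌝ * ∑a²
      ≈⟨ sum-*ˡ (⌜ L ⌝ * ⌜ L ⌝) (λ n → a n * a n) ⟩
    sum (λ n → ⌜ L ⌝ * ⌜ L ⌝ * (a n * a n))
      ≤⟨ sum-mono {N} {λ n → ⌜ L ⌝ * ⌜ L ⌝ * (a n * a n)} {λ n → Y n n} diagonal ⟩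
    sum (λ n → Y n n)
      ≤⟨ diagonal≤ {N} {Y} 0≤Y ⟩
    sum (λ m → sum λ n → Y m n)
      ≈⟨ sum-cong {N} {λ m → sum λ n → sum λ j → sum λ l → X m n (t j) (t l)} {λ m → sum λ n → Y m n} (λ m →
           sum-cong {N} {λ n → sum λ j → sum λ l → X m n (t j) (t l)} {λ n → Y m n} λ n →
             sum-quadratic (a m * a n) (λ j → A m n (t j)) (λ j → D m n (t j))) ⟨
    sum (λ m → sum λ n → sum λ j → sum λ l → X m n (t j) (t l))
      ≈⟨ ∑∑-comm (λ j l m n → X m n (t j) (t l)) ⟨
    sum (λ j → sum λ l → sum λ m → sum λ n → X m n (t j) (t l))
      ≈⟨ sum-cong {L} {λ j → sum λ l → G (t j - t l)} {λ j → sum λ l → sum λ m → sum λ n → X m n (t j) (t l)} (λ j →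
           sum-cong {L} {λ l → G (t j - t l)} {λ l → sum λ m → sum λ n → X m n (t j) (t l)} λ l → G-minus (t j) (t l)) ⟨
    sum (λ j → sum λ l → G (t j - t l)) ∎
    where
    open ≤-Reasoning
    ∑A ∑D : Fin N → Fin N → ℝ
    ∑A m n = sum (λ j → A m n (t j))
    ∑D m n = sum (λ j → D m n (t j))
    Y : Fin N → Fin N → ℝ
    Y m n = a m * a n * (∑A m n * ∑A m n + ∑D m n * ∑D m n)
    0≤Y : ∀ m n → 0ℝ ≤ Y m n
    0≤Y m n = *-nonNeg (*-nonNeg (0≤a m) (0≤a n)) (+-nonNeg (0≤x² (∑A m n)) (0≤x² (∑D m n)))
    ∑A≈L : ∀ n → ∑A n n ≈ ⌜ L ⌝
    ∑A≈L n = ≈-trans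
      (sum-cong {L} {λ j → A n n (t j)} {λ _ → 1ℝ} λ j → cos²+sin²≈1 (t j * φ n))
      (≈-trans (sum-const L 1ℝ) (*-identityʳ ⌜ L ⌝))
    diagonal : ∀ n → ⌜ L ⌝ * ⌜ L ⌝ * (a n * a n) ≤ Y n n
    diagonal n = begin
      ⌜ L ⌝ * ⌜ L ⌝ * (a n * a n)            ≈⟨ *-comm (⌜ L ⌝ * ⌜ L ⌝) (a n * a n) ⟩
      a n * a n * (⌜ L ⌝ * ⌜ L ⌝)            ≈⟨ *-congˡ (*-cong (∑A≈L n) (∑A≈L n)) ⟨
      a n * a n * (∑A n n * ∑A n n)          ≈⟨ *-congˡ (+-identityʳ (∑A n n * ∑A n n)) ⟨
      a n * a n * (∑A n n * ∑A n n + 0ℝ)     ≤⟨ *-monoˡ-≤ (*-nonNeg (0≤a n) (0≤a n)) (+-monoʳ-≤ (∑A n n * ∑A n n) (0≤x² (∑D n n))) ⟩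
      Y n n                                  ∎

  module _ (T : ℝ) (0<T : 0ℝ < T) (p : ℕ) where

    private
      q : ℕ
      q = suc p

      lipschitz : IsLip (<⇒≤ 0<T) (λ t → G t ^ q)
      lipschitz = lip-^ (<⇒≤ 0<T) G (G-lipschitz (<⇒≤ 0<T)) q

    open LeftEndpoints (λ t → G t ^ q) T 0<T (proj₁ lipschitz) (proj₂ lipschitz)
      using (pos; riemannSum; integral≥; isLebesgueIntegral) renaming (integral to ∫F) public

    ∫F-isLebesgueIntegral : IsLebesgueIntegral (λ t → ∣ sumᶜ (λ n → a n · exp ((t * φ n) · 𝕚)) ∣ᶜ ^ (2 *ℕ q)) (- T) T ∫F
    ∫F-isLebesgueIntegral = isLebesgueIntegral-cong (λ t → ≈-sym (∣∑∣^2q≈G^q q t)) isLebesgueIntegral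

    -- For fixed l the sum over j runs through L consecutive nodes, from index L - l on, and G ≥ 0
    -- allows the other L nodes to be added. The L choices of l turn the bound L² ∑ a² into L ∑ a².
    -- As this is spread over 2 L nodes, s carries the factor ½.
    mean-square≥ : ∀ m → ⌜ 2^ m ⌝ * ∑a² ≤ partialSum (λ i → G (pos (suc m) i)) (2^ (suc m))
    mean-square≥ m = begin
      ⌜ L ⌝ * ∑a²
        ≈⟨ *-congʳ (*-identityˡ ⌜ L ⌝) ⟨
      1ℝ * ⌜ L ⌝ * ∑a²
        ≈⟨ *-congʳ (*-congʳ h*L≈1) ⟨
      h * ⌜ L ⌝ * ⌜ L ⌝ * ∑a²
        ≈⟨ solve 3 (λ h l s → h :* l :* l :* s := h :* (l :* l :* s)) ≈-refl h ⌜ L ⌝ ∑a² ⟩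
      h * (⌜ L ⌝ * ⌜ L ⌝ * ∑a²)
        ≤⟨ *-monoˡ-≤ 0≤h (∑∑G≥ t) ⟩
      h * sum (λ j → sum λ l → G (t j - t l))
        ≈⟨ *-congˡ (sum-comm (λ j l → G (t j - t l))) ⟩
      h * sum (λ l → sum λ j → G (t j - t l))
        ≤⟨ *-monoˡ-≤ 0≤h (sum-mono {L} {λ l → sum λ j → G (t j - t l)} {λ _ → W} window) ⟩
      h * sum {L} (λ _ → W)
        ≈⟨ *-congˡ (sum-const L W) ⟩
      h * (⌜ L ⌝ * W)
        ≈⟨ *-assoc h ⌜ L ⌝ W ⟨
      h * ⌜ L ⌝ * W
        ≈⟨ *-congʳ h*L≈1 ⟩
      1ℝ * W
        ≈⟨ *-identityˡ W ⟩
      W ∎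
      where
      open ≤-Reasoning
      open ℝ-Solver
      L : ℕ
      L = 2^ m
      h W : ℝ
      h = fromℚ (½^ m)
      W = partialSum (λ i → G (pos (suc m) i)) (2^ (suc m))
      0≤h : 0ℝ ≤ h
      0≤h = fromℚ-mono (0≤½^ m)
      h*L≈1 : h * ⌜ L ⌝ ≈ 1ℝ
      h*L≈1 = pointwise⇒≈ λ _ → trans (ℚ.*-comm (½^ m) (fromℕ L)) (2^*½^ m)
      t : Vector ℝ L
      t j = T * fromℚ (fromℕ (toℕ j) ℚ.* ½^ m)
      window : ∀ l → sum (λ j → G (t j - t l)) ≤ W
      window l = begin
        sum (λ j → G (t j - t l))
          ≈⟨ sum-cong {L} {λ j → G (t j - t l)} {λ j → G (pos (suc m) (d ℕ.+ toℕ j))} (λ j → G-cong (shift j)) ⟩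
        sum {L} (λ j → G (pos (suc m) (d ℕ.+ toℕ j)))
          ≈⟨ sum≈partialSum (λ j → G (pos (suc m) (d ℕ.+ j))) L ⟩
        partialSum (λ j → G (pos (suc m) (d ℕ.+ j))) L
          ≤⟨ window≤partialSum (λ i → 0≤G (pos (suc m) i)) d (ℕ.+-monoˡ-≤ L (ℕ.m∸n≤m L (toℕ l))) ⟩
        W ∎
        where
        d : ℕ
        d = L ℕ.∸ toℕ l
        shift : ∀ j → t j - t l ≈ pos (suc m) (d ℕ.+ toℕ j)
        shift j = ≈-trans
          (solve 3 (λ T x y → T :* x :- T :* y := T :* (x :- y)) ≈-refl T (fromℚ (fromℕ (toℕ j) ℚ.* ½^ m)) (fromℚ (fromℕ (toℕ l) ℚ.* ½^ m)))
          (*-congˡ (pointwise⇒≈ λ _ → sym (node-shift m (toℕ j) (toℕ l) d (ℕ.m+[n∸m]≡n (ℕ.<⇒≤ (Fin.toℕ<n l))))))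

    private
      s : ℝ
      s = fromℚ ℚ.½ * ∑a²

      0≤s : 0ℝ ≤ s
      0≤s = *-nonNeg (fromℚ-mono (ℚ.<⇒≤ (ℚ.positive⁻¹ ℚ.½))) (sum-nonNeg λ n → 0≤x² (a n))

    -- With M = 2 L one has L ∑ a² = M s. Summing the tangent at s over the M nodes, whose slope q
    -- s^p is non-negative, gives at least q s^p M s - p M s^q = M s^q, because q = p + 1.
    power-sum≥ : ∀ m → ⌜ 2^ (suc m) ⌝ * s ^ q ≤ partialSum (λ i → G (pos (suc m) i) ^ q) (2^ (suc m))
    power-sum≥ m = begin
      ⌜ M ⌝ * (s * sᵖ)
        ≈⟨ *-congʳ (⌜+⌝ L L) ⟩
      (⌜ L ⌝ + ⌜ L ⌝) * (s * sᵖ)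
        ≈⟨ rearrange ⌜ L ⌝ ⌜ p ⌝ ∑a² sᵖ ⟩
      (1ℝ + ⌜ p ⌝) * sᵖ * (⌜ L ⌝ * ∑a²) - (⌜ L ⌝ + ⌜ L ⌝) * (⌜ p ⌝ * (s * sᵖ))
        ≈⟨ +-cong (*-congʳ (*-congʳ (⌜suc⌝ p))) (neg-cong (*-congʳ (⌜+⌝ L L))) ⟨
      ⌜ q ⌝ * sᵖ * (⌜ L ⌝ * ∑a²) - ⌜ M ⌝ * (⌜ p ⌝ * (s * sᵖ))
        ≤⟨ +-monoˡ-≤ (- (⌜ M ⌝ * (⌜ p ⌝ * (s * sᵖ)))) (≤-trans
             (*-monoˡ-≤ (*-nonNeg 0≤⌜ q ⌝ (^-nonNeg 0≤s p)) (mean-square≥ m)) summed) ⟩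
      partialSum (λ i → G (pos (suc m) i) ^ q) M + ⌜ M ⌝ * (⌜ p ⌝ * (s * sᵖ)) - ⌜ M ⌝ * (⌜ p ⌝ * (s * sᵖ))
        ≈⟨ cancel (partialSum (λ i → G (pos (suc m) i) ^ q) M) (⌜ M ⌝ * (⌜ p ⌝ * (s * sᵖ))) ⟩
      partialSum (λ i → G (pos (suc m) i) ^ q) M ∎
      where
      open ≤-Reasoning
      open ℝ-Solver
      L M : ℕ
      L = 2^ m
      M = 2^ (suc m)
      sᵖ : ℝ
      sᵖ = s ^ p
      rearrange : ∀ l k e t → (l + l) * (fromℚ ℚ.½ * e * t) ≈
        (1ℝ + k) * t * (l * e) - (l + l) * (k * (fromℚ ℚ.½ * e * t))
      rearrange = solve 4 (λ l k e t → (l :+ l) :* (con ℚ.½ :* e :* t) :=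
        (con ℚ.1ℚ :+ k) :* t :* (l :* e) :- (l :+ l) :* (k :* (con ℚ.½ :* e :* t))) ≈-refl
      cancel : ∀ y z → y + z - z ≈ y
      cancel = solve 2 (λ y z → y :+ z :- z := y) ≈-refl
      summed : ⌜ q ⌝ * sᵖ * partialSum (λ i → G (pos (suc m) i)) M ≤ partialSum (λ i → G (pos (suc m) i) ^ q) M + ⌜ M ⌝ * (⌜ p ⌝ * (s * sᵖ))
      summed = begin
        ⌜ q ⌝ * sᵖ * partialSum (λ i → G (pos (suc m) i)) M
          ≈⟨ partialSum-*ˡ (⌜ q ⌝ * sᵖ) (λ i → G (pos (suc m) i)) M ⟨
        partialSum (λ i → ⌜ q ⌝ * sᵖ * G (pos (suc m) i)) M
          ≤⟨ partialSum-mono M (λ i _ → tangent≤power p (0≤G (pos (suc m) i)) 0≤s) ⟩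
        partialSum (λ i → G (pos (suc m) i) ^ q + ⌜ p ⌝ * s ^ q) M
          ≈⟨ partialSum-+ (λ i → G (pos (suc m) i) ^ q) (λ _ → ⌜ p ⌝ * s ^ q) M ⟩
        partialSum (λ i → G (pos (suc m) i) ^ q) M + partialSum (λ _ → ⌜ p ⌝ * s ^ q) M
          ≈⟨ +-congˡ (partialSum-const (⌜ p ⌝ * s ^ q) M) ⟩
        partialSum (λ i → G (pos (suc m) i) ^ q) M + ⌜ M ⌝ * (⌜ p ⌝ * s ^ q) ∎

    riemannSum≥ : ∀ m → 2ℝ * T * s ^ q ≤ riemannSum (suc m)
    riemannSum≥ m = begin
      2ℝ * T * s ^ q
        ≈⟨ *-congʳ (*-identityˡ (2ℝ * T)) ⟨
      1ℝ * (2ℝ * T) * s ^ q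
        ≈⟨ *-congʳ (*-congʳ (pointwise⇒≈ λ _ → 2^*½^ (suc m))) ⟨
      ⌜ M ⌝ * fromℚ (½^ (suc m)) * (2ℝ * T) * s ^ q
        ≈⟨ solve 5 (λ n h k T y → n :* h :* (k :* T) :* y := T :* (k :* h) :* (n :* y)) ≈-refl ⌜ M ⌝ (fromℚ (½^ (suc m))) 2ℝ T (s ^ q) ⟩
      T * (2ℝ * fromℚ (½^ (suc m))) * (⌜ M ⌝ * s ^ q)
        ≈⟨ *-congʳ (*-congˡ (fromℚ-* (fromℕ 2) (½^ (suc m)))) ⟩
      T * fromℚ (fromℕ 2 ℚ.* ½^ (suc m)) * (⌜ M ⌝ * s ^ q)
        ≤⟨ *-monoˡ-≤ (*-nonNeg (<⇒≤ 0<T) (fromℚ-mono (0≤* (0≤fromℕ 2) (0≤½^ (suc m))))) (power-sum≥ m) ⟩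
      riemannSum (suc m) ∎
      where
      open ≤-Reasoning
      open ℝ-Solver
      M : ℕ
      M = 2^ (suc m)

    2Ts^q≤∫F : 2ℝ * T * (fromℚ ℚ.½ * ∑a²) ^ q ≤ ∫F
    2Ts^q≤∫F = integral≥ riemannSum≥

-- The constant 2^-q and normalization by 2 T

fromℚ-½^ : ∀ q → fromℚ (½^ q) ≈ fromℚ ℚ.½ ^ q
fromℚ-½^ zero    = ≈-refl
fromℚ-½^ (suc q) = ≈-trans (≈-sym (fromℚ-* ℚ.½ (½^ q))) (*-congˡ (fromℚ-½^ q))

theorem1 : ∀ (q : ℕ) .{{_ : NonZero q}} →
    Σ[ c ∈ ℝ ] 0ℝ < c ×
    (∀ (N : ℕ) .{{_ : NonZero N}} (φ a : Vector ℝ N) → (∀ n → 0ℝ ≤ a n) →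
    ∀ (T : ℝ) (T>0 : 0ℝ < T) →
    Σ[ I ∈ ℝ ]
    IsLebesgueIntegral
    (λ t → ∣ sumᶜ (λ n → a n · exp ((t * φ n) · 𝕚)) ∣ᶜ ^ (2 *ℕ q))
    (- T) T I ×
    c * sum (λ n → a n ^ 2) ^ q ≤ recip (2ℝ * T) (2*-pos T>0) * I)
theorem1 zero {{q≢0}} = ⊥-elim-irr (NonZero.nonZero q≢0)
theorem1 q@(suc p) = fromℚ (½^ q)
  , mk< (½^ q) (0<½^ q) (0 , λ _ _ → ℚ.≤-reflexive (ℚ.+-identityˡ (½^ q)))
  , λ N φ a 0≤a T T>0 → ∫F φ a 0≤a T T>0 p , ∫F-isLebesgueIntegral φ a 0≤a T T>0 p , bound N φ a 0≤a T T>0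
  where
  bound : ∀ N (φ a : Vector ℝ N) (0≤a : ∀ n → 0ℝ ≤ a n) T (T>0 : 0ℝ < T) →
    fromℚ (½^ q) * sum (λ n → a n ^ 2) ^ q ≤ recip (2ℝ * T) (2*-pos T>0) * ∫F φ a 0≤a T T>0 p
  bound N φ a 0≤a T T>0 = begin
    fromℚ (½^ q) * sum (λ n → a n ^ 2) ^ q
      ≈⟨ *-cong (fromℚ-½^ q) (^-congˡ q (sum-cong {N} {λ n → a n ^ 2} {λ n → a n * a n} λ n → *-congˡ (*-identityʳ (a n)))) ⟩
    fromℚ ℚ.½ ^ q * S ^ q
      ≈⟨ ^-distrib-* (fromℚ ℚ.½) S q ⟨
    (fromℚ ℚ.½ * S) ^ q
      ≈⟨ *-identityˡ ((fromℚ ℚ.½ * S) ^ q) ⟨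
    1ℝ * (fromℚ ℚ.½ * S) ^ q
      ≈⟨ *-congʳ (≈-trans (*-comm r (2ℝ * T)) (recip-inverseʳ (2ℝ * T) (2*-pos T>0))) ⟨
    r * (2ℝ * T) * (fromℚ ℚ.½ * S) ^ q
      ≈⟨ *-assoc r (2ℝ * T) ((fromℚ ℚ.½ * S) ^ q) ⟩
    r * (2ℝ * T * (fromℚ ℚ.½ * S) ^ q)
      ≤⟨ *-monoˡ-≤ (recip-nonNeg (2ℝ * T) (2*-pos T>0)) (2Ts^q≤∫F φ a 0≤a T T>0 p) ⟩
    r * ∫F φ a 0≤a T T>0 p ∎
    where
    open ≤-Reasoning
    S r : ℝ
    S = ∑a² φ a 0≤a
    r = recip (2ℝ * T) (2*-pos T>0)
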